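{- For any $P\in\mathcal{P}_{k,n}$, one has $g_P(q)=q^{k(n-k)}$.
   Context: Let $n\ge 1$, $0\le k\le n$, $[n]=\{1,\dots,n\}$. An $n$-periodic affine permutation is a bijection $f:\mathbb{Z}\to\mathbb{Z}$ with $f(i+n)=f(i)+n$ for all $i$. $\mathbf{B}_{k,n}$ is the set of those with $\frac1n\sum_{i=1}^n(f(i)-i)=k$ and $i\le f(i)\le i+n$ for all $i$. The length is $\ell(f)=\#\{(a,b): a\in[n],\,b\in\mathbb{Z},\,a<b,\,f(a)>f(b)\}$. Lattice paths: $\mathcal{P}_{k,n}$ is the set of lattice paths $P$ from $(0,0)$ to $(n-k,k)$ with unit steps $P_1,\dots,P_n\in\{\mathrm R,\mathrm U\}$ (right, up). Extend $P$ to a bi-infinite path with steps indexed by $\mathbb{Z}$ via $P_{i+n}=P_i$ (step $1$ starts at $(0,0)$); it is invariant under translation by $(n-k,k)$. The strip of $P$ is the region between the extended path $P$ (southern boundary) and its translate $P+(0,k)$ (northern boundary). On each boundary the unit edges are labeled by $\mathbb{Z}$: the southern edge labeled $i$ is step $i$ of $P$, and the northern edge labeled $i$ is its translate by $(0,k)$. Fillings: a periodic filling assigns to each unit box of the strip a crossing or an elbow, invariantly under translation by $(n-k,k)$. Strands enter at the northern boundary edges and travel right/down: in a crossing box a strand entering from the left exits right and one entering from the top exits at the bottom; in an elbow box a strand entering from the left exits at the bottom and one entering from the top exits right. Each strand ends at a southern boundary edge; the strand permutation sends $i$ to $j$ if the strand entering at northern edge $i$ exits at southern edge $j$. (If $k\in\{0,n\}$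 the strip has no boxes and each strand exits at the edge where it enters.) $\operatorname{Deo}_{f,P}$ is the set of $(f,P)$-affine Deograms: periodic fillings with strand permutation $f$ such that whenever two strands form an elbow in a box, they have crossed each other an even number of times in boxes traversed before it (counting from the northern boundary). For $A\in\operatorname{Deo}_{f,P}$, $\#\mathrm{elbows}(A)$ and $\#\mathrm{crossings}(A)$ are counted modulo translation by $(n-k,k)$ (their sum is $k(n-k)$). Put $$R_{f,\tau_P}(q)=\sum_{A\in\operatorname{Deo}_{f,P}}(q-1)^{\#\mathrm{elbows}(A)}\,q^{(\#\mathrm{crossings}(A)-\ell(f))/2},\qquad g_P(q)=\sum_{f\in\mathbf{B}_{k,n}}R_{f,\tau_P}(q).$$ (By a theorem of Billig–Dyer, for $q$ a prime power $R_{f,\tau_P}(q)$ is also the number of $\mathbb{F}_q$-points of the locus in the open positroid variety $\Pi^\circ_f\subset\operatorname{Gr}(k,n)$ where the Plücker coordinate indexed by the positions of the up-steps of $P$ is nonzero.) -}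

module Defs where

open import Level using (Level)
open import Algebra.Bundles using (CommutativeRing)
import Algebra.Properties.Semiring.Exp as Exp
open import Data.Fin.Base using (Fin; toℕ; fromℕ<)
import Data.Fin.Properties as Fin
open import Data.Integer.Base using (ℤ; +_; _+_; _-_; _*_; _≤_; _<_; 1ℤ; 0ℤ; +≤+; +<+)
  renaming (suc to sucℤ)
open import Data.Integer.DivMod using (_/ℕ_; _%ℕ_; n%ℕd<d; a≡a%ℕn+[a/ℕn]*n; [n/ℕd]*d≤n; n<s[n/ℕd]*d)
import Data.Integer.Properties as ℤ
import Algebra.Properties.AbelianGroup ℤ.+-0-abelianGroup as ℤ+
open import Data.Integer.Tactic.RingSolver using (solve-∀)
open import Data.List.Base using (List; []; _∷_; map; filter; foldr; length; take; lookup; allFin; cartesianProduct; cartesianProductWith)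
open import Data.List.Membership.DecPropositional using (_∈?_)
open import Data.Nat.Base as ℕ using (ℕ; zero; suc; _∸_)
open import Data.Nat.Divisibility using (_∣_; _∣?_)
import Data.Nat.Properties as ℕ
open import Data.Product.Base using (∃; _×_; _,_; proj₁; proj₂)
open import Data.Product.Properties using () renaming (≡-dec to ×-≡-dec)
open import Data.Vec.Base as Vec using (Vec; []; _∷_; count)
open import Function.Base using (_∘_)
open import Function.Definitions using (Injective; Surjective; Bijective)
open import Relation.Binary.Definitions using (DecidableEquality)
open import Relation.Binary.PropositionalEquality using (_≡_; refl; sym; trans; cong; cong₂; subst; module ≡-Reasoning)
open import Relation.Nullary.Decidable.Core using (Dec; yes; no; map′; _×-dec_; _→-dec_)

private variable
  a : Level
  A : Set a

words : List A → (m : ℕ) → List (Vec A m)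
words xs zero    = [] ∷ []
words xs (suc m) = cartesianProductWith _∷_ xs (words xs m)

sumℤ : List ℤ → ℤ
sumℤ = foldr _+_ 0ℤ

-- Fin n stands for [n] = {1,…,n}, and for ℤ modulo n, through s ↦ label s.
label : ∀ {n} → Fin n → ℤ
label s = + suc (toℕ s)

[1⋯_] : ℕ → List ℤ
[1⋯ n ] = map label (allFin n)

module _ {n : ℕ} .{{_ : ℕ.NonZero n}} where

  residue : ℤ → Fin n
  residue i = fromℕ< (n%ℕd<d (i - 1ℤ) n)

  period : ℤ → ℤ
  period i = (i - 1ℤ) /ℕ n

/ℕ-unique : ∀ n .{{_ : ℕ.NonZero n}} i q → q * + n ≤ i → i < sucℤ q * + n → i /ℕ n ≡ q
/ℕ-unique n@(suc _) i q lo hi = ℤ.≤-antisym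
  (below (ℤ.≤-<-trans ([n/ℕd]*d≤n i n) hi))
  (below (ℤ.≤-<-trans lo (n<s[n/ℕd]*d i n)))
  where
  below : ∀ {u v} → u * + n < sucℤ v * + n → u ≤ v
  below {u} {v} lt = subst (u ≤_) (ℤ.pred-suc v) (ℤ.i<j⇒i≤pred[j] (ℤ.*-cancelʳ-<-nonNeg {u} {sucℤ v} (+ n) lt))

module _ {n : ℕ} .{{_ : ℕ.NonZero n}} where

  label-split : ∀ i → i ≡ label (residue {n} i) + period {n} i * + n
  label-split i = begin
    i                                                    ≡⟨ solve-eq i ⟩
    1ℤ + (i - 1ℤ)                                        ≡⟨ cong (λ j → 1ℤ + j) (a≡a%ℕn+[a/ℕn]*n (i - 1ℤ) n) ⟩
    1ℤ + (+ ((i - 1ℤ) %ℕ n) + period {n} i * + n)        ≡⟨ ℤ.+-assoc 1ℤ (+ ((i - 1ℤ) %ℕ n)) (period {n} i * + n) ⟨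
    + suc ((i - 1ℤ) %ℕ n) + period {n} i * + n           ≡⟨ cong (λ r → + suc r + period {n} i * + n) (Fin.toℕ-fromℕ< (n%ℕd<d (i - 1ℤ) n)) ⟨
    label (residue {n} i) + period {n} i * + n           ∎
    where
    open ≡-Reasoning
    solve-eq : ∀ j → j ≡ 1ℤ + (j - 1ℤ)
    solve-eq = solve-∀

  period-label : ∀ (s : Fin n) m → period {n} (label s + m * + n) ≡ m
  period-label s m = /ℕ-unique n _ m
    (ℤ.≤-trans (ℤ.i≤j+i _ (+ toℕ s)) (ℤ.≤-reflexive (sym (shape (+ toℕ s) (m * + n)))))
    (ℤ.≤-<-trans (ℤ.≤-reflexive (shape (+ toℕ s) (m * + n)))
      (ℤ.<-≤-trans (ℤ.+-monoˡ-< (m * + n) (+<+ (Fin.toℕ<n s)))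
        (ℤ.≤-reflexive (sym (ℤ.suc-* m (+ n))))))
    where
    shape : ∀ t u → (1ℤ + t + u) - 1ℤ ≡ t + u
    shape = solve-∀

  residue-label : ∀ (s : Fin n) m → residue {n} (label s + m * + n) ≡ s
  residue-label s m = Fin.toℕ-injective (ℕ.suc-injective (ℤ.+-injective
    (ℤ+.∙-cancelʳ (m * + n) _ _ (begin
      label (residue {n} i) + m * + n            ≡⟨ cong (λ p → label (residue {n} i) + p * + n) (period-label s m) ⟨
      label (residue {n} i) + period {n} i * + n ≡⟨ label-split i ⟨
      i                                          ∎))))
    where
    open ≡-Reasoning
    i = label s + m * + n

  residue-+ : ∀ i m → residue {n} (i + m * + n) ≡ residue {n} i
  residue-+ i m = begin
    residue {n} (i + m * + n)                                          ≡⟨ cong (λ j → residue {n} (j + m * + n)) (label-split i) ⟩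
    residue {n} (label (residue {n} i) + period {n} i * + n + m * + n) ≡⟨ cong (residue {n}) (shape (label (residue {n} i)) (period {n} i) m (+ n)) ⟩
    residue {n} (label (residue {n} i) + (period {n} i + m) * + n)     ≡⟨ residue-label (residue {n} i) (period {n} i + m) ⟩
    residue {n} i                                                      ∎
    where
    open ≡-Reasoning
    shape : ∀ t u v w → t + u * w + v * w ≡ t + (u + v) * w
    shape = solve-∀

record IsBounded (n k : ℕ) (f : ℤ → ℤ) : Set where
  field
    periodic  : ∀ i → f (i + + n) ≡ f i + + n
    bijective : Bijective _≡_ _≡_ f
    -- (1/n) Σ (f(i) - i) = k with the denominator cleared.
    average   : sumℤ (map (λ i → f i - i) [1⋯ n ]) ≡ + n * + k
    lower     : ∀ i → i ≤ f i
    upper     : ∀ i → f i ≤ i + + n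

module _ {n : ℕ} .{{_ : ℕ.NonZero n}} where

  -- The n-periodic map with offsets f(i) - i, i ∈ [n], listed in d.
  extend : Vec (Fin (suc n)) n → ℤ → ℤ
  extend d i = i + + toℕ (Vec.lookup d (residue i))

  module _ (d : Vec (Fin (suc n)) n) where

    private f = extend d

    extend-+ : ∀ i m → f (i + m * + n) ≡ f i + m * + n
    extend-+ i m rewrite residue-+ {n} i m = shape i (m * + n) (+ toℕ (Vec.lookup d (residue i)))
      where
      shape : ∀ t u v → t + u + v ≡ t + v + u
      shape = solve-∀

    extend-split : ∀ i → f i ≡ f (label (residue {n} i)) + period {n} i * + n
    extend-split i = trans (cong f (label-split {n} i)) (extend-+ (label (residue {n} i)) (period {n} i))

    extend-residue : ∀ i → residue {n} (f (label (residue {n} i))) ≡ residue {n} (f i)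
    extend-residue i = sym (trans (cong (residue {n}) (extend-split i)) (residue-+ {n} (f (label (residue {n} i))) (period {n} i)))

    label-residue : ∀ (s : Fin n) → residue {n} (label s) ≡ s
    label-residue s = trans (cong (residue {n}) (sym (ℤ.+-identityʳ (label s)))) (residue-label s 0ℤ)

    extend-injective? : Dec (Injective _≡_ _≡_ f)
    extend-injective? = map′ to from (Fin.all? λ s → Fin.all? λ t →
      (residue {n} (f (label s)) Fin.≟ residue {n} (f (label t))) →-dec (s Fin.≟ t))
      where
      to : (∀ s t → residue {n} (f (label s)) ≡ residue {n} (f (label t)) → s ≡ t) → Injective _≡_ _≡_ f
      to inj {x} {y} fx≡fy = begin
        x                                          ≡⟨ label-split {n} x ⟩
        label (residue {n} x) + period {n} x * + n ≡⟨ cong₂ (λ s u → label s + u) same shift ⟩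
        label (residue {n} y) + period {n} y * + n ≡⟨ label-split {n} y ⟨
        y                                          ∎
        where
        open ≡-Reasoning
        same : residue {n} x ≡ residue {n} y
        same = inj _ _ (trans (extend-residue x) (trans (cong (residue {n}) fx≡fy) (sym (extend-residue y))))
        shift : period {n} x * + n ≡ period {n} y * + n
        shift = ℤ+.∙-cancelˡ (f (label (residue {n} x))) _ _ (begin
          f (label (residue {n} x)) + period {n} x * + n ≡⟨ extend-split x ⟨
          f x                                            ≡⟨ fx≡fy ⟩
          f y                                            ≡⟨ extend-split y ⟩
          f (label (residue {n} y)) + period {n} y * + n ≡⟨ cong (λ s → f (label s) + period {n} y * + n) same ⟨
          f (label (residue {n} x)) + period {n} y * + n ∎)

      from : Injective _≡_ _≡_ f → ∀ s t → residue {n} (f (label s)) ≡ residue {n} (f (label t)) → s ≡ t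
      from inj s t eq = begin
        s                                   ≡⟨ residue-label s (v - u) ⟨
        residue {n} (label s + (v - u) * + n) ≡⟨ cong (residue {n}) (inj {label s + (v - u) * + n} {label t} (begin
          f (label s + (v - u) * + n)                          ≡⟨ extend-+ (label s) (v - u) ⟩
          f (label s) + (v - u) * + n                          ≡⟨ cong (_+ (v - u) * + n) (label-split {n} (f (label s))) ⟩
          label (residue {n} (f (label s))) + u * + n + (v - u) * + n ≡⟨ shape (label (residue {n} (f (label s)))) u v (+ n) ⟩
          label (residue {n} (f (label s))) + v * + n          ≡⟨ cong (λ r → label r + v * + n) eq ⟩
          label (residue {n} (f (label t))) + v * + n          ≡⟨ label-split {n} (f (label t)) ⟨
          f (label t)                                          ∎)) ⟩
        residue {n} (label t)               ≡⟨ label-residue t ⟩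
        t                                   ∎
        where
        open ≡-Reasoning
        u = period {n} (f (label s))
        v = period {n} (f (label t))
        shape : ∀ w u v z → w + u * z + (v - u) * z ≡ w + v * z
        shape = solve-∀

    extend-surjective? : Dec (Surjective _≡_ _≡_ f)
    extend-surjective? = map′ to from (Fin.all? λ r → Fin.any? λ s → residue {n} (f (label s)) Fin.≟ r)
      where
      to : (∀ r → ∃ λ s → residue {n} (f (label s)) ≡ r) → Surjective _≡_ _≡_ f
      to sur y with s , eq ← sur (residue {n} y) = label s + (v - u) * + n , λ { refl → begin
          f (label s + (v - u) * + n)                          ≡⟨ extend-+ (label s) (v - u) ⟩
          f (label s) + (v - u) * + n                          ≡⟨ cong (_+ (v - u) * + n) (label-split {n} (f (label s))) ⟩
          label (residue {n} (f (label s))) + u * + n + (v - u) * + n ≡⟨ shape (label (residue {n} (f (label s)))) u v (+ n) ⟩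
          label (residue {n} (f (label s))) + v * + n          ≡⟨ cong (λ r → label r + v * + n) eq ⟩
          label (residue {n} y) + v * + n                      ≡⟨ label-split {n} y ⟨
          y                                                    ∎ }
        where
        open ≡-Reasoning
        u = period {n} (f (label s))
        v = period {n} y
        shape : ∀ w u v z → w + u * z + (v - u) * z ≡ w + v * z
        shape = solve-∀

      from : Surjective _≡_ _≡_ f → ∀ r → ∃ λ s → residue {n} (f (label s)) ≡ r
      from sur r with x , fx ← sur (label r) =
        residue {n} x , trans (extend-residue x) (trans (cong (residue {n}) (fx refl)) (label-residue r))

    isBounded? : ∀ k → Dec (IsBounded n k f)
    isBounded? k = map′ to from (extend-injective? ×-dec extend-surjective? ×-dec (_ ℤ.≟ _))
      where
      Conditions : Set
      Conditions = Injective _≡_ _≡_ f × Surjective _≡_ _≡_ f ×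
                   sumℤ (map (λ i → f i - i) [1⋯ n ]) ≡ + n * + k

      to : Conditions → IsBounded n k f
      to (inj , sur , avg) = record
        { periodic  = λ i → subst (λ u → f (i + u) ≡ f i + u) (ℤ.*-identityˡ (+ n)) (extend-+ i 1ℤ)
        ; bijective = (λ {x} {y} → inj {x} {y}) , sur
        ; average   = avg
        ; lower     = λ i → ℤ.i≤i+j i _
        ; upper     = λ i → ℤ.+-monoʳ-≤ i (+≤+ (ℕ.s≤s⁻¹ (Fin.toℕ<n (Vec.lookup d (residue i)))))
        }

      from : IsBounded n k f → Conditions
      from b with (inj , sur) ← IsBounded.bijective b =
        (λ {x} {y} → inj {x} {y}) , sur , IsBounded.average b

-- By periodicity and i ≤ f(i) ≤ i + n, an element f of 𝐁 is the same thing as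
-- the word of its offsets f(i) - i ∈ {0,…,n}, i ∈ [n].
𝐁 : (n k : ℕ) .{{_ : ℕ.NonZero n}} → List (ℤ → ℤ)
𝐁 n k = map extend (filter (λ d → isBounded? d k) (words (allFin (suc n)) n))

-- For bounded f, every inversion (a , b) has a < b < a + n (inversion-near), so
-- it suffices to count b = a + j with j ∈ [n].
affineLength : ℕ → (ℤ → ℤ) → ℕ
affineLength n f = length (filter (λ (a , j) → f (a + j) ℤ.<? f a) (cartesianProduct [1⋯ n ] [1⋯ n ]))

inversion-near : ∀ {n k f} → IsBounded n k f → ∀ a b → f b < f a → b < a + + n
inversion-near bd a b fb<fa = ℤ.≤-<-trans (IsBounded.lower bd b) (ℤ.<-≤-trans fb<fa (IsBounded.upper bd a))

data Step : Set where
  R U : Step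

_≟ˢ_ : DecidableEquality Step
R ≟ˢ R = yes refl
R ≟ˢ U = no λ ()
U ≟ˢ R = no λ ()
U ≟ˢ U = yes refl

record LatticePath (n k : ℕ) : Set where
  field
    steps : Vec Step n
    ups   : count (_≟ˢ U) steps ≡ k

Point : Set
Point = ℤ × ℤ

_≟ᵖ_ : DecidableEquality Point
_≟ᵖ_ = ×-≡-dec ℤ._≟_ ℤ._≟_

-- A box is given by its lower left corner.  The edge (R , p) is the horizontal
-- and (U , p) the vertical unit edge with lower or left endpoint p.
Box Edge : Set
Box  = Point
Edge = Step × Point

_≟ᵉ_ : DecidableEquality Edge
_≟ᵉ_ = ×-≡-dec _≟ˢ_ _≟ᵖ_

left right top bottom : Box → Edge
left   c       = U , c
right  (x , y) = U , (x + 1ℤ , y)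
top    (x , y) = R , (x , y + 1ℤ)
bottom c       = R , c

data Tile : Set where
  crossing elbow : Tile

_≟ᵗ_ : DecidableEquality Tile
crossing ≟ᵗ crossing = yes refl
crossing ≟ᵗ elbow    = no λ ()
elbow    ≟ᵗ crossing = no λ ()
elbow    ≟ᵗ elbow    = yes refl

-- Strands travel right and down: across the edge e a strand passes from the box
-- boxBefore e into the box boxAfter e.
boxBefore boxAfter : Edge → Box
boxBefore (U , (x , y)) = x - 1ℤ , y
boxBefore (R , p)       = p
boxAfter  (U , p)       = p
boxAfter  (R , (x , y)) = x , y - 1ℤ

-- The edge through which a strand leaves c, given the direction of the edge
-- through which it enters c: U for the left and R for the top edge.
exitEdge : Tile → Step → Box → Edge
exitEdge crossing U c = right c
exitEdge crossing R c = bottom c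
exitEdge elbow    U c = bottom c
exitEdge elbow    R c = right c

-- The edge through which a strand enters c, given the direction of the edge
-- through which it leaves c: U for the right and R for the bottom edge.
entryEdge : Tile → Step → Box → Edge
entryEdge crossing U c = left c
entryEdge crossing R c = top c
entryEdge elbow    U c = top c
entryEdge elbow    R c = left c

module Strip {n k : ℕ} .{{_ : ℕ.NonZero n}} (P : LatticePath n k) where

  open LatticePath P

  shift : ℤ → Point → Point
  shift m (x , y) = x + m * (+ n - + k) , y + m * + k

  Translate : Point → Point → Set
  Translate p p′ = ∃ λ m → p′ ≡ shift m p

  translate? : ∀ p p′ → Dec (Translate p p′)
  translate? p@(x , y) p′@(x′ , y′) = map′ (m₀ ,_) from (p′ ≟ᵖ shift m₀ p)
    where
    m₀ = ((x′ + y′) - (x + y)) /ℕ n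

    shape : ∀ x y m u v → ((x + m * (u - v)) + (y + m * v)) - (x + y) ≡ m * u
    shape = solve-∀

    from : Translate p p′ → p′ ≡ shift m₀ p
    from (m , eq@refl) = trans eq (cong (λ m → shift m p) (sym (/ℕ-unique n _ m
      (ℤ.≤-reflexive (sym Δ))
      (ℤ.≤-<-trans (ℤ.≤-reflexive Δ) (m*n<suc[m]*n m n)))))
      where
      Δ = shape x y m (+ n) (+ k)
      m*n<suc[m]*n : ∀ m n .{{_ : ℕ.NonZero n}} → m * + n < sucℤ m * + n
      m*n<suc[m]*n m n@(suc _) = ℤ.*-monoʳ-<-pos (+ n) {m} {sucℤ m} (ℤ.suc[i]≤j⇒i<j ℤ.≤-refl)

  step : ℤ → Step
  step i = Vec.lookup steps (residue i)

  -- The starting point of step i; step 1 starts at the origin.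
  start : ℤ → Point
  start i = shift (period {n} i) (+ seen R , + seen U)
    where
    seen : Step → ℕ
    seen d = length (filter (_≟ˢ d) (take (toℕ (residue {n} i)) (Vec.toList steps)))

  _↑_ : Point → ℕ → Point
  (x , y) ↑ t = x , y + + t

  south north : ℤ → Edge
  south i = step i , start i
  north i = step i , start i ↑ k

  -- Step i of the path starts on the antidiagonal x + y = i - 1, so an edge
  -- can only be the southern, respectively northern, edge with the label below.
  southLabel northLabel : Edge → ℤ
  southLabel (_ , (x , y)) = x + y + 1ℤ
  northLabel (_ , (x , y)) = x + y + 1ℤ - + k

  southern? : ∀ e → Dec (e ≡ south (southLabel e))
  southern? e = e ≟ᵉ south (southLabel e)

  northern? : ∀ e → Dec (e ≡ north (northLabel e))
  northern? e = e ≟ᵉ north (northLabel e)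

  -- The boxes of the strip modulo translation: those lying above the right
  -- steps of the path with label in [n], in stacks of height k.
  boxes : List Box
  boxes = cartesianProductWith (λ s t → start (label s) ↑ toℕ t)
            (filter (λ s → Vec.lookup steps s ≟ˢ R) (allFin n)) (allFin k)

  Filling : Set
  Filling = Vec Tile (length boxes)

  fillings : List Filling
  fillings = words (crossing ∷ elbow ∷ []) (length boxes)

  #elbows #crossings : Filling → ℕ
  #elbows    = count (_≟ᵗ elbow)
  #crossings = count (_≟ᵗ crossing)

  module _ (A : Filling) where

    -- The value outside of the strip is irrelevant.
    tile : Box → Tile
    tile c with Fin.any? (λ p → translate? (lookup boxes p) c)
    ... | yes (p , _) = Vec.lookup A p
    ... | no  _       = crossing

    next : Edge → Edge
    next e@(d , _) with southern? e
    ... | yes _ = e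
    ... | no  _ = exitEdge (tile c) d c
      where c = boxAfter e

    advance : ℕ → Edge → Edge
    advance zero    e = e
    advance (suc m) e = advance m (next e)

    -- A strand traverses at most n - 1 boxes, so it has reached the southern
    -- boundary after n moves.
    strand : ℤ → ℤ
    strand i = southLabel (advance n (north i))

    -- The strand through e is followed backwards for at most m boxes.
    trace : ℕ → Edge → List Box
    trace zero    e = []
    trace (suc m) e@(d , _) with northern? e
    ... | yes _ = []
    ... | no  _ = c ∷ trace m (entryEdge (tile c) d c)
      where c = boxBefore e

    -- The boxes traversed, before reaching the edge e, by the strand through e;
    -- again there are at most n - 1 of them.
    history : Edge → List Box
    history = trace n

    -- The number of times that the two strands entering c have crossed before.
    priorCrossings : Box → ℕ
    priorCrossings c = length (filter (λ b → (tile b ≟ᵗ crossing) ×-dec _∈?_ _≟ᵖ_ b (history (top c)))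
                                      (history (left c)))

    -- The strand permutation and f are both n-periodic, and so is the elbow
    -- condition; hence [n] and the boxes modulo translation suffice.
    record IsDeogram (f : ℤ → ℤ) : Set where
      field
        strands : ∀ (s : Fin n) → strand (label s) ≡ f (label s)
        elbows  : ∀ (p : Fin (length boxes)) → Vec.lookup A p ≡ elbow → 2 ∣ priorCrossings (lookup boxes p)

    isDeogram? : ∀ f → Dec (IsDeogram f)
    isDeogram? f = map′
      (λ (s , e) → record { strands = s ; elbows = e })
      (λ D → IsDeogram.strands D , IsDeogram.elbows D)
      ((Fin.all? λ s → strand (label s) ℤ.≟ f (label s)) ×-dec
       (Fin.all? λ p → (Vec.lookup A p ≟ᵗ elbow) →-dec (2 ∣? priorCrossings (lookup boxes p))))

  Deo : (ℤ → ℤ) → List Filling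
  Deo f = filter (λ A → isDeogram? A f) fillings

-- The polynomials are evaluated at an element q of an arbitrary commutative
-- ring; the case of q = X in ℤ[X] is an identity of polynomials.
module Evaluation {c ℓ} (𝓡 : CommutativeRing c ℓ) where

  open CommutativeRing 𝓡 using (Carrier; 0#; 1#)
    renaming (_+_ to _+ʳ_; _*_ to _*ʳ_; _-_ to _-ʳ_)
  open Exp (CommutativeRing.semiring 𝓡) public using (_^_)

  sumʳ : List Carrier → Carrier
  sumʳ = foldr _+ʳ_ 0#

  module _ {n k : ℕ} .{{_ : ℕ.NonZero n}} (P : LatticePath n k) (q : Carrier) where

    open Strip P

    -- For A in Deo f the difference #crossings A - ℓ(f) is nonnegative and even,
    -- so the truncated operations on ℕ are exact.
    Rpoly : (ℤ → ℤ) → Carrier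
    Rpoly f = sumʳ (map (λ A → (q -ʳ 1#) ^ #elbows A
                            *ʳ q ^ ((#crossings A ∸ affineLength n f) ℕ./ 2))
                        (Deo f))

    g : Carrier
    g = sumʳ (map Rpoly (𝐁 n k))

{-# OPTIONS --safe #-}
-- Deciding the boxes of a filling A one after another along the strands, the
-- permutation is multiplied by a simple transposition at each crossing, and
-- its length changes by +1 or -1 according to whether the two strands have
-- crossed an even or an odd number of times before.  Hence #crossings A - ℓ(f)
-- is twice the number of crossings of the second kind, and the weight of A is a
-- product over its boxes: q - 1 for an elbow and 1 for a crossing after an even
-- number of crossings, 0 for an elbow and q for a crossing after an odd number.
-- In either case the two choices for a box add up to q, and whether the number
-- is even depends on the preceding boxes only, so that summing over the boxes
-- from the last to the first gives q ^ (k * (n ∸ k)).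
module Submission where

open import Defs
open import Algebra.Bundles using (CommutativeRing)
import Algebra.Properties.CommutativeMonoid.Sum as CMSum
open import Data.Bool.Base using (Bool; true; false; if_then_else_; _∧_; _xor_; not)
open import Data.Bool.Properties using (xor-assoc; xor-same; ∧-zeroʳ; ∧-identityʳ; not-involutive)
open import Data.Empty using (⊥)
open import Data.Fin.Base using (Fin; zero; suc; toℕ; fromℕ<; punchIn)
import Data.Fin.Properties as Fin
open import Data.Integer.Base using (ℤ; +_; _+_; _-_; -_; _*_; _≤_; _<_; 0ℤ; 1ℤ; +≤+; +<+; ∣_∣)
open import Data.Integer.DivMod using (_/ℕ_; _%ℕ_; a≡a%ℕn+[a/ℕn]*n)
import Data.Integer.Properties as ℤ
open import Data.Integer.Tactic.RingSolver using (solve-∀)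
open import Data.List.Base as List using (List; []; _∷_; _++_; length; filter; map; take; tabulate; allFin; cartesianProduct; cartesianProductWith)
open import Data.List.Membership.DecPropositional using (_∈?_)
open import Data.List.Membership.Propositional using (_∈_)
import Data.List.Membership.Propositional.Properties as ∈
import Data.List.Properties as List
open import Data.List.Relation.Unary.All as All using (All; []; _∷_)
import Data.List.Relation.Unary.All.Properties as All
open import Data.List.Relation.Unary.AllPairs as AllPairs using (AllPairs; []; _∷_)
import Data.List.Relation.Unary.AllPairs.Properties as AllPairs
open import Data.List.Relation.Unary.Any as Any using (here; there)
import Data.List.Relation.Unary.Any.Properties as Any
open import Data.List.Relation.Unary.Unique.Propositional using (Unique)
import Data.List.Relation.Unary.Unique.Propositional.Properties as Unique
open import Data.Nat.Base as ℕ using (ℕ; zero; suc; NonZero)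
open import Data.Nat.Divisibility using (_∣_; divides; _∣?_)
import Data.Nat.DivMod as ℕ
import Data.Nat.Properties as ℕ
import Data.Nat.Tactic.RingSolver as ℕ-Solver
open import Data.Product.Base using (∃; _×_; _,_; proj₁; proj₂)
open import Data.Product.Properties using (×-≡,≡→≡)
open import Data.Sum.Base using (_⊎_; inj₁; inj₂)
open import Data.Vec.Base as Vec using (Vec; []; _∷_; insertAt; lookup; toList; count; _[_]≔_)
import Data.Vec.Properties as Vec
open import Function.Base using (_∘_)
open import Relation.Binary.PropositionalEquality using (_≡_; _≢_; refl; sym; trans; cong; cong₂; subst; subst₂; module ≡-Reasoning)
open import Relation.Nullary using (¬_; Dec; yes; no; does; contradiction)
open import Relation.Nullary.Decidable using (dec-true; dec-false; _×-dec_; _→-dec_)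

-- Sums over words

-- A filling has exactly one strand permutation, and it always lies in `𝐁`. Exchanging the two sums
-- therefore removes the sum over f, and only the elbow condition remains. The length claim needs an
-- order in which crossings can be taken away. A linear function, constant on translates and falling
-- along strands, provides it: beyond a crossing where it is least there are only elbows, an elbow
-- keeps a strand on its antidiagonal, and so the two strands of that crossing end at neighbouring
-- southern labels. Replacing it by an elbow composes the permutation with a simple transposition of
-- the end labels and leaves the pasts of all other crossings alone. Without crossings f(i) = i + k,
-- of length 0 and average k. To see whether the length rises or falls, the induction also carries
-- that two strands are inverted iff they share an odd number of crossings. Pasts are read backwards
-- from the southern boundary, so the inverse permutation is what is traced; f itself is built up as
-- a product of transpositions.

argmin : ∀ {N} (r : Fin (suc N) → ℤ) → ∃ λ p → ∀ p′ → r p ≤ r p′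
argmin {zero}  r = zero , λ { zero → ℤ.≤-refl }
argmin {suc N} r with argmin (r ∘ suc)
... | p , min with ℤ.≤-total (r zero) (r (suc p))
...   | inj₁ r₀≤rp = zero , λ { zero → ℤ.≤-refl ; (suc p′) → ℤ.≤-trans r₀≤rp (min p′) }
...   | inj₂ rp≤r₀ = suc p , λ { zero → rp≤r₀ ; (suc p′) → min p′ }

insertAt-[]≔ : ∀ {a} {A : Set a} {N} (xs : Vec A N) p (x y : A) → insertAt xs p x [ p ]≔ y ≡ insertAt xs p y
insertAt-[]≔ xs       zero    x y = refl
insertAt-[]≔ (z ∷ xs) (suc p) x y = cong (z ∷_) (insertAt-[]≔ xs p x y)

insertAt-agree : ∀ {a} {A : Set a} {N} (xs : Vec A N) p {x y : A} {p′} → p′ ≢ p →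
                 lookup (insertAt xs p x) p′ ≡ lookup (insertAt xs p y) p′
insertAt-agree xs       zero    {p′ = zero}   p′≢p = contradiction refl p′≢p
insertAt-agree xs       zero    {p′ = suc p′} p′≢p = refl
insertAt-agree (z ∷ xs) (suc p) {p′ = zero}   p′≢p = refl
insertAt-agree (z ∷ xs) (suc p) {p′ = suc p′} p′≢p = insertAt-agree xs p (p′≢p ∘ cong suc)

module Sums {c ℓ} (𝓡 : CommutativeRing c ℓ) where

  open CommutativeRing 𝓡 hiding (zero; _-_; -_)
    renaming (_+_ to _+ʳ_; _*_ to _*ʳ_; refl to ≈-refl; sym to ≈-sym; trans to ≈-trans)
  open Evaluation 𝓡 using (sumʳ; _^_)
  open import Relation.Binary.Reasoning.Setoid setoid
  open import Algebra.Properties.CommutativeSemigroup +-commutativeSemigroup using (interchange)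
  open CMSum *-commutativeMonoid public using () renaming (sum to prod; sum-cong-≋ to prod-cong; sum-remove to prod-remove)

  infixr 5 ∑
  ∑ : ∀ {a} {A : Set a} → List A → (A → Carrier) → Carrier
  ∑ xs f = sumʳ (map f xs)

  syntax ∑ xs (λ x → e) = ∑[ x ∈ xs ] e

  module _ {a} {A : Set a} where

    ∑-cong : ∀ (xs : List A) {f g : A → Carrier} → (∀ x → f x ≈ g x) → ∑ xs f ≈ ∑ xs g
    ∑-cong []       f≈g = ≈-refl
    ∑-cong (x ∷ xs) f≈g = +-cong (f≈g x) (∑-cong xs f≈g)

    ∑-++ : ∀ (xs ys : List A) {f} → ∑ (xs ++ ys) f ≈ ∑ xs f +ʳ ∑ ys f
    ∑-++ []       ys = ≈-sym (+-identityˡ _)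
    ∑-++ (x ∷ xs) ys = ≈-trans (+-congˡ (∑-++ xs ys)) (≈-sym (+-assoc _ _ _))

    ∑-zero : ∀ (xs : List A) {f} → (∀ x → f x ≈ 0#) → ∑ xs f ≈ 0#
    ∑-zero []       f≈0 = ≈-refl
    ∑-zero (x ∷ xs) f≈0 = ≈-trans (+-cong (f≈0 x) (∑-zero xs f≈0)) (+-identityˡ _)

    ∑-+ : ∀ (xs : List A) {f g} → ∑[ x ∈ xs ] (f x +ʳ g x) ≈ ∑ xs f +ʳ ∑ xs g
    ∑-+ []       = ≈-sym (+-identityˡ _)
    ∑-+ (x ∷ xs) = ≈-trans (+-congˡ (∑-+ xs)) (interchange _ _ _ _)

    ∑-*ˡ : ∀ (xs : List A) {u f} → ∑[ x ∈ xs ] (u *ʳ f x) ≈ u *ʳ ∑ xs f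
    ∑-*ˡ []       = ≈-sym (zeroʳ _)
    ∑-*ˡ (x ∷ xs) = ≈-trans (+-congˡ (∑-*ˡ xs)) (≈-sym (distribˡ _ _ _))

    ∑-filter : ∀ {p} {P : A → Set p} (P? : ∀ x → Dec (P x)) xs {f} →
               ∑ (filter P? xs) f ≈ ∑[ x ∈ xs ] (if does (P? x) then f x else 0#)
    ∑-filter P? []       = ≈-refl
    ∑-filter P? (x ∷ xs) with does (P? x)
    ... | true  = +-congˡ (∑-filter P? xs)
    ... | false = ≈-trans (∑-filter P? xs) (≈-sym (+-identityˡ _))

  ∑-map : ∀ {a b} {A : Set a} {B : Set b} (h : B → A) xs {f} → ∑ (map h xs) f ≈ ∑[ x ∈ xs ] f (h x)
  ∑-map h xs = reflexive (cong sumʳ (sym (List.map-∘ xs)))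

  ∑-swap : ∀ {a b} {A : Set a} {B : Set b} (xs : List A) (ys : List B) (f : A → B → Carrier) →
           ∑[ x ∈ xs ] ∑[ y ∈ ys ] f x y ≈ ∑[ y ∈ ys ] ∑[ x ∈ xs ] f x y
  ∑-swap []       ys f = ≈-sym (∑-zero ys λ _ → ≈-refl)
  ∑-swap (x ∷ xs) ys f = ≈-trans (+-congˡ (∑-swap xs ys f)) (≈-sym (∑-+ ys))

  ∑-cartesianProductWith : ∀ {a b d} {A : Set a} {B : Set b} {D : Set d} (h : A → B → D) xs ys {f} →
                           ∑ (cartesianProductWith h xs ys) f ≈ ∑[ x ∈ xs ] ∑[ y ∈ ys ] f (h x y)
  ∑-cartesianProductWith h []       ys = ≈-refl
  ∑-cartesianProductWith h (x ∷ xs) ys =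
    ≈-trans (∑-++ (map (h x) ys) _) (+-cong (∑-map (h x) ys) (∑-cartesianProductWith h xs ys))

  ∑-words-suc : ∀ {a} {A : Set a} (xs : List A) N (f : Vec A (suc N) → Carrier) →
                ∑ (words xs (suc N)) f ≈ ∑[ x ∈ xs ] ∑[ A ∈ words xs N ] f (x ∷ A)
  ∑-words-suc xs N f = ∑-cartesianProductWith _∷_ xs (words xs N)

  ∑-allFin : ∀ {m} (i : Fin m) {f} → (∀ j → j ≢ i → f j ≈ 0#) → ∑ (allFin m) f ≈ f i
  ∑-allFin {suc m} i {f} f≈0 = begin
    f zero +ʳ ∑ (tabulate suc) f          ≡⟨ cong (λ xs → f zero +ʳ sumʳ (map f xs)) (List.map-tabulate (λ j → j) suc) ⟨
    f zero +ʳ ∑ (map suc (allFin m)) f    ≈⟨ +-congˡ (∑-map suc (allFin m)) ⟩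
    f zero +ʳ ∑ (allFin m) (f ∘ suc)      ≈⟨ pick i f≈0 ⟩
    f i                                  ∎
    where
    pick : ∀ i → (∀ j → j ≢ i → f j ≈ 0#) → f zero +ʳ ∑ (allFin m) (f ∘ suc) ≈ f i
    pick zero    f≈0 = ≈-trans (+-congˡ (∑-zero (allFin m) λ j → f≈0 (suc j) λ ())) (+-identityʳ _)
    pick (suc i) f≈0 = ≈-trans (+-cong (f≈0 zero λ ())
      (∑-allFin i λ j j≢i → f≈0 (suc j) (j≢i ∘ Fin.suc-injective))) (+-identityˡ _)

  -- For a fixed filling this collapses the sum over candidate permutations: only the offset word of
  -- its own strand permutation survives.
  ∑-words : ∀ {m N} (d : Vec (Fin m) N) {f} → (∀ e → e ≢ d → f e ≈ 0#) → ∑ (words (allFin m) N) f ≈ f d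
  ∑-words             []      f≈0 = +-identityʳ _
  ∑-words {m} {suc N} (x ∷ d) {f} f≈0 = begin
    ∑ (words (allFin m) (suc N)) f                         ≈⟨ ∑-words-suc (allFin m) N f ⟩
    ∑[ y ∈ allFin m ] ∑[ e ∈ words (allFin m) N ] f (y ∷ e) ≈⟨ ∑-allFin x (λ y y≢x → ∑-zero (words (allFin m) N) λ e → f≈0 (y ∷ e) (y≢x ∘ Vec.∷-injectiveˡ)) ⟩
    ∑[ e ∈ words (allFin m) N ] f (x ∷ e)                  ≈⟨ ∑-words d (λ e e≢d → f≈0 (x ∷ e) (e≢d ∘ Vec.∷-injectiveʳ)) ⟩
    f (x ∷ d)                                              ∎

  tiles : List Tile
  tiles = crossing ∷ elbow ∷ []

  ∑-insertAt : ∀ {N} (p : Fin (suc N)) {f} →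
               ∑ (words tiles (suc N)) f ≈ ∑[ A ∈ words tiles N ] (f (insertAt A p crossing) +ʳ f (insertAt A p elbow))
  ∑-insertAt {N} zero {f} = begin
    ∑ (words tiles (suc N)) f
      ≈⟨ ∑-words-suc tiles N f ⟩
    ∑[ t ∈ tiles ] ∑[ A ∈ words tiles N ] f (t ∷ A)
      ≈⟨ +-congˡ (+-identityʳ _) ⟩
    (∑[ A ∈ words tiles N ] f (crossing ∷ A)) +ʳ (∑[ A ∈ words tiles N ] f (elbow ∷ A))
      ≈⟨ ∑-+ (words tiles N) ⟨
    ∑[ A ∈ words tiles N ] (f (crossing ∷ A) +ʳ f (elbow ∷ A)) ∎
  ∑-insertAt {suc N} (suc p) {f} = begin
    ∑ (words tiles (suc (suc N))) f
      ≈⟨ ∑-words-suc tiles (suc N) f ⟩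
    ∑[ t ∈ tiles ] ∑[ A ∈ words tiles (suc N) ] f (t ∷ A)
      ≈⟨ ∑-cong tiles (λ t → ∑-insertAt p {λ A → f (t ∷ A)}) ⟩
    ∑[ t ∈ tiles ] ∑[ A ∈ words tiles N ] (f (t ∷ insertAt A p crossing) +ʳ f (t ∷ insertAt A p elbow))
      ≈⟨ ∑-words-suc tiles N (λ A → f (insertAt A (suc p) crossing) +ʳ f (insertAt A (suc p) elbow)) ⟨
    ∑[ A ∈ words tiles (suc N) ] (f (insertAt A (suc p) crossing) +ʳ f (insertAt A (suc p) elbow)) ∎

  -- Summing first over the tile at a position p of least rank, on which only
  -- the factor at p depends, splits off a factor q.
  triangular : ∀ N (rank : Fin N → ℤ) (w : Fin N → Vec Tile N → Carrier) (q : Carrier) →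
    (∀ p A B → lookup A p ≡ lookup B p → (∀ p′ → rank p < rank p′ → lookup A p′ ≡ lookup B p′) → w p A ≈ w p B) →
    (∀ p A → w p (A [ p ]≔ crossing) +ʳ w p (A [ p ]≔ elbow) ≈ q) →
    ∑[ A ∈ words tiles N ] prod (λ p → w p A) ≈ q ^ N
  triangular zero    rank w q local total = +-identityʳ 1#
  triangular (suc N) rank w q local total with argmin rank
  ... | p , least = begin
    ∑[ A ∈ words tiles (suc N) ] prod (λ p′ → w p′ A)
      ≈⟨ ∑-insertAt p ⟩
    ∑[ A ∈ words tiles N ] (prod (λ p′ → w p′ (insertAt A p crossing)) +ʳ prod (λ p′ → w p′ (insertAt A p elbow)))
      ≈⟨ ∑-cong (words tiles N) split ⟩
    ∑[ A ∈ words tiles N ] (q *ʳ prod (λ p′ → w′ p′ A))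
      ≈⟨ ∑-*ˡ (words tiles N) ⟩
    q *ʳ (∑[ A ∈ words tiles N ] prod (λ p′ → w′ p′ A))
      ≈⟨ *-congˡ (triangular N (rank ∘ punchIn p) w′ q local′ total′) ⟩
    q *ʳ q ^ N ∎
    where
    -- The tile `crossing` is an arbitrary default: since p has least rank, no other factor sees the
    -- tile there.
    w′ : Fin N → Vec Tile N → Carrier
    w′ p′ A = w (punchIn p p′) (insertAt A p crossing)

    at : ∀ A t p′ → lookup (insertAt A p t) (punchIn p p′) ≡ lookup A p′
    at A t p′ = Vec.insertAt-punchIn A p t p′

    factor : ∀ A t → prod (λ p′ → w p′ (insertAt A p t)) ≈ w p (insertAt A p t) *ʳ prod (λ p′ → w′ p′ A)
    factor A t = ≈-trans (prod-remove {i = p} (λ p′ → w p′ (insertAt A p t))) (*-congˡ (prod-cong λ p′ →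
      local (punchIn p p′) _ _ (trans (at A t p′) (sym (at A crossing p′)))
        λ p″ lt → insertAt-agree A p λ { refl → ℤ.<⇒≱ lt (least _) }))

    split : ∀ A → prod (λ p′ → w p′ (insertAt A p crossing)) +ʳ prod (λ p′ → w p′ (insertAt A p elbow)) ≈
                  q *ʳ prod (λ p′ → w′ p′ A)
    split A = begin
      prod (λ p′ → w p′ (insertAt A p crossing)) +ʳ prod (λ p′ → w p′ (insertAt A p elbow))
        ≈⟨ +-cong (factor A crossing) (factor A elbow) ⟩
      w p (insertAt A p crossing) *ʳ prod (λ p′ → w′ p′ A) +ʳ w p (insertAt A p elbow) *ʳ prod (λ p′ → w′ p′ A)
        ≈⟨ distribʳ _ _ _ ⟨
      (w p (insertAt A p crossing) +ʳ w p (insertAt A p elbow)) *ʳ prod (λ p′ → w′ p′ A)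
        ≡⟨ cong₂ (λ B C → (w p B +ʳ w p C) *ʳ prod (λ p′ → w′ p′ A)) (insertAt-[]≔ A p crossing crossing) (insertAt-[]≔ A p crossing elbow) ⟨
      (w p (insertAt A p crossing [ p ]≔ crossing) +ʳ w p (insertAt A p crossing [ p ]≔ elbow)) *ʳ prod (λ p′ → w′ p′ A)
        ≈⟨ *-congʳ (total p (insertAt A p crossing)) ⟩
      q *ʳ prod (λ p′ → w′ p′ A) ∎

    local′ : ∀ p′ A B → lookup A p′ ≡ lookup B p′ →
             (∀ p″ → rank (punchIn p p′) < rank (punchIn p p″) → lookup A p″ ≡ lookup B p″) → w′ p′ A ≈ w′ p′ B
    local′ p′ A B eq above = local (punchIn p p′) _ _ (trans (at A crossing p′) (trans eq (sym (at B crossing p′)))) agree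
      where
      agree : ∀ p″ → rank (punchIn p p′) < rank p″ → lookup (insertAt A p crossing) p″ ≡ lookup (insertAt B p crossing) p″
      agree p″ lt with p Fin.≟ p″
      ... | yes refl = trans (Vec.insertAt-lookup A p crossing) (sym (Vec.insertAt-lookup B p crossing))
      ... | no  p≢p″ with Fin.punchIn-punchOut p≢p″
      ...   | eq′ = subst (λ i → lookup (insertAt A p crossing) i ≡ lookup (insertAt B p crossing) i) eq′
        (trans (at A crossing _) (trans (above _ (subst (λ i → rank (punchIn p p′) < rank i) (sym eq′) lt)) (sym (at B crossing _))))

    total′ : ∀ p′ A → w′ p′ (A [ p′ ]≔ crossing) +ʳ w′ p′ (A [ p′ ]≔ elbow) ≈ q
    total′ p′ A = subst₂ (λ B C → w (punchIn p p′) B +ʳ w (punchIn p p′) C ≈ q)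
      (update A p p′) (update A p p′) (total (punchIn p p′) (insertAt A p crossing))
      where
      update : ∀ {a} {A : Set a} {N} (xs : Vec A N) p p′ {x y} → insertAt xs p x [ punchIn p p′ ]≔ y ≡ insertAt (xs [ p′ ]≔ y) p x
      update xs       zero    p′       = refl
      update (z ∷ xs) (suc p) zero     = refl
      update (z ∷ xs) (suc p) (suc p′) = cong (z ∷_) (update xs p p′)

-- Linear inequalities between integers

infixl 6 _⊕_
_⊕_ : ∀ {a b c d} → a ≤ b → c ≤ d → a + c ≤ b + d
_⊕_ = ℤ.+-mono-≤

-- A certificate for linear arithmetic. The hypotheses are added up with `_⊕_` to a ≤ b, and the
-- identity, usually left to the ring solver, states that d - c equals b - a.
≤-by : ∀ {a b} c d → a ≤ b → d + a ≡ c + b → c ≤ d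
≤-by {a} {b} c d a≤b eq = ℤ.0≤i-j⇒j≤i (subst (0ℤ ≤_) difference (ℤ.i≤j⇒0≤j-i a≤b))
  where
  open ≡-Reasoning
  difference : b - a ≡ d - c
  difference = begin
    b - a           ≡⟨ grow a b c ⟩
    c + b - c - a   ≡⟨ cong (λ u → u - c - a) eq ⟨
    d + a - c - a   ≡⟨ shrink a c d ⟩
    d - c           ∎
    where
    grow : ∀ a b c → b - a ≡ c + b - c - a
    grow = solve-∀
    shrink : ∀ a c d → d + a - c - a ≡ d - c
    shrink = solve-∀

absurd-by : ∀ {a b} → a ≤ b → a ≡ b + 1ℤ → ⊥
absurd-by {a} {b} a≤b eq with ≤-by 1ℤ 0ℤ a≤b (trans (ℤ.+-identityˡ a) (trans eq (ℤ.+-comm b 1ℤ)))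
... | +≤+ ()

-- Strict inequalities are mostly kept in the form u + 1ℤ ≤ v, so that they too can be added with
-- `_⊕_`.
≰⇒+1≤ : ∀ {a b} → ¬ a ≤ b → b + 1ℤ ≤ a
≰⇒+1≤ {a} {b} a≰b = subst (_≤ a) (ℤ.+-comm 1ℤ b) (ℤ.i<j⇒suc[i]≤j (ℤ.≰⇒> a≰b))

i≤i+1 : ∀ i → i ≤ i + 1ℤ
i≤i+1 i = ℤ.i≤i+j i 1ℤ

upTo : ∀ {a b} → a ≤ b → ∃ λ m → b ≡ a + + m
upTo {a} {b} a≤b = ∣ b - a ∣ , trans (sub a b) (cong (λ u → a + u) (sym (ℤ.0≤i⇒+∣i∣≡i (ℤ.i≤j⇒0≤j-i a≤b))))
  where
  sub : ∀ a b → b ≡ a + (b - a)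
  sub = solve-∀

-- Lattice paths and the strip

module _ (d : Step) where

  -- By unfolding, the count that is local to `start`, now available for every t up to and including
  -- the end of a period.
  occurrences : ∀ {m} → Vec Step m → ℕ → ℕ
  occurrences v t = length (filter (_≟ˢ d) (take t (toList v)))

  occurrences-suc : ∀ {m} (v : Vec Step m) s →
    occurrences v (suc (toℕ s)) ≡ occurrences v (toℕ s) ℕ.+ (if does (lookup v s ≟ˢ d) then 1 else 0)
  occurrences-suc (x ∷ v) zero with does (x ≟ˢ d)
  ... | true  = refl
  ... | false = refl
  occurrences-suc (x ∷ v) (suc s) with does (x ≟ˢ d)
  ... | true  = cong suc (occurrences-suc v s)
  ... | false = occurrences-suc v s

  occurrences-all : ∀ {m} (v : Vec Step m) → occurrences v m ≡ count (_≟ˢ d) v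
  occurrences-all []      = refl
  occurrences-all (x ∷ v) with does (x ≟ˢ d)
  ... | true  = cong suc (occurrences-all v)
  ... | false = occurrences-all v

occurrences-total : ∀ {m} (v : Vec Step m) t → t ℕ.≤ m → occurrences R v t ℕ.+ occurrences U v t ≡ t
occurrences-total v       zero    _ = refl
occurrences-total (R ∷ v) (suc t) (ℕ.s≤s t≤m) = cong suc (occurrences-total v t t≤m)
occurrences-total (U ∷ v) (suc t) (ℕ.s≤s t≤m) =
  trans (ℕ.+-suc (occurrences R v t) (occurrences U v t)) (cong suc (occurrences-total v t t≤m))

move : Step → Point → Point
move R (x , y) = x + 1ℤ , y
move U (x , y) = x , y + 1ℤ

module PathGeometry {n k : ℕ} .{{_ : NonZero n}} (P : LatticePath n k) where

  open LatticePath P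
  open Strip P

  seen : Step → ℕ → ℕ
  seen d t = occurrences d steps t

  -- `start` only meets t < n. Allowing t = n gives a name to the end of a period, and `place-wrap`
  -- identifies it with the beginning of the next.
  place : ℤ → ℕ → Point
  place m t = shift m (+ seen R t , + seen U t)

  start-label : ∀ (s : Fin n) m → start (label s + m * + n) ≡ place m (toℕ s)
  start-label s m = cong₂ (λ u r → place u (toℕ r)) (period-label s m) (residue-label s m)

  step-label : ∀ (s : Fin n) m → step (label s + m * + n) ≡ lookup steps s
  step-label s m = cong (lookup steps) (residue-label s m)

  seen-U : seen U n ≡ k
  seen-U = trans (occurrences-all U steps) ups

  seen-R : seen R n ℕ.+ k ≡ n
  seen-R = trans (cong (seen R n ℕ.+_) (sym seen-U)) (occurrences-total steps n ℕ.≤-refl)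

  place-wrap : ∀ m → place m n ≡ place (m + 1ℤ) 0
  place-wrap m = ×-≡,≡→≡ (subst (λ u → + seen R n + m * (u - + k) ≡ 0ℤ + (m + 1ℤ) * (u - + k)) (cong +_ seen-R) (across (+ seen R n) (+ k) m) ,
                          trans (cong (λ u → + u + m * + k) seen-U) (up (+ k) m))
    where
    across : ∀ a k m → a + m * (a + k - k) ≡ 0ℤ + (m + 1ℤ) * (a + k - k)
    across = solve-∀
    up : ∀ k m → k + m * k ≡ 0ℤ + (m + 1ℤ) * k
    up = solve-∀

  start-next : ∀ (s : Fin n) m → start (label s + m * + n + 1ℤ) ≡ place m (suc (toℕ s))
  start-next s m with suc (toℕ s) ℕ.<? n
  ... | yes s+1<n = begin
    start (label s + m * + n + 1ℤ)                ≡⟨ cong start (trans (swap (label s) (m * + n)) (cong (λ t → + suc t + m * + n) (sym (trans (Fin.toℕ-fromℕ< s+1<n) (ℕ.+-comm 1 (toℕ s)))))) ⟩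
    start (label (fromℕ< s+1<n) + m * + n)        ≡⟨ start-label (fromℕ< s+1<n) m ⟩
    place m (toℕ (fromℕ< s+1<n))                  ≡⟨ cong (place m) (Fin.toℕ-fromℕ< s+1<n) ⟩
    place m (suc (toℕ s))                         ∎
    where
    open ≡-Reasoning
    swap : ∀ u v → u + v + 1ℤ ≡ u + 1ℤ + v
    swap = solve-∀
  ... | no  s+1≮n = begin
    start (label s + m * + n + 1ℤ)                ≡⟨ cong start (trans (cong (λ u → + u + m * + n + 1ℤ) last) (wrap (+ n) m)) ⟩
    start (1ℤ + (m + 1ℤ) * + n)                   ≡⟨ cong (λ t → start (+ suc t + (m + 1ℤ) * + n)) (Fin.toℕ-fromℕ< 0<n) ⟨
    start (label (fromℕ< 0<n) + (m + 1ℤ) * + n)   ≡⟨ start-label (fromℕ< 0<n) (m + 1ℤ) ⟩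
    place (m + 1ℤ) (toℕ (fromℕ< 0<n))             ≡⟨ cong (place (m + 1ℤ)) (Fin.toℕ-fromℕ< 0<n) ⟩
    place (m + 1ℤ) 0                              ≡⟨ place-wrap m ⟨
    place m n                                     ≡⟨ cong (place m) last ⟨
    place m (suc (toℕ s))                         ∎
    where
    open ≡-Reasoning
    0<n : 0 ℕ.< n
    0<n = ℕ.>-nonZero⁻¹ n
    last : suc (toℕ s) ≡ n
    last = ℕ.≤-antisym (Fin.toℕ<n s) (ℕ.≮⇒≥ s+1≮n)
    wrap : ∀ n m → n + m * n + 1ℤ ≡ 1ℤ + (m + 1ℤ) * n
    wrap = solve-∀

  start-suc : ∀ i → start (i + 1ℤ) ≡ move (step i) (start i)
  start-suc i = subst (λ j → start (j + 1ℤ) ≡ move (step j) (start j)) (sym (label-split {n} i))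
                  (at (residue i) (period {n} i))
    where
    shape : ∀ u v → u + 1ℤ + v ≡ u + v + 1ℤ
    shape = solve-∀
    at : ∀ (s : Fin n) m → start (label s + m * + n + 1ℤ) ≡ move (step (label s + m * + n)) (start (label s + m * + n))
    at s m rewrite start-next s m | start-label s m | step-label s m
                 | occurrences-suc R steps s | occurrences-suc U steps s with lookup steps s
    ... | R = cong₂ _,_ (shape (+ seen R (toℕ s)) (m * (+ n - + k))) (cong (λ u → + u + m * + k) (ℕ.+-identityʳ _))
    ... | U = cong₂ _,_ (cong (λ u → + u + m * (+ n - + k)) (ℕ.+-identityʳ _)) (shape (+ seen U (toℕ s)) (m * + k))

  start-+ : ∀ i m → start (i + m * + n) ≡ shift m (start i)
  start-+ i m = begin
    start (i + m * + n)                                        ≡⟨ cong (λ j → start (j + m * + n)) (label-split {n} i) ⟩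
    start (label (residue {n} i) + p * + n + m * + n)          ≡⟨ cong start (regroup (label (residue {n} i)) p m (+ n)) ⟩
    start (label (residue {n} i) + (p + m) * + n)              ≡⟨ start-label (residue i) (p + m) ⟩
    place (p + m) (toℕ (residue {n} i))                        ≡⟨ cong₂ _,_ (split (+ seen R (toℕ (residue {n} i))) p m (+ n - + k)) (split (+ seen U (toℕ (residue {n} i))) p m (+ k)) ⟩
    shift m (start i)                                          ∎
    where
    open ≡-Reasoning
    p = period {n} i
    regroup : ∀ t u v w → t + u * w + v * w ≡ t + (u + v) * w
    regroup = solve-∀
    split : ∀ a p m w → a + (p + m) * w ≡ a + p * w + m * w
    split = solve-∀

  abstract
    X Y : ℤ → ℤ
    X i = proj₁ (start i)
    Y i = proj₂ (start i)

    -- Each step raises the coordinate sum by one, so a label amounts to an antidiagonal. Either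
    -- coordinate of a point of the path thus determines the other, which is why later conditions
    -- mention only one of them.
    X+Y : ∀ i → X i + Y i + 1ℤ ≡ i
    X+Y i = begin
      + seen R t + p * (+ n - + k) + (+ seen U t + p * + k) + 1ℤ ≡⟨ regroup (+ seen R t) (+ seen U t) p (+ n) (+ k) ⟩
      1ℤ + (+ seen R t + + seen U t) + p * + n                   ≡⟨ cong (λ u → 1ℤ + + u + p * + n) (occurrences-total steps t (ℕ.<⇒≤ (Fin.toℕ<n (residue {n} i)))) ⟩
      label (residue {n} i) + p * + n                            ≡⟨ label-split {n} i ⟨
      i                                                          ∎
      where
      open ≡-Reasoning
      t : ℕ
      t = toℕ (residue {n} i)
      p : ℤ
      p = period {n} i
      regroup : ∀ a b p n k → a + p * (n - k) + (b + p * k) + 1ℤ ≡ 1ℤ + (a + b) + p * n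
      regroup = solve-∀

    X-suc : ∀ i → step i ≡ R → X (i + 1ℤ) ≡ X i + 1ℤ
    X-suc i eq = trans (cong proj₁ (start-suc i)) (cong (λ d → proj₁ (move d (start i))) eq)

    X-fix : ∀ i → step i ≡ U → X (i + 1ℤ) ≡ X i
    X-fix i eq = trans (cong proj₁ (start-suc i)) (cong (λ d → proj₁ (move d (start i))) eq)

    Y-suc : ∀ i → step i ≡ U → Y (i + 1ℤ) ≡ Y i + 1ℤ
    Y-suc i eq = trans (cong proj₂ (start-suc i)) (cong (λ d → proj₂ (move d (start i))) eq)

    Y-fix : ∀ i → step i ≡ R → Y (i + 1ℤ) ≡ Y i
    Y-fix i eq = trans (cong proj₂ (start-suc i)) (cong (λ d → proj₂ (move d (start i))) eq)

    start-XY : ∀ i → start i ≡ (X i , Y i)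
    start-XY i = refl

    X-+ : ∀ i m → X (i + m * + n) ≡ X i + m * (+ n - + k)
    X-+ i m = cong proj₁ (start-+ i m)

    Y-+ : ∀ i m → Y (i + m * + n) ≡ Y i + m * + k
    Y-+ i m = cong proj₂ (start-+ i m)

  module _ (Z : ℤ → ℤ) (Z-mono₁ : ∀ i → Z i ≤ Z (i + 1ℤ)) where

    mono-from : ∀ m i → Z i ≤ Z (i + + m)
    mono-from zero    i = ℤ.≤-reflexive (cong Z (sym (ℤ.+-identityʳ i)))
    mono-from (suc m) i = ℤ.≤-trans (Z-mono₁ i) (ℤ.≤-trans (mono-from m (i + 1ℤ)) (ℤ.≤-reflexive (cong Z (ℤ.+-assoc i 1ℤ (+ m)))))

    monotone : ∀ {i j} → i ≤ j → Z i ≤ Z j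
    monotone {i} i≤j with m , refl ← upTo i≤j = mono-from m i

  X-mono : ∀ {i j} → i ≤ j → X i ≤ X j
  X-mono = monotone X λ i → one i (step i) refl
    where
    one : ∀ i d → step i ≡ d → X i ≤ X (i + 1ℤ)
    one i R eq = ℤ.≤-trans (i≤i+1 (X i)) (ℤ.≤-reflexive (sym (X-suc i eq)))
    one i U eq = ℤ.≤-reflexive (sym (X-fix i eq))

  Y-mono : ∀ {i j} → i ≤ j → Y i ≤ Y j
  Y-mono = monotone Y λ i → one i (step i) refl
    where
    one : ∀ i d → step i ≡ d → Y i ≤ Y (i + 1ℤ)
    one i U eq = ℤ.≤-trans (i≤i+1 (Y i)) (ℤ.≤-reflexive (sym (Y-suc i eq)))
    one i R eq = ℤ.≤-reflexive (sym (Y-fix i eq))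

  X-cancel : ∀ {i j} → X i + 1ℤ ≤ X j → i + 1ℤ ≤ j
  X-cancel {i} {j} lt = ≰⇒+1≤ λ j≤i → absurd-by (lt ⊕ X-mono j≤i) (shape (X i) (X j))
    where
    shape : ∀ u v → u + 1ℤ + v ≡ v + u + 1ℤ
    shape = solve-∀

  Y-cancel : ∀ {i j} → Y i + 1ℤ ≤ Y j → i + 1ℤ ≤ j
  Y-cancel {i} {j} lt = ≰⇒+1≤ λ j≤i → absurd-by (lt ⊕ Y-mono j≤i) (shape (Y i) (Y j))
    where
    shape : ∀ u v → u + 1ℤ + v ≡ v + u + 1ℤ
    shape = solve-∀

≡⇒≤ : ∀ {a b : ℤ} → a ≡ b → a ≤ b
≡⇒≤ = ℤ.≤-reflexive

-- The strip between the two boundaries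

module StripGeometry {n k : ℕ} .{{_ : NonZero n}} (P : LatticePath n k) where

  open LatticePath P
  open Strip P
  open PathGeometry P

  -- The box with lower left corner (x , y) lies above the southern boundary
  -- iff its lower right corner, on the antidiagonal of start j, does, and below
  -- the northern boundary iff its upper left corner, on the antidiagonal of
  -- start i ↑ k, does.
  record StripBox (c : Box) : Set where
    constructor stripBox
    field
      {i j}  : ℤ
      at-j   : proj₁ c + proj₂ c + + 2 ≡ j
      at-i   : i + + k ≡ j
      lower  : Y j ≤ proj₂ c
      upper  : proj₂ c + 1ℤ ≤ Y i + + k

  -- On an antidiagonal, lying higher means lying further left, so by `X+Y` a bound on heights is a
  -- bound on abscissas. This and its three companions switch between the two forms of the strip
  -- conditions.
  lower-X : ∀ {x y j} → x + y + + 2 ≡ j → Y j ≤ y → x + 1ℤ ≤ X j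
  lower-X {x} {y} {j} refl h = ≤-by _ _ (h ⊕ ≡⇒≤ (sym (X+Y j))) (shape x y (X j) (Y j))
    where
    shape : ∀ x y a b → a + (b + (x + y + + 2)) ≡ x + 1ℤ + (y + (a + b + 1ℤ))
    shape = solve-∀

  X-lower : ∀ {x y j} → x + y + + 2 ≡ j → x + 1ℤ ≤ X j → Y j ≤ y
  X-lower {x} {y} {j} refl h = ≤-by _ _ (h ⊕ ≡⇒≤ (X+Y j)) (shape x y (X j) (Y j))
    where
    shape : ∀ x y a b → y + (x + 1ℤ + (a + b + 1ℤ)) ≡ b + (a + (x + y + + 2))
    shape = solve-∀

  upper-X : ∀ {x y i j} → x + y + + 2 ≡ j → i + + k ≡ j → y + 1ℤ ≤ Y i + + k → X i ≤ x
  upper-X {x} {y} {i} refl eq h = ≤-by _ _ (h ⊕ ≡⇒≤ (X+Y i) ⊕ ≡⇒≤ eq) (shape x y (X i) (Y i) i (+ k))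
    where
    shape : ∀ x y a b i k → x + (y + 1ℤ + (a + b + 1ℤ) + (i + k)) ≡ a + (b + k + i + (x + y + + 2))
    shape = solve-∀

  X-upper : ∀ {x y i j} → x + y + + 2 ≡ j → i + + k ≡ j → X i ≤ x → y + 1ℤ ≤ Y i + + k
  X-upper {x} {y} {i} refl eq h = ≤-by _ _ (h ⊕ ≡⇒≤ (sym (X+Y i)) ⊕ ≡⇒≤ (sym eq)) (shape x y (X i) (Y i) i (+ k))
    where
    shape : ∀ x y a b i k → b + k + (a + i + (x + y + + 2)) ≡ y + 1ℤ + (x + (a + b + 1ℤ) + (i + k))
    shape = solve-∀

  Southern Northern : Edge → Set
  Southern e = e ≡ south (southLabel e)
  Northern e = e ≡ north (northLabel e)

  -- Heights suffice: once i is known to be the label of the antidiagonal of p, `X+Y` supplies the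
  -- abscissa.
  record OnPath (d : Step) (p : Point) (i : ℤ) : Set where
    constructor onPath
    field
      step≡ : step i ≡ d
      Y≡    : Y i ≡ proj₂ p

  southern : ∀ {d x y i} → x + y + 1ℤ ≡ i → OnPath d (x , y) i → Southern (d , (x , y))
  southern {x = x} {y} refl (onPath refl Y≡) = cong (step i ,_) (sym (trans (start-XY i) (cong₂ _,_ X≡ Y≡)))
    where
    i = x + y + 1ℤ
    isolate : ∀ u v → u ≡ u + v + 1ℤ - v - 1ℤ
    isolate = solve-∀
    X≡ : X i ≡ x
    X≡ = trans (isolate (X i) (Y i)) (trans (cong₂ (λ u v → u - v - 1ℤ) (X+Y i) Y≡) (sym (isolate x y)))

  Southern⇒OnPath : ∀ {d x y} → Southern (d , (x , y)) → OnPath d (x , y) (x + y + 1ℤ)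
  Southern⇒OnPath {x = x} {y} eq = onPath (sym (cong proj₁ eq))
    (trans (cong proj₂ (sym (start-XY (x + y + 1ℤ)))) (sym (cong (proj₂ ∘ proj₂) eq)))

  northern : ∀ {d x y i} → x + y + 1ℤ ≡ i + + k → step i ≡ d → Y i + + k ≡ y → Northern (d , (x , y))
  northern {x = x} {y} {i} eq refl Y≡ = cong₂ _,_ (cong step i≡) (begin
    x , y                            ≡⟨ cong₂ _,_ X≡ Y≡ ⟨
    X i , Y i + + k                  ≡⟨ cong (_↑ k) (start-XY i) ⟨
    start i ↑ k                      ≡⟨ cong (λ j → start j ↑ k) i≡ ⟩
    start (x + y + 1ℤ - + k) ↑ k     ∎)
    where
    open ≡-Reasoning
    isolate : ∀ u v → u ≡ u + v - v
    isolate = solve-∀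
    i≡ : i ≡ x + y + 1ℤ - + k
    i≡ = trans (isolate i (+ k)) (cong (_- + k) (sym eq))
    shape : ∀ u v k → u ≡ u + v + 1ℤ + k - (v + k) - 1ℤ
    shape = solve-∀
    shape₂ : ∀ u v → u + v + 1ℤ - v - 1ℤ ≡ u
    shape₂ = solve-∀
    X≡ : X i ≡ x
    X≡ = trans (shape (X i) (Y i) (+ k)) (trans (cong₂ (λ u v → u - v - 1ℤ) (trans (cong (_+ + k) (X+Y i)) (sym eq)) Y≡) (shape₂ x y))

  Northern⇒ : ∀ {d x y} → Northern (d , (x , y)) → step (x + y + 1ℤ - + k) ≡ d × Y (x + y + 1ℤ - + k) + + k ≡ y
  Northern⇒ {x = x} {y} eq = sym (cong proj₁ eq) ,
    trans (cong (λ p → proj₂ p + + k) (sym (start-XY (x + y + 1ℤ - + k)))) (sym (cong (proj₂ ∘ proj₂) eq))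

  Y-step : ∀ i → Y (i + 1ℤ) ≤ Y i + 1ℤ
  Y-step i = one (step i) refl
    where
    one : ∀ d → step i ≡ d → Y (i + 1ℤ) ≤ Y i + 1ℤ
    one R eq = ℤ.≤-trans (≡⇒≤ (Y-fix i eq)) (i≤i+1 (Y i))
    one U eq = ≡⇒≤ (Y-suc i eq)

  Y-rise : ∀ {i} → Y i + 1ℤ ≤ Y (i + 1ℤ) → step i ≡ U
  Y-rise {i} lt with step i in eq
  ... | U = refl
  ... | R = contradiction (lt ⊕ ≡⇒≤ (Y-fix i eq)) λ le → absurd-by le (shape (Y i) (Y (i + 1ℤ)))
    where
    shape : ∀ u v → u + 1ℤ + v ≡ v + u + 1ℤ
    shape = solve-∀

  Y-flat : ∀ {i} → Y (i + 1ℤ) ≤ Y i → step i ≡ R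
  Y-flat {i} le with step i in eq
  ... | R = refl
  ... | U = contradiction (le ⊕ ≡⇒≤ (sym (Y-suc i eq))) λ le → absurd-by le (shape (Y i) (Y (i + 1ℤ)))
    where
    shape : ∀ u v → v + (u + 1ℤ) ≡ u + v + 1ℤ
    shape = solve-∀

  cancel-1 : ∀ {u v} → u + 1ℤ ≤ v + 1ℤ → u ≤ v
  cancel-1 {u} {v} le = ≤-by u v le (shape u v)
    where
    shape : ∀ u v → v + (u + 1ℤ) ≡ u + (v + 1ℤ)
    shape = solve-∀

  -- The step to the right passes to the next antidiagonal in the same row, so only the lower bound
  -- can fail. As `Y` grows by at most one per step, failure forces step j to go up from the foot of
  -- the right edge, which is then southern.
  right-inside : ∀ {c} → StripBox c → Southern (right c) ⊎ StripBox (boxAfter (right c))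
  right-inside {x , y} (stripBox {i} {j} at-j at-i lower upper) with Y (j + 1ℤ) ℤ.≤? y
  ... | yes le = inj₂ (stripBox (trans (shape x y) (cong (_+ 1ℤ) at-j)) (trans (shape₂ i (+ k)) (cong (_+ 1ℤ) at-i)) le
                   (ℤ.≤-trans upper (ℤ.+-monoˡ-≤ (+ k) (Y-mono (i≤i+1 i)))))
    where
    shape : ∀ x y → x + 1ℤ + y + + 2 ≡ x + y + + 2 + 1ℤ
    shape = solve-∀
    shape₂ : ∀ i k → i + 1ℤ + k ≡ i + k + 1ℤ
    shape₂ = solve-∀
  ... | no  gt = inj₁ (southern (trans (shape x y) at-j) (onPath (Y-rise (ℤ.≤-trans (ℤ.+-monoˡ-≤ 1ℤ lower) y<))
                   (ℤ.≤-antisym lower (cancel-1 (ℤ.≤-trans y< (Y-step j))))))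
    where
    y< : y + 1ℤ ≤ Y (j + 1ℤ)
    y< = ≰⇒+1≤ gt
    shape : ∀ x y → x + 1ℤ + y + 1ℤ ≡ x + y + + 2
    shape = solve-∀

  private
    shift-down : ∀ {i} → i - 1ℤ + 1ℤ ≡ i
    shift-down {i} = shape i
      where
      shape : ∀ i → i - 1ℤ + 1ℤ ≡ i
      shape = solve-∀

    Y-before : ∀ i → Y i ≤ Y (i - 1ℤ) + 1ℤ
    Y-before i = subst (λ u → Y u ≤ Y (i - 1ℤ) + 1ℤ) shift-down (Y-step (i - 1ℤ))

    Y-before-mono : ∀ i → Y (i - 1ℤ) ≤ Y i
    Y-before-mono i = Y-mono (subst (i - 1ℤ ≤_) shift-down (i≤i+1 (i - 1ℤ)))

    swap-1 : ∀ u v → u + 1ℤ + v ≡ u + v + 1ℤ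
    swap-1 = solve-∀

  bottom-inside : ∀ {c} → StripBox c → Southern (bottom c) ⊎ StripBox (boxAfter (bottom c))
  bottom-inside {x , y} (stripBox {i} {j} at-j at-i lower upper) with Y (j - 1ℤ) ℤ.≤? y - 1ℤ
  ... | yes le = inj₂ (stripBox {i = i - 1ℤ} (trans (shape x y) (cong (_- 1ℤ) at-j)) (trans (shape₂ i (+ k)) (cong (_- 1ℤ) at-i)) le
                   (subst (_≤ Y (i - 1ℤ) + + k) (sym (shift-down {y})) (cancel-1 (ℤ.≤-trans upper
                     (ℤ.≤-trans (ℤ.+-monoˡ-≤ (+ k) (Y-before i)) (≡⇒≤ (swap-1 (Y (i - 1ℤ)) (+ k))))))))
    where
    shape : ∀ x y → x + (y - 1ℤ) + + 2 ≡ x + y + + 2 - 1ℤ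
    shape = solve-∀
    shape₂ : ∀ i k → i - 1ℤ + k ≡ i + k - 1ℤ
    shape₂ = solve-∀
  ... | no  gt = inj₁ (southern (trans (shape x y) (cong (_- 1ℤ) at-j)) (onPath
                   (Y-flat (ℤ.≤-trans (≡⇒≤ (cong Y shift-down)) (ℤ.≤-trans lower y≤)))
                   (ℤ.≤-antisym (ℤ.≤-trans (Y-before-mono j) lower) y≤)))
    where
    y≤ : y ≤ Y (j - 1ℤ)
    y≤ = subst (_≤ Y (j - 1ℤ)) (shift-down {y}) (≰⇒+1≤ gt)
    shape : ∀ x y → x + y + 1ℤ ≡ x + y + + 2 - 1ℤ
    shape = solve-∀

  -- Against the direction of travel it is the upper bound that can fail, and then the edge lies on
  -- the northern boundary.
  left-inside : ∀ {c} → StripBox c → Northern (left c) ⊎ StripBox (boxBefore (left c))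
  left-inside {x , y} (stripBox {i} {j} at-j at-i lower upper) with y + 1ℤ ℤ.≤? Y (i - 1ℤ) + + k
  ... | yes le = inj₂ (stripBox {i = i - 1ℤ} (trans (shape x y) (cong (_- 1ℤ) at-j)) (trans (shape₂ i (+ k)) (cong (_- 1ℤ) at-i))
                   (ℤ.≤-trans (Y-before-mono j) lower) le)
    where
    shape : ∀ x y → x - 1ℤ + y + + 2 ≡ x + y + + 2 - 1ℤ
    shape = solve-∀
    shape₂ : ∀ i k → i - 1ℤ + k ≡ i + k - 1ℤ
    shape₂ = solve-∀
  ... | no  gt = inj₁ (northern (trans (shape x y) (trans (cong (_- 1ℤ) (trans at-j (sym at-i))) (shape₂ i (+ k))))
                   (Y-rise {i - 1ℤ} (≤-by _ _ (Y≤y ⊕ upper) (shape₃ (Y (i - 1ℤ)) y (+ k) (sym (cong Y shift-down)))))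
                   (ℤ.≤-antisym Y≤y y≤Y))
    where
    Y≤y : Y (i - 1ℤ) + + k ≤ y
    Y≤y = cancel-1 (≰⇒+1≤ gt)
    y≤Y : y ≤ Y (i - 1ℤ) + + k
    y≤Y = cancel-1 (ℤ.≤-trans upper (ℤ.≤-trans (ℤ.+-monoˡ-≤ (+ k) (Y-before i)) (≡⇒≤ (swap-1 (Y (i - 1ℤ)) (+ k)))))
    shape : ∀ x y → x + y + 1ℤ ≡ x + y + + 2 - 1ℤ
    shape = solve-∀
    shape₂ : ∀ i k → i + k - 1ℤ ≡ i - 1ℤ + k
    shape₂ = solve-∀
    shape₃ : ∀ u y k {v w} → v ≡ w → w + (u + k + (y + 1ℤ)) ≡ u + 1ℤ + (y + (v + k))
    shape₃ u y k {v} refl = shape₄ u y k v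
      where
      shape₄ : ∀ u y k v → v + (u + k + (y + 1ℤ)) ≡ u + 1ℤ + (y + (v + k))
      shape₄ = solve-∀

  top-inside : ∀ {c} → StripBox c → Northern (top c) ⊎ StripBox (boxBefore (top c))
  top-inside {x , y} (stripBox {i} {j} at-j at-i lower upper) with y + 1ℤ + 1ℤ ℤ.≤? Y (i + 1ℤ) + + k
  ... | yes le = inj₂ (stripBox (trans (shape x y) (cong (_+ 1ℤ) at-j)) (trans (swap-1 i (+ k)) (cong (_+ 1ℤ) at-i))
                   (ℤ.≤-trans (Y-step j) (ℤ.+-monoˡ-≤ 1ℤ lower)) le)
    where
    shape : ∀ x y → x + (y + 1ℤ) + + 2 ≡ x + y + + 2 + 1ℤ
    shape = solve-∀
  ... | no  gt = inj₁ (northern (trans (shape x y) (trans at-j (sym at-i)))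
                   (Y-flat (≤-by _ _ (Y≤y ⊕ upper) (shape₃ (Y i) (Y (i + 1ℤ)) y (+ k))))
                   (ℤ.≤-antisym (ℤ.≤-trans (ℤ.+-monoˡ-≤ (+ k) (Y-mono (i≤i+1 i))) Y≤y) upper))
    where
    Y≤y : Y (i + 1ℤ) + + k ≤ y + 1ℤ
    Y≤y = cancel-1 (≰⇒+1≤ gt)
    shape : ∀ x y → x + (y + 1ℤ) + 1ℤ ≡ x + y + + 2
    shape = solve-∀
    shape₃ : ∀ u v y k → u + (v + k + (y + 1ℤ)) ≡ v + (y + 1ℤ + (u + k))
    shape₃ = solve-∀

  -- Complements `right-inside` and `bottom-inside`: a strand leaving a box of the strip is stopped
  -- by `next` exactly when no box of the strip follows.
  Southern⇒¬StripBox : ∀ e → Southern e → ¬ StripBox (boxAfter e)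
  Southern⇒¬StripBox (U , (x , y)) s (stripBox {j = j} at-j _ lower _) with Southern⇒OnPath s
  ... | onPath step≡ Y≡ = absurd-by {b = y} (ℤ.≤-trans (≡⇒≤ (sym Yj)) lower) refl
    where
    shape : ∀ x y → x + y + 1ℤ + 1ℤ ≡ x + y + + 2
    shape = solve-∀
    Yj : Y j ≡ y + 1ℤ
    Yj = trans (cong Y (trans (sym at-j) (sym (shape x y)))) (trans (Y-suc _ step≡) (cong (_+ 1ℤ) Y≡))
  Southern⇒¬StripBox (R , (x , y)) s (stripBox {j = j} at-j _ lower _) with Southern⇒OnPath s
  ... | onPath step≡ Y≡ = absurd-by (ℤ.≤-trans (≡⇒≤ (sym Yj)) lower) (sym (shift-down {y}))
    where
    shape : ∀ x y → x + y + 1ℤ ≡ x + (y - 1ℤ) + + 2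
    shape = solve-∀
    Yj : Y j ≡ y
    Yj = trans (cong Y (trans (sym at-j) (sym (shape x y)))) Y≡

  Northern⇒¬StripBox : ∀ e → Northern e → ¬ StripBox (boxBefore e)
  Northern⇒¬StripBox (U , (x , y)) s (stripBox {i} at-j at-i _ upper) with Northern⇒ s
  ... | step≡ , Y≡ = absurd-by {b = y} (ℤ.≤-trans upper (≡⇒≤ Yi)) refl
    where
    shape : ∀ x y k → x - 1ℤ + y + + 2 - k ≡ x + y + 1ℤ - k
    shape = solve-∀
    shape₂ : ∀ i k → i ≡ i + k - k
    shape₂ = solve-∀
    Yi : Y i + + k ≡ y
    Yi = trans (cong (λ u → Y u + + k) (trans (shape₂ i (+ k)) (trans (cong (_- + k) (trans at-i (sym at-j))) (shape x y (+ k))))) Y≡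
  Northern⇒¬StripBox (R , (x , y)) s (stripBox {i} at-j at-i _ upper) with Northern⇒ s
  ... | step≡ , Y≡ = absurd-by {b = y} (ℤ.≤-trans upper (≡⇒≤ Yi)) refl
    where
    shape : ∀ x y k → x + y + + 2 - k ≡ x + y + 1ℤ - k + 1ℤ
    shape = solve-∀
    shape₂ : ∀ i k → i ≡ i + k - k
    shape₂ = solve-∀
    Yi : Y i + + k ≡ y
    Yi = trans (cong (λ u → Y u + + k) (trans (shape₂ i (+ k)) (trans (cong (_- + k) (trans at-i (sym at-j))) (shape x y (+ k)))))
               (trans (cong (_+ + k) (Y-fix _ step≡)) Y≡)

-- Boxes of the strip modulo translation

AllPairs-cartesianProductWith : ∀ {a b c r p} {A : Set a} {B : Set b} {C : Set c} {_~_ : C → C → Set r} {Q : A → Set p}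
  (f : A → B → C) → (∀ {x x′} y y′ → Q x → Q x′ → x ≢ x′ → f x y ~ f x′ y′) → (∀ {x y y′} → Q x → y ≢ y′ → f x y ~ f x y′) →
  ∀ {xs ys} → All Q xs → Unique xs → Unique ys → AllPairs _~_ (cartesianProductWith f xs ys)
AllPairs-cartesianProductWith f across within []        []         _   = []
AllPairs-cartesianProductWith {_~_ = _~_} {Q = Q} f across within {x ∷ xs} {ys} (q ∷ qs) (x∉ ∷ u) uys = AllPairs.++⁺
  (AllPairs.map⁺ (AllPairs.map (within q) uys))
  (AllPairs-cartesianProductWith f across within qs u uys)
  (All.map⁺ (All.tabulate λ {y} _ → rows y qs x∉))
  where
  rows : ∀ y {zs} → All Q zs → All (x ≢_) zs → All (f x y ~_) (cartesianProductWith f zs ys)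
  rows y []       []         = []
  rows y (q′ ∷ qs) (x≢z ∷ x∉) = All.++⁺ (All.map⁺ (All.tabulate λ {y′} _ → across y y′ q q′ x≢z)) (rows y qs x∉)

AllPairs-lookup : ∀ {a r} {A : Set a} {_~_ : A → A → Set r} → (∀ {x y} → x ~ y → y ~ x) →
                  ∀ {xs} → AllPairs _~_ xs → ∀ {p p′} → p ≢ p′ → List.lookup xs p ~ List.lookup xs p′
AllPairs-lookup symm (h ∷ hs) {zero}  {zero}   p≢p′ = contradiction refl p≢p′
AllPairs-lookup symm (h ∷ hs) {zero}  {suc p′} p≢p′ = All.lookup h (∈.∈-lookup p′)
AllPairs-lookup symm (h ∷ hs) {suc p} {zero}   p≢p′ = symm (All.lookup h (∈.∈-lookup p))
AllPairs-lookup symm (h ∷ hs) {suc p} {suc p′} p≢p′ = AllPairs-lookup symm hs (p≢p′ ∘ cong suc)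

module BoxGeometry {n k : ℕ} .{{_ : NonZero n}} (P : LatticePath n k) where

  open LatticePath P
  open Strip P
  open PathGeometry P
  open StripGeometry P

  Y-lipschitz : ∀ i m → Y (i + + m) ≤ Y i + + m
  Y-lipschitz i m = ≤-by _ _ (X-mono (ℤ.i≤i+j i (+ m)) ⊕ ≡⇒≤ (X+Y (i + + m)) ⊕ ≡⇒≤ (sym (X+Y i)))
                      (shape (X i) (Y i) (X (i + + m)) (Y (i + + m)) i (+ m))
    where
    shape : ∀ x y x′ y′ i m → y + m + (x + (x′ + y′ + 1ℤ) + i) ≡ y′ + (x′ + (i + m) + (x + y + 1ℤ))
    shape = solve-∀

  private
    swap-1 : ∀ u v → u + 1ℤ + v ≡ u + v + 1ℤ
    swap-1 = solve-∀

  south-XY : ∀ i → south i ≡ (step i , (X i , Y i))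
  south-XY i = cong (step i ,_) (start-XY i)

  -- With i = h + k, the northern edge labeled h lies on the same antidiagonal. If there is no room
  -- for a box before the southern edge, `Y-lipschitz` makes the two edges equal; this happens only
  -- when k is 0 or n.
  south-inside : ∀ i → Northern (south i) ⊎ StripBox (boxBefore (south i))
  south-inside i = subst (λ i → Northern (south i) ⊎ StripBox (boxBefore (south i))) (minus-plus i (+ k)) (above (i - + k))
    where
    minus-plus : ∀ i k → i - k + k ≡ i
    minus-plus = solve-∀
    module _ (h : ℤ) where
      at : ∀ d → step (h + + k) ≡ d → Northern (d , (X (h + + k) , Y (h + + k))) ⊎ StripBox (boxBefore (d , (X (h + + k) , Y (h + + k))))
      at U eq with Y (h + + k) + 1ℤ ℤ.≤? Y h + + k
      ... | yes le = inj₂ (stripBox (trans (shape (X (h + + k)) (Y (h + + k))) (X+Y (h + + k))) refl ℤ.≤-refl le)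
        where
        shape : ∀ x y → x - 1ℤ + y + + 2 ≡ x + y + 1ℤ
        shape = solve-∀
      ... | no  gt = inj₁ (northern (X+Y (h + + k)) (Y-rise (≤-by _ _ (Y≤ ⊕ Y-lipschitz (h + 1ℤ) k ⊕ ≡⇒≤ (sym (Y-suc (h + + k) eq)))
                       (shape (Y h) (Y (h + + k)) (+ k) (Y (h + 1ℤ)) (cong Y (swap-1 h (+ k)))))) (ℤ.≤-antisym Y≤ (Y-lipschitz h k)))
        where
        Y≤ : Y h + + k ≤ Y (h + + k)
        Y≤ = cancel-1 (≰⇒+1≤ gt)
        shape : ∀ a b k c {d e} → d ≡ e → c + (a + k + d + (b + 1ℤ)) ≡ a + 1ℤ + (b + (c + k) + e)
        shape a b k c {d} refl = shape₂ a b k c d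
          where
          shape₂ : ∀ a b k c d → c + (a + k + d + (b + 1ℤ)) ≡ a + 1ℤ + (b + (c + k) + d)
          shape₂ = solve-∀
      at R eq with Y (h + + k) + 1ℤ ℤ.≤? Y (h + 1ℤ) + + k
      ... | yes le = inj₂ (stripBox (trans (shape (X (h + + k)) (Y (h + + k))) (cong (_+ 1ℤ) (X+Y (h + + k)))) (swap-1 h (+ k)) (≡⇒≤ (Y-fix (h + + k) eq)) le)
        where
        shape : ∀ x y → x + y + + 2 ≡ x + y + 1ℤ + 1ℤ
        shape = solve-∀
      ... | no  gt = inj₁ (northern (X+Y (h + + k)) (Y-flat (≤-by _ _ (Y≤ ⊕ Y-lipschitz h k) (shape (Y h) (Y (h + + k)) (+ k) (Y (h + 1ℤ)))))
                       (ℤ.≤-antisym (ℤ.≤-trans (ℤ.+-monoˡ-≤ (+ k) (Y-mono (i≤i+1 h))) Y≤) (Y-lipschitz h k)))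
        where
        Y≤ : Y (h + 1ℤ) + + k ≤ Y (h + + k)
        Y≤ = cancel-1 (≰⇒+1≤ gt)
        shape : ∀ a b k c → a + (c + k + b) ≡ c + (b + (a + k))
        shape = solve-∀

      above : Northern (south (h + + k)) ⊎ StripBox (boxBefore (south (h + + k)))
      above = subst (λ e → Northern e ⊎ StripBox (boxBefore e)) (sym (south-XY (h + + k))) (at (step (h + + k)) refl)

  -- The northern boundary above the first box is taken at its index i, the southern one below the
  -- second box at j′, and i ≤ j′ because X i ≤ x ≤ x′ < X j′. Between these indices `Y` cannot
  -- decrease.
  drop-bound : ∀ {x y x′ y′} → StripBox (x , y) → StripBox (x′ , y′) → x ≤ x′ → y + 1ℤ ≤ y′ + + k
  drop-bound {x} {y} {x′} {y′} (stripBox {i} at-j at-i lower upper) (stripBox {_} {j′} at-j′ at-i′ lower′ upper′) x≤x′ =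
    ℤ.≤-trans upper (ℤ.+-monoˡ-≤ (+ k) (ℤ.≤-trans (Y-mono i≤j′) lower′))
    where
    i≤j′ : i ≤ j′
    i≤j′ = ℤ.≤-trans (i≤i+1 i) (X-cancel (ℤ.≤-trans (ℤ.+-monoˡ-≤ 1ℤ (ℤ.≤-trans (upper-X {x} {y} at-j at-i upper) x≤x′)) (lower-X {x′} {y′} at-j′ lower′)))

  -- The same argument with the axes exchanged: by periodicity the northern boundary is also the
  -- southern one moved left by n - k, with labels shifted by n.
  advance-bound : ∀ {x y x′ y′} → StripBox (x , y) → StripBox (x′ , y′) → y′ ≤ y → x′ + 1ℤ ≤ x + (+ n - + k)
  advance-bound {x} {y} {x′} {y′} (stripBox {i} at-j at-i lower upper) (stripBox {_} {j′} at-j′ at-i′ lower′ upper′) y′≤y =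
    ℤ.≤-trans (lower-X {x′} {y′} at-j′ lower′) (ℤ.≤-trans (X-mono j′≤i+n) (ℤ.≤-trans (≡⇒≤ (X-+ i 1ℤ))
      (ℤ.≤-trans (≡⇒≤ (cong (λ u → X i + u) (ℤ.*-identityˡ (+ n - + k)))) (ℤ.+-monoˡ-≤ (+ n - + k) (upper-X {x} {y} at-j at-i upper)))))
    where
    j′≤i+n : j′ ≤ i + 1ℤ * + n
    j′≤i+n = ℤ.≤-trans (i≤i+1 j′) (Y-cancel (ℤ.≤-trans (ℤ.+-monoˡ-≤ 1ℤ (ℤ.≤-trans lower′ y′≤y))
      (ℤ.≤-trans upper (≡⇒≤ (sym (trans (Y-+ i 1ℤ) (cong (λ u → Y i + u) (ℤ.*-identityˡ (+ k)))))))))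

  strip-1≤k : ∀ {c} → StripBox c → 1ℤ ≤ + k
  strip-1≤k {x , y} sb = ≤-by _ _ (drop-bound sb sb ℤ.≤-refl) (shape (+ k) y)
    where
    shape : ∀ k y → k + (y + 1ℤ) ≡ 1ℤ + (y + k)
    shape = solve-∀

  strip-1≤n-k : ∀ {c} → StripBox c → 1ℤ ≤ + n - + k
  strip-1≤n-k {x , y} sb = ≤-by _ _ (advance-bound sb sb ℤ.≤-refl) (shape (+ n) (+ k) x)
    where
    shape : ∀ n k y → n - k + (y + 1ℤ) ≡ 1ℤ + (y + (n - k))
    shape = solve-∀

  -- Invariant under translation, and decreasing along every strand.
  rank : Box → ℤ
  rank (x , y) = (+ n - + k) * y - + k * x

  rank-shift : ∀ m c → rank (shift m c) ≡ rank c
  rank-shift m (x , y) = shape (+ n) (+ k) x y m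
    where
    shape : ∀ n k x y m → (n - k) * (y + m * k) - k * (x + m * (n - k)) ≡ (n - k) * y - k * x
    shape = solve-∀

  rank-right : ∀ {c x y} → StripBox c → rank (x + 1ℤ , y) < rank (x , y)
  rank-right {x = x} {y} sb = ℤ.suc[i]≤j⇒i<j (≤-by _ _ (strip-1≤k sb) (shape (+ n) (+ k) x y))
    where
    shape : ∀ n k x y → (n - k) * y - k * x + 1ℤ ≡ 1ℤ + ((n - k) * y - k * (x + 1ℤ)) + k
    shape = solve-∀

  rank-down : ∀ {c x y} → StripBox c → rank (x , y) < rank (x , y + 1ℤ)
  rank-down {x = x} {y} sb = ℤ.suc[i]≤j⇒i<j (≤-by _ _ (strip-1≤n-k sb) (shape (+ n) (+ k) x y))
    where
    shape : ∀ n k x y → (n - k) * (y + 1ℤ) - k * x + 1ℤ ≡ 1ℤ + ((n - k) * y - k * x) + (n - k)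
    shape = solve-∀

  record Reach (c c′ : Box) (m : ℕ) : Set where
    constructor reach
    field
      {a b} : ℕ
      x≡    : proj₁ c′ ≡ proj₁ c + + a
      y≡    : proj₂ c ≡ proj₂ c′ + + b
      m≡    : a ℕ.+ b ≡ m

  -- The two bounds allow at most k - 1 moves down and n - k - 1 moves to the right. This is why n
  -- units of fuel always suffice, and with m = 0 it yields 2 ≤ n.
  reach-bound : ∀ {c c′ m} → StripBox c → StripBox c′ → Reach c c′ m → suc (suc m) ℕ.≤ n
  reach-bound {x , y} {x′ , y′} sb sb′ (reach {a} {b} refl refl refl) = ℤ.drop‿+≤+
    (≤-by (+ 2 + (+ a + + b)) (+ n) (drop-bound sb sb′ (ℤ.i≤i+j x (+ a)) ⊕ advance-bound sb sb′ (ℤ.i≤i+j y′ (+ b))) (shape x y′ (+ a) (+ b) (+ n) (+ k)))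
    where
    shape : ∀ x y a b n k → n + (y + b + 1ℤ + (x + a + 1ℤ)) ≡ + 2 + (a + b) + (y + k + (x + (n - k)))
    shape = solve-∀

  private
    RS : List (Fin n)
    RS = filter (λ s → lookup steps s ≟ˢ R) (allFin n)

    tower : Fin n → Fin k → Box
    tower s t = start (label s) ↑ toℕ t

    Apart : Box → Box → Set
    Apart b b′ = ∀ c → Translate b c → ¬ Translate b′ c

    rises : ∀ s m → lookup steps s ≡ R → X (label s + m * + n + 1ℤ) ≡ X (label s + m * + n) + 1ℤ
    rises s m isR = X-suc _ (trans (step-label s m) isR)

    X-injective : ∀ {i i′} → X (i + 1ℤ) ≡ X i + 1ℤ → X (i′ + 1ℤ) ≡ X i′ + 1ℤ → X i ≡ X i′ → i ≡ i′
    X-injective {i} {i′} r r′ eq = ℤ.≤-antisym (below r′ (sym eq)) (below r eq)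
      where
      below : ∀ {i i′} → X (i + 1ℤ) ≡ X i + 1ℤ → X i ≡ X i′ → i′ ≤ i
      below {i} {i′} r eq = cancel-1 (X-cancel {j = i + 1ℤ} (≡⇒≤ (trans (cong (_+ 1ℤ) (sym eq)) (sym r))))

    X-tower : ∀ s t m → proj₁ (shift m (tower s t)) ≡ X (label s + m * + n)
    X-tower s t m = trans (cong (λ p → proj₁ (shift m (p ↑ toℕ t))) (start-XY (label s))) (sym (X-+ (label s) m))

    Y-tower : ∀ s t m → proj₂ (shift m (tower s t)) ≡ Y (label s + m * + n) + + toℕ t
    Y-tower s t m = trans (cong (λ p → proj₂ (shift m (p ↑ toℕ t))) (start-XY (label s)))
      (trans (shape (Y (label s)) (+ toℕ t) (m * + k)) (cong (_+ + toℕ t) (sym (Y-+ (label s) m))))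
      where
      shape : ∀ u v w → u + v + w ≡ u + w + v
      shape = solve-∀

    -- `X` takes different values at the starts of different right steps, so the column of a box
    -- determines the right step below it, hence s, and then the height gives t.
    same-tower : ∀ {s s′ t t′ m m′} → lookup steps s ≡ R → lookup steps s′ ≡ R → shift m (tower s t) ≡ shift m′ (tower s′ t′) → s ≡ s′ × t ≡ t′
    same-tower {s} {s′} {t} {t′} {m} {m′} r r′ eq =
      trans (sym (residue-label s m)) (trans (cong residue i≡i′) (residue-label s′ m′)) ,
      Fin.toℕ-injective (ℤ.+-injective (trans (isolate (Y (label s + m * + n)) (+ toℕ t)) (trans (cong₂ _-_ Y≡ (cong Y i≡i′)) (sym (isolate (Y (label s′ + m′ * + n)) (+ toℕ t′))))))
      where
      i≡i′ : label s + m * + n ≡ label s′ + m′ * + n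
      i≡i′ = X-injective (rises s m r) (rises s′ m′ r′) (trans (sym (X-tower s t m)) (trans (cong proj₁ eq) (X-tower s′ t′ m′)))
      Y≡ : Y (label s + m * + n) + + toℕ t ≡ Y (label s′ + m′ * + n) + + toℕ t′
      Y≡ = trans (sym (Y-tower s t m)) (trans (cong proj₂ eq) (Y-tower s′ t′ m′))
      isolate : ∀ u v → v ≡ u + v - u
      isolate = solve-∀

    boxes-apart : AllPairs Apart boxes
    boxes-apart = AllPairs-cartesianProductWith tower
      (λ t t′ r r′ s≢s′ c (m , eq) (m′ , eq′) → s≢s′ (proj₁ (same-tower {t = t} {t′} {m} {m′} r r′ (trans (sym eq) eq′))))
      (λ {s} {t} {t′} r t≢t′ c (m , eq) (m′ , eq′) → t≢t′ (proj₂ (same-tower {s} {s} {t} {t′} {m} {m′} r r (trans (sym eq) eq′))))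
      (All.all-filter (λ s → lookup steps s ≟ˢ R) (allFin n))
      (Unique.filter⁺ (λ s → lookup steps s ≟ˢ R) (Unique.allFin⁺ n))
      (Unique.allFin⁺ k)

  class-unique : ∀ {p p′ c} → Translate (List.lookup boxes p) c → Translate (List.lookup boxes p′) c → p ≡ p′
  class-unique {p} {p′} {c} tr tr′ with p Fin.≟ p′
  ... | yes eq = eq
  ... | no  p≢p′ = contradiction tr′ (AllPairs-lookup (λ apart c t t′ → apart c t′ t) boxes-apart p≢p′ c tr)

  tile-class : ∀ A {p c} → Translate (List.lookup boxes p) c → tile A c ≡ lookup A p
  tile-class A {p} {c} tr with Fin.any? (λ p → translate? (List.lookup boxes p) c)
  ... | yes (p′ , tr′) = cong (lookup A) (class-unique tr′ tr)
  ... | no  none       = contradiction (p , tr) none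

  -- The lower right corner of a box at height t above the right step i is on the antidiagonal of i
  -- + 1 + t. Since 0 ≤ t < k, both strip conditions become monotonicity of `X`.
  listed⇒strip : ∀ {p c} → Translate (List.lookup boxes p) c → StripBox c
  listed⇒strip {p} {c} (m , refl) with ∈.∈-cartesianProductWith⁻ tower RS (allFin k) (∈.∈-lookup p)
  ... | s , t , s∈ , _ , eq = subst (λ b → StripBox (shift m b)) (sym eq) strip
    where
    i = label s + m * + n
    isR = proj₂ (∈.∈-filter⁻ (λ s → lookup steps s ≟ˢ R) {xs = allFin n} s∈)
    t+1≤k : + toℕ t + 1ℤ ≤ + k
    t+1≤k = ℤ.≤-trans (≡⇒≤ (ℤ.+-comm (+ toℕ t) 1ℤ)) (+≤+ (Fin.toℕ<n t))
    at-j : proj₁ (shift m (tower s t)) + proj₂ (shift m (tower s t)) + + 2 ≡ i + 1ℤ + + toℕ t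
    at-j = trans (cong₂ (λ u v → u + v + + 2) (X-tower s t m) (Y-tower s t m)) (trans (shape (X i) (Y i) (+ toℕ t)) (cong (λ u → u + 1ℤ + + toℕ t) (X+Y i)))
      where
      shape : ∀ x y t → x + (y + t) + + 2 ≡ x + y + 1ℤ + 1ℤ + t
      shape = solve-∀
    at-i : i + 1ℤ + + toℕ t - + k + + k ≡ i + 1ℤ + + toℕ t
    at-i = shape (i + 1ℤ + + toℕ t) (+ k)
      where
      shape : ∀ u k → u - k + k ≡ u
      shape = solve-∀
    strip : StripBox (shift m (tower s t))
    strip = stripBox {i = i + 1ℤ + + toℕ t - + k} at-j at-i
      (X-lower {proj₁ (shift m (tower s t))} at-j (ℤ.≤-trans (≡⇒≤ (trans (cong (_+ 1ℤ) (X-tower s t m)) (sym (rises s m isR)))) (X-mono (ℤ.i≤i+j (i + 1ℤ) (+ toℕ t)))))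
      (X-upper at-j at-i (ℤ.≤-trans (X-mono {j = i} (≤-by _ _ t+1≤k (shape i (+ toℕ t) (+ k)))) (≡⇒≤ (sym (X-tower s t m)))))
      where
      shape : ∀ i t k → i + (t + 1ℤ) ≡ i + 1ℤ + t - k + k
      shape = solve-∀

  private
    -- A discrete intermediate value argument: `X` cannot pass from the left to the right side of
    -- column x except at a single step.
    crossing-step : ∀ m i {x} → X i ≤ x → x + 1ℤ ≤ X (i + + m) → ∃ λ i′ → i ≤ i′ × i′ + 1ℤ ≤ i + + m × X i′ ≤ x × x + 1ℤ ≤ X (i′ + 1ℤ)
    crossing-step zero    i {x} lo hi = contradiction (ℤ.≤-trans hi (≡⇒≤ (cong X (ℤ.+-identityʳ i))) ⊕ lo) λ le → absurd-by le (shape x (X i))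
      where
      shape : ∀ x y → x + 1ℤ + y ≡ y + x + 1ℤ
      shape = solve-∀
    crossing-step (suc m) i {x} lo hi with x + 1ℤ ℤ.≤? X (i + 1ℤ)
    ... | yes x< = i , ℤ.≤-refl , ℤ.≤-trans (ℤ.i≤i+j (i + 1ℤ) (+ m)) (≡⇒≤ (ℤ.+-assoc i 1ℤ (+ m))) , lo , x<
    ... | no  x≮ with crossing-step m (i + 1ℤ) (cancel-1 (≰⇒+1≤ x≮)) (ℤ.≤-trans hi (≡⇒≤ (cong X (sym (ℤ.+-assoc i 1ℤ (+ m))))))
    ...   | i′ , i≤ , ≤j , lo′ , hi′ = i′ , ℤ.≤-trans (i≤i+1 i) i≤ , ℤ.≤-trans ≤j (≡⇒≤ (ℤ.+-assoc i 1ℤ (+ m))) , lo′ , hi′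

  -- Between the indices i and j = i + k of the two boundary points, the path crosses the column of
  -- the box by a right step h. The height above it is less than k because Y i ≤ Y h.
  strip⇒listed : ∀ {c} → StripBox c → ∃ λ p → Translate (List.lookup boxes p) c
  strip⇒listed {x , y} (stripBox {i} {j} at-j at-i lower upper) with crossing-step k i (upper-X {x} {y} at-j at-i upper) (ℤ.≤-trans (lower-X {x} {y} at-j lower) (≡⇒≤ (cong X (sym at-i))))
  ... | h , i≤h , h<j , lo , hi with upTo (ℤ.≤-trans (Y-mono (ℤ.≤-trans (i≤i+1 h) (ℤ.≤-trans h<j (≡⇒≤ at-i)))) lower)
  ...   | t , y≡ = Any.index listed , period h , sym (begin
      shift (period h) (List.lookup boxes (Any.index listed)) ≡⟨ cong (shift (period h)) (Any.lookup-index listed) ⟨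
      shift (period h) (tower (residue h) t′)                 ≡⟨ ×-≡,≡→≡ (trans (X-tower (residue h) t′ (period h)) (trans (cong X (sym (label-split h))) Xh) ,
                                                                          trans (Y-tower (residue h) t′ (period h)) (trans (cong₂ (λ u v → Y u + + v) (sym (label-split h)) (Fin.toℕ-fromℕ< t<k)) (sym y≡))) ⟩
      (x , y)                                                 ∎)
    where
    open ≡-Reasoning
    shape : ∀ a b x → a + (x + 1ℤ + b) ≡ b + (x + a) + 1ℤ
    shape = solve-∀
    isR : step h ≡ R
    isR with step h in eq
    ... | R = refl
    ... | U = contradiction (hi ⊕ ≡⇒≤ (X-fix h eq) ⊕ lo) λ le → absurd-by le (shape₂ x (X (h + 1ℤ)) (X h))
      where
      shape₂ : ∀ x u v → x + 1ℤ + u + v ≡ u + v + x + 1ℤ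
      shape₂ = solve-∀
    Xh : X h ≡ x
    Xh = ℤ.≤-antisym lo (cancel-1 (ℤ.≤-trans hi (≡⇒≤ (X-suc h isR))))
    t<k : t ℕ.< k
    t<k = ℤ.drop‿+≤+ (≤-by (1ℤ + + t) (+ k) (upper ⊕ Y-mono i≤h ⊕ ≡⇒≤ (sym y≡)) (shape₃ y (Y i) (Y h) (+ t) (+ k)))
      where
      shape₃ : ∀ y u v t k → k + (y + 1ℤ + u + (v + t)) ≡ 1ℤ + t + (u + k + v + y)
      shape₃ = solve-∀
    t′ : Fin k
    t′ = fromℕ< t<k
    listed : tower (residue h) t′ ∈ boxes
    listed = ∈.∈-cartesianProductWith⁺ tower (∈.∈-filter⁺ (λ s → lookup steps s ≟ˢ R) (∈.∈-allFin (residue h)) isR) (∈.∈-allFin t′)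

  length-boxes : length boxes ≡ (n ℕ.∸ k) ℕ.* k
  length-boxes = trans (product-length RS) (cong (ℕ._* k) (trans (filter-count R steps) (trans (sym (occurrences-all R steps)) (trans (sym (ℕ.m+n∸n≡m (seen R n) k)) (cong (ℕ._∸ k) seen-R)))))
    where
    product-length : ∀ xs → length (cartesianProductWith tower xs (allFin k)) ≡ length xs ℕ.* k
    product-length []       = refl
    product-length (x ∷ xs) = trans (List.length-++ (map (tower x) (allFin k)))
      (cong₂ ℕ._+_ (trans (List.length-map (tower x) (allFin k)) (List.length-tabulate (λ t → t))) (product-length xs))
    filter-count : ∀ d {m} (v : Vec Step m) → length (filter (λ s → lookup v s ≟ˢ d) (allFin m)) ≡ count (_≟ˢ d) v
    filter-count d v = go (lookup v) (λ s → s) v (λ _ → refl)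
      where
      go : ∀ {b} {B : Set b} (g : B → Step) {m} (h : Fin m → B) (v : Vec Step m) → (∀ s → g (h s) ≡ lookup v s) →
           length (filter (λ s → g s ≟ˢ d) (List.tabulate h)) ≡ count (_≟ˢ d) v
      go g h []      eq = refl
      go g h (x ∷ v) eq rewrite eq zero with does (x ≟ˢ d)
      ... | true  = cong suc (go g (h ∘ suc) v (eq ∘ suc))
      ... | false = go g (h ∘ suc) v (eq ∘ suc)

-- Transpositions of bounded affine permutations

module ∑ℕ = CMSum ℕ.+-0-commutativeMonoid
module ∑ℤ = CMSum ℤ.+-0-commutativeMonoid

val : Bool → ℕ
val true  = 1
val false = 0

∑ℕ-indicator : ∀ {N} (i : Fin N) → ∑ℕ.sum (λ j → val (does (j Fin.≟ i))) ≡ 1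
∑ℕ-indicator {suc N} zero    = cong suc (∑ℕ.sum-replicate-zero N)
∑ℕ-indicator {suc N} (suc i) = ∑ℕ-indicator i

∑ℕ-increase : ∀ {N} (i : Fin N) {f g : Fin N → ℕ} → (∀ j → f j ≡ g j ℕ.+ val (does (j Fin.≟ i))) → ∑ℕ.sum f ≡ suc (∑ℕ.sum g)
∑ℕ-increase i {f} {g} eq = trans (∑ℕ.sum-cong-≗ eq)
  (trans (∑ℕ.∑-distrib-+ g _) (trans (cong (∑ℕ.sum g ℕ.+_) (∑ℕ-indicator i)) (ℕ.+-comm _ 1)))

∑ℤ-balanced : ∀ {N} (i i′ : Fin N) {f g : Fin N → ℤ} →
  (∀ j → f j ≡ g j + (+ val (does (j Fin.≟ i)) - + val (does (j Fin.≟ i′)))) → ∑ℤ.sum f ≡ ∑ℤ.sum g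
∑ℤ-balanced i i′ {f} {g} eq = begin
  ∑ℤ.sum f                                                                    ≡⟨ ∑ℤ.sum-cong-≗ eq ⟩
  ∑ℤ.sum (λ j → g j + (+ at i j - + at i′ j))                                  ≡⟨ ∑ℤ.∑-distrib-+ g _ ⟩
  ∑ℤ.sum g + ∑ℤ.sum (λ j → + at i j - + at i′ j)                               ≡⟨ cong (λ u → ∑ℤ.sum g + u) (difference (at i) (at i′)) ⟩
  ∑ℤ.sum g + (+ ∑ℕ.sum (at i) - + ∑ℕ.sum (at i′))                              ≡⟨ cong₂ (λ u v → ∑ℤ.sum g + (+ u - + v)) (∑ℕ-indicator i) (∑ℕ-indicator i′) ⟩
  ∑ℤ.sum g + 0ℤ                                                                ≡⟨ ℤ.+-identityʳ _ ⟩
  ∑ℤ.sum g                                                                     ∎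
  where
  open ≡-Reasoning
  at : ∀ {N} → Fin N → Fin N → ℕ
  at i j = val (does (j Fin.≟ i))
  regroup : ∀ a b c d → a - b + (c - d) ≡ a + c - (b + d)
  regroup = solve-∀
  difference : ∀ {N} (u v : Fin N → ℕ) → ∑ℤ.sum (λ j → + u j - + v j) ≡ + ∑ℕ.sum u - + ∑ℕ.sum v
  difference {zero}  u v = refl
  difference {suc N} u v = trans (cong (λ w → + u zero - + v zero + w) (difference (u ∘ suc) (v ∘ suc)))
                             (regroup (+ u zero) (+ v zero) (+ ∑ℕ.sum (u ∘ suc)) (+ ∑ℕ.sum (v ∘ suc)))

∑-map-allFin : ∀ {N} (g : ℤ → ℤ) (h : Fin N → ℤ) → sumℤ (map g (map h (allFin N))) ≡ ∑ℤ.sum (g ∘ h)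
∑-map-allFin {N} g h = trans (cong sumℤ (trans (sym (List.map-∘ (allFin N))) (List.map-tabulate (λ i → i) (g ∘ h)))) (go (g ∘ h))
  where
  go : ∀ {N} (u : Fin N → ℤ) → sumℤ (tabulate u) ≡ ∑ℤ.sum u
  go {zero}  u = refl
  go {suc N} u = cong (λ w → u zero + w) (go (u ∘ suc))

length-filter-tabulate : ∀ {N a p} {A : Set a} {Q : A → Set p} (Q? : ∀ x → Dec (Q x)) (h : Fin N → A) →
  length (filter Q? (tabulate h)) ≡ ∑ℕ.sum (λ i → val (does (Q? (h i))))
length-filter-tabulate {zero}  Q? h = refl
length-filter-tabulate {suc N} Q? h with does (Q? (h zero))
... | true  = cong suc (length-filter-tabulate Q? (h ∘ suc))
... | false = length-filter-tabulate Q? (h ∘ suc)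

infix 5 _<ᵇ_
_<ᵇ_ : ℤ → ℤ → Bool
i <ᵇ j = does (i ℤ.<? j)

affineLength-∑ : ∀ n f → affineLength n f ≡ ∑ℕ.sum {n} (λ s → ∑ℕ.sum {n} (λ j → val (f (label s + label j) <ᵇ f (label s))))
affineLength-∑ n f = begin
  length (filter inverted? (cartesianProduct [1⋯ n ] [1⋯ n ]))               ≡⟨ cong (λ xs → length (filter inverted? (cartesianProduct xs xs))) tabulated ⟩
  length (filter inverted? (cartesianProduct (tabulate {n = n} label) (tabulate {n = n} label))) ≡⟨ rows {n} label ⟩
  ∑ℕ.sum {n} (λ s → ∑ℕ.sum {n} (row {n} label s))                                   ∎
  where
  open ≡-Reasoning
  inverted? : ∀ ((a , j) : ℤ × ℤ) → Dec (f (a + j) < f a)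
  inverted? (a , j) = f (a + j) ℤ.<? f a
  tabulated : [1⋯ n ] ≡ tabulate {n = n} label
  tabulated = List.map-tabulate (λ i → i) label
  row : ∀ {N} (h : Fin N → ℤ) → Fin N → Fin n → ℕ
  row h s j = val (f (h s + label j) <ᵇ f (h s))
  rows : ∀ {N} (h : Fin N → ℤ) → length (filter inverted? (cartesianProduct (tabulate h) (tabulate {n = n} label))) ≡
         ∑ℕ.sum {N} (λ s → ∑ℕ.sum {n} (row h s))
  rows {zero}  h = refl
  rows {suc N} h = begin
    length (filter inverted? (pairs ++ rest))                        ≡⟨ cong length (List.filter-++ inverted? pairs rest) ⟩
    length (filter inverted? pairs ++ filter inverted? rest)         ≡⟨ List.length-++ (filter inverted? pairs) ⟩
    length (filter inverted? pairs) ℕ.+ length (filter inverted? rest)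
      ≡⟨ cong (λ xs → length (filter inverted? xs) ℕ.+ length (filter inverted? rest)) tabulated-pairs ⟩
    length (filter inverted? (tabulate {n = n} (λ j → h zero , label j))) ℕ.+ length (filter inverted? rest)
      ≡⟨ cong₂ ℕ._+_ (length-filter-tabulate {n} inverted? (λ j → h zero , label j)) (rows {N} (h ∘ suc)) ⟩
    ∑ℕ.sum {n} (row h zero) ℕ.+ ∑ℕ.sum {N} (λ s → ∑ℕ.sum {n} (row (h ∘ suc) s))  ∎
    where
    pairs = map (h zero ,_) (tabulate {n = n} label)
    tabulated-pairs : pairs ≡ tabulate {n = n} (λ j → h zero , label j)
    tabulated-pairs = List.map-tabulate label (h zero ,_)
    rest = cartesianProduct (tabulate (h ∘ suc)) (tabulate {n = n} label)

affineLength-cong : ∀ n {f g} → (∀ i → f i ≡ g i) → affineLength n f ≡ affineLength n g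
affineLength-cong n {f} {g} eq = begin
  affineLength n f                                  ≡⟨ affineLength-∑ n f ⟩
  ∑ℕ.sum {n} (λ s → ∑ℕ.sum {n} (inversions f s))    ≡⟨ ∑ℕ.sum-cong-≗ {n} {λ s → ∑ℕ.sum (inversions f s)} {λ s → ∑ℕ.sum (inversions g s)} (λ s → ∑ℕ.sum-cong-≗ {n} {inversions f s} {inversions g s} (same s)) ⟩
  ∑ℕ.sum {n} (λ s → ∑ℕ.sum {n} (inversions g s))    ≡⟨ affineLength-∑ n g ⟨
  affineLength n g                                  ∎
  where
  open ≡-Reasoning
  inversions : (ℤ → ℤ) → Fin n → Fin n → ℕ
  inversions f s j = val (f (label s + label j) <ᵇ f (label s))
  same : ∀ s j → inversions f s j ≡ inversions g s j
  same s j = cong₂ (λ u v → val (u <ᵇ v)) (eq (label s + label j)) (eq (label s))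

<ᵇ-true : ∀ {i j} → i + 1ℤ ≤ j → i <ᵇ j ≡ true
<ᵇ-true {i} {j} lt = dec-true (i ℤ.<? j) (ℤ.suc[i]≤j⇒i<j (subst (_≤ j) (ℤ.+-comm i 1ℤ) lt))

<ᵇ-false : ∀ {i j} → j ≤ i → i <ᵇ j ≡ false
<ᵇ-false {i} {j} le = dec-false (i ℤ.<? j) (ℤ.≤⇒≯ le)

+1≤-or-≤ : ∀ i j → i + 1ℤ ≤ j ⊎ j ≤ i
+1≤-or-≤ i j with j ℤ.≤? i
... | yes le = inj₂ le
... | no  gt = inj₁ (≰⇒+1≤ gt)

≢⇒+1≤ : ∀ {i j} → i ≤ j → i ≢ j → i + 1ℤ ≤ j
≢⇒+1≤ {i} {j} le neq with +1≤-or-≤ i j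
... | inj₁ lt = lt
... | inj₂ ge = contradiction (ℤ.≤-antisym le ge) neq

-- This and the next lemma isolate the only position at which raising an integer by one changes a
-- comparison. The cases of `<ᵇ-partner` away from a common pair reduce to them.
<ᵇ-nudgeˡ : ∀ u v → v ≢ u + 1ℤ → u <ᵇ v ≡ u + 1ℤ <ᵇ v
<ᵇ-nudgeˡ u v v≢ with +1≤-or-≤ u v
... | inj₁ lt = trans (<ᵇ-true {u} {v} lt) (sym (<ᵇ-true {u + 1ℤ} {v} (≢⇒+1≤ lt (v≢ ∘ sym))))
... | inj₂ ge = trans (<ᵇ-false {u} {v} ge) (sym (<ᵇ-false {u + 1ℤ} {v} (ℤ.≤-trans ge (i≤i+1 u))))

<ᵇ-nudgeʳ : ∀ u v → v ≢ u → v <ᵇ u ≡ v <ᵇ u + 1ℤ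
<ᵇ-nudgeʳ u v v≢ with +1≤-or-≤ v u
... | inj₁ lt = trans (<ᵇ-true {v} {u} lt) (sym (<ᵇ-true {v} {u + 1ℤ} (ℤ.≤-trans lt (i≤i+1 u))))
... | inj₂ ge = trans (<ᵇ-false {v} {u} ge) (sym (<ᵇ-false {v} {u + 1ℤ} (≢⇒+1≤ ge (v≢ ∘ sym))))

-- The inverse b is part of the data because it is the traced map `source`, whereas f is assembled
-- from transpositions; the first two fields say that both describe the same permutation.
record Bounded (n : ℕ) (f b : ℤ → ℤ) : Set where
  field
    f∘b      : ∀ j → f (b j) ≡ j
    b∘f      : ∀ i → b (f i) ≡ i
    periodic : ∀ i m → f (i + m * + n) ≡ f i + m * + n
    lower    : ∀ i → i ≤ f i
    upper    : ∀ i → f i ≤ i + + n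

  f-injective : ∀ {i i′} → f i ≡ f i′ → i ≡ i′
  f-injective {i} {i′} eq = trans (sym (b∘f i)) (trans (cong b eq) (b∘f i′))

  b-periodic : ∀ j m → b (j + m * + n) ≡ b j + m * + n
  b-periodic j m = f-injective (trans (f∘b (j + m * + n)) (sym (trans (periodic (b j) m) (cong (_+ m * + n) (f∘b j)))))

module Transposition (n : ℕ) .{{_ : NonZero n}} (2≤n : 2 ℕ.≤ n) (P : ℤ) where

  at : ℤ → ℤ
  at m = P + m * + n

  data View (j : ℤ) : Set where
    low  : ∀ m → j ≡ at m → View j
    high : ∀ m → j ≡ at m + 1ℤ → View j
    off  : (∀ m → j ≢ at m) → (∀ m → j ≢ at m + 1ℤ) → View j

  partner : ∀ {j} → View j → ℤ
  partner     (low m _)  = at m + 1ℤ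
  partner     (high m _) = at m
  partner {j} (off _ _)  = j

  private
    ∣multiple∣≢1 : ∀ d → d * + n ≢ 1ℤ
    ∣multiple∣≢1 d eq = ℕ.<⇒≢ 2≤n (sym (ℕ.m*n≡1⇒n≡1 ∣ d ∣ n (trans (sym (ℤ.abs-* d (+ n))) (cong ∣_∣ eq))))

  -- The residues of P and P + 1 modulo n differ because 2 ≤ n; for n = 1 there would be nothing to
  -- transpose.
  at≢at+1 : ∀ {m m′} → at m ≢ at m′ + 1ℤ
  at≢at+1 {m} {m′} eq = ∣multiple∣≢1 (m - m′) (trans (shape m m′ (+ n) P) (trans (cong (λ u → u - at m′) eq) (shape₂ (at m′))))
    where
    shape : ∀ m m′ n p → (m - m′) * n ≡ p + m * n - (p + m′ * n)
    shape = solve-∀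
    shape₂ : ∀ u → u + 1ℤ - u ≡ 1ℤ
    shape₂ = solve-∀

  at-injective : ∀ {m m′} → at m ≡ at m′ → m ≡ m′
  at-injective {m} {m′} eq = ℤ.*-cancelʳ-≡ m m′ (+ n) (trans (isolate P (m * + n)) (trans (cong (_- P) eq) (sym (isolate P (m′ * + n)))))
    where
    isolate : ∀ p u → u ≡ p + u - p
    isolate = solve-∀

  +1-cancel : ∀ {u v} → u + 1ℤ ≡ v + 1ℤ → u ≡ v
  +1-cancel {u} {v} eq = trans (isolate u) (trans (cong (_- 1ℤ) eq) (sym (isolate v)))
    where
    isolate : ∀ u → u ≡ u + 1ℤ - 1ℤ
    isolate = solve-∀

  view : ∀ j → View j
  view j with (j - P) %ℕ n in r≡ | a≡a%ℕn+[a/ℕn]*n (j - P) n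
  ... | 0 | eq = low ((j - P) /ℕ n) (trans (isolate j P) (cong (λ u → P + u) (trans eq (ℤ.+-identityˡ _))))
    where
    isolate : ∀ j p → j ≡ p + (j - p)
    isolate = solve-∀
  ... | 1 | eq = high ((j - P) /ℕ n) (trans (isolate j P) (trans (cong (λ u → P + u) eq) (shape P ((j - P) /ℕ n * + n))))
    where
    isolate : ∀ j p → j ≡ p + (j - p)
    isolate = solve-∀
    shape : ∀ p u → p + (1ℤ + u) ≡ p + u + 1ℤ
    shape = solve-∀
  ... | suc (suc r) | eq = off (λ m j≡ → not-low m j≡) (λ m j≡ → not-high m j≡)
    where
    -- Uniqueness of division: a representation of j with remainder t < n makes t equal to suc (suc
    -- r), which excludes the values 0 and 1 below.
    quotient : ∀ m (t : ℕ) → t ℕ.< n → j ≡ P + (m * + n + + t) → + suc (suc r) ≡ + t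
    quotient m t t<n j≡ = trans (isolate (+ suc (suc r)) ((j - P) /ℕ n * + n)) (trans (cong₂ _-_ (trans (sym eq) j-P≡) (cong (_* + n) q≡m)) (shape₂ (m * + n) (+ t)))
      where
      shape : ∀ p u → p + u - p ≡ u
      shape = solve-∀
      shape₂ : ∀ u v → u + v - u ≡ v
      shape₂ = solve-∀
      isolate : ∀ u v → u ≡ u + v - v
      isolate = solve-∀
      j-P≡ : j - P ≡ m * + n + + t
      j-P≡ = trans (cong (_- P) j≡) (shape P (m * + n + + t))
      q≡m : (j - P) /ℕ n ≡ m
      q≡m = /ℕ-unique n (j - P) m (ℤ.≤-trans (ℤ.i≤i+j (m * + n) (+ t)) (≡⇒≤ (sym j-P≡)))
        (ℤ.≤-<-trans (≡⇒≤ j-P≡) (ℤ.<-≤-trans (ℤ.+-monoʳ-< (m * + n) (+<+ t<n)) (≡⇒≤ (trans (ℤ.+-comm (m * + n) (+ n)) (sym (ℤ.suc-* m (+ n)))))))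
    not-low : ∀ m → j ≢ at m
    not-low m j≡ with () ← quotient m 0 (ℕ.>-nonZero⁻¹ n) (trans j≡ (cong (λ u → P + u) (sym (ℤ.+-identityʳ (m * + n)))))
    not-high : ∀ m → j ≢ at m + 1ℤ
    not-high m j≡ with () ← quotient m 1 2≤n (trans j≡ (ℤ.+-assoc P (m * + n) 1ℤ))

  swap : ℤ → ℤ
  swap j = partner (view j)

  -- A view contains a choice of m with a proof. Independence of the choice lets `swap` be evaluated
  -- through whichever view is at hand.
  partner-unique : ∀ {j} (v w : View j) → partner v ≡ partner w
  partner-unique (low m e)  (low m′ e′)  = cong (_+ 1ℤ) (trans (sym e) e′)
  partner-unique (low m e)  (high m′ e′) = contradiction (trans (sym e) e′) (at≢at+1 {m} {m′})
  partner-unique (low m e)  (off ≢at _)  = contradiction e (≢at m)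
  partner-unique (high m e) (low m′ e′)  = contradiction (trans (sym e′) e) (at≢at+1 {m′} {m})
  partner-unique (high m e) (high m′ e′) = +1-cancel (trans (sym e) e′)
  partner-unique (high m e) (off _ ≢at)  = contradiction e (≢at m)
  partner-unique (off ≢at _) (low m e)   = contradiction e (≢at m)
  partner-unique (off _ ≢at) (high m e)  = contradiction e (≢at m)
  partner-unique (off _ _)  (off _ _)    = refl

  swap-view : ∀ {j} (v : View j) → swap j ≡ partner v
  swap-view {j} v = partner-unique (view j) v

  swap-at : ∀ m → swap (at m) ≡ at m + 1ℤ
  swap-at m = swap-view (low m refl)

  swap-at+1 : ∀ m → swap (at m + 1ℤ) ≡ at m
  swap-at+1 m = swap-view (high m refl)

  swap-involutive : ∀ j → swap (swap j) ≡ j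
  swap-involutive j with view j
  ... | low m e  = trans (swap-at+1 m) (sym e)
  ... | high m e = trans (swap-at m) (sym e)
  ... | off a b  = swap-view (off a b)

  at-+ : ∀ m m′ → at m + m′ * + n ≡ at (m + m′)
  at-+ m m′ = shape P m m′ (+ n)
    where
    shape : ∀ p u v w → p + u * w + v * w ≡ p + (u + v) * w
    shape = solve-∀

  private
    swap-+1 : ∀ u v → u + 1ℤ + v ≡ u + v + 1ℤ
    swap-+1 = solve-∀

  at+1-+ : ∀ m m′ → at m + 1ℤ + m′ * + n ≡ at (m + m′) + 1ℤ
  at+1-+ m m′ = trans (swap-+1 (at m) (m′ * + n)) (cong (_+ 1ℤ) (at-+ m m′))

  swap-periodic : ∀ j m → swap (j + m * + n) ≡ swap j + m * + n
  swap-periodic j m with view j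
  ... | low m′ refl  = trans (cong swap (at-+ m′ m)) (trans (swap-at (m′ + m)) (sym (at+1-+ m′ m)))
  ... | high m′ refl = trans (cong swap (at+1-+ m′ m)) (trans (swap-at+1 (m′ + m)) (sym (at-+ m′ m)))
  ... | off a b      = swap-view (off (λ m′ eq → a (m′ - m) (back (at m′) (at (m′ - m)) eq (trans (at-+ (m′ - m) m) (cong at (shape m′ m)))))
                                      (λ m′ eq → b (m′ - m) (back (at m′ + 1ℤ) (at (m′ - m) + 1ℤ) eq (trans (at+1-+ (m′ - m) m) (cong (λ u → at u + 1ℤ) (shape m′ m))))))
    where
    shape : ∀ u v → u - v + v ≡ u
    shape = solve-∀
    back : ∀ u v → j + m * + n ≡ u → v + m * + n ≡ u → j ≡ v
    back u v eq eq′ = trans (isolate j (m * + n)) (trans (cong (_- m * + n) (trans eq (sym eq′))) (sym (isolate v (m * + n))))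
      where
      isolate : ∀ u v → u ≡ u + v - v
      isolate = solve-∀

  -- Tells whether both labels lie in one pair `at m`, `at m + 1ℤ`; these are the only pairs whose
  -- order the swap reverses.
  meet : ∀ {j j′} → View j → View j′ → Bool
  meet (low m _)  (low m′ _)  = does (m ℤ.≟ m′)
  meet (low m _)  (high m′ _) = does (m ℤ.≟ m′)
  meet (high m _) (low m′ _)  = does (m ℤ.≟ m′)
  meet (high m _) (high m′ _) = does (m ℤ.≟ m′)
  meet (off _ _)  _           = false
  meet (low _ _)  (off _ _)   = false
  meet (high _ _) (off _ _)   = false

  -- A simple transposition reverses only the pairs that it exchanges. All other comparisons survive
  -- because no integer lies strictly between the two exchanged ones.
  <ᵇ-partner : ∀ {j j′} → j ≢ j′ → (v : View j) (w : View j′) → j <ᵇ j′ ≡ meet v w xor (partner v <ᵇ partner w)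
  <ᵇ-partner j≢j′ (low m refl) (low m′ refl) with m ℤ.≟ m′
  ... | yes refl = contradiction refl j≢j′
  ... | no  m≢m′ = trans (<ᵇ-nudgeˡ (at m) (at m′) (at≢at+1 {m′} {m})) (<ᵇ-nudgeʳ (at m′) (at m + 1ℤ) ((at≢at+1 {m′} {m}) ∘ sym))
  <ᵇ-partner j≢j′ (low m refl) (high m′ refl) with m ℤ.≟ m′
  ... | yes refl = trans (<ᵇ-true {at m} {at m + 1ℤ} ℤ.≤-refl) (cong not (sym (<ᵇ-false {at m + 1ℤ} {at m} (i≤i+1 (at m)))))
  ... | no  m≢m′ = trans (<ᵇ-nudgeˡ (at m) (at m′ + 1ℤ) λ eq → m≢m′ (sym (at-injective (+1-cancel eq))))
                         (sym (<ᵇ-nudgeʳ (at m′) (at m + 1ℤ) ((at≢at+1 {m′} {m}) ∘ sym)))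
  <ᵇ-partner j≢j′ (high m refl) (low m′ refl) with m ℤ.≟ m′
  ... | yes refl = trans (<ᵇ-false {at m + 1ℤ} {at m} (i≤i+1 (at m))) (cong not (sym (<ᵇ-true {at m} {at m + 1ℤ} ℤ.≤-refl)))
  ... | no  m≢m′ = trans (sym (<ᵇ-nudgeˡ (at m) (at m′) (at≢at+1 {m′} {m}))) (<ᵇ-nudgeʳ (at m′) (at m) λ eq → m≢m′ (at-injective eq))
  <ᵇ-partner j≢j′ (high m refl) (high m′ refl) with m ℤ.≟ m′
  ... | yes refl = contradiction refl j≢j′
  ... | no  m≢m′ = sym (trans (<ᵇ-nudgeˡ (at m) (at m′) (at≢at+1 {m′} {m})) (<ᵇ-nudgeʳ (at m′) (at m + 1ℤ) ((at≢at+1 {m′} {m}) ∘ sym)))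
  <ᵇ-partner {j′ = j′} j≢j′ (low m refl)  (off a b)     = <ᵇ-nudgeˡ (at m) j′ (b m)
  <ᵇ-partner {j′ = j′} j≢j′ (high m refl) (off a b)     = sym (<ᵇ-nudgeˡ (at m) j′ (b m))
  <ᵇ-partner {j} j≢j′ (off a b)     (low m refl)  = <ᵇ-nudgeʳ (at m) j (a m)
  <ᵇ-partner {j} j≢j′ (off a b)     (high m refl) = sym (<ᵇ-nudgeʳ (at m) j (a m))
  <ᵇ-partner j≢j′ (off _ _)     (off _ _)     = refl

  module _ {f b : ℤ → ℤ} (F : Bounded n f b) where

    open Bounded F

    private
      α β : ℤ
      α = b P
      β = b (P + 1ℤ)

      f≡low : ∀ {i} m → f i ≡ at m → i ≡ α + m * + n
      f≡low {i} m eq = trans (sym (b∘f i)) (trans (cong b eq) (b-periodic P m))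

      f≡high : ∀ {i} m → f i ≡ at m + 1ℤ → i ≡ β + m * + n
      f≡high {i} m eq = trans (sym (b∘f i)) (trans (cong b (trans eq (sym (swap-+1 P (m * + n))))) (b-periodic (P + 1ℤ) m))

      f-low : ∀ m → f (α + m * + n) ≡ at m
      f-low m = trans (periodic α m) (cong (_+ m * + n) (f∘b P))

      f-high : ∀ m → f (β + m * + n) ≡ at m + 1ℤ
      f-high m = trans (periodic β m) (trans (cong (_+ m * + n) (f∘b (P + 1ℤ))) (swap-+1 P (m * + n)))

      label-residue′ : ∀ (s : Fin n) → residue {n} (label s) ≡ s
      label-residue′ s = trans (cong (residue {n}) (sym (ℤ.+-identityʳ (label s)))) (residue-label s 0ℤ)

      label-of : ∀ γ → label (residue {n} γ) ≡ γ + (- period {n} γ) * + n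
      label-of γ = trans (isolate (label (residue {n} γ)) (period {n} γ) (+ n)) (cong (λ u → u + (- period {n} γ) * + n) (sym (label-split {n} γ)))
        where
        isolate : ∀ a m n → a ≡ a + m * n + - m * n
        isolate = solve-∀

      residue-of : ∀ {s : Fin n} γ m → label s ≡ γ + m * + n → s ≡ residue {n} γ
      residue-of {s} γ m eq = trans (sym (label-residue′ s)) (trans (cong (residue {n}) eq) (residue-+ {n} γ m))

    private
      f-residue-α : ∀ {s} → s ≡ residue {n} α → f (label s) ≡ at (- period {n} α)
      f-residue-α refl = trans (cong f (label-of α)) (f-low (- period {n} α))

      f-residue-β : ∀ {s} → s ≡ residue {n} β → f (label s) ≡ at (- period {n} β) + 1ℤ
      f-residue-β refl = trans (cong f (label-of β)) (f-high (- period {n} β))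

    -- In each period one value of f goes up by one, at the class of α, and one goes down by one, at
    -- the class of β.
    average-swap : sumℤ (map (λ i → swap (f i) - i) [1⋯ n ]) ≡ sumℤ (map (λ i → f i - i) [1⋯ n ])
    average-swap = trans (∑-map-allFin {n} (λ i → swap (f i) - i) label) (trans
      (∑ℤ-balanced {n} (residue α) (residue β) at-s)
      (sym (∑-map-allFin {n} (λ i → f i - i) label)))
      where
      at-s : ∀ s → swap (f (label s)) - label s ≡ f (label s) - label s + (+ val (does (s Fin.≟ residue α)) - + val (does (s Fin.≟ residue β)))
      at-s s with view (f (label s))
      ... | low m e  rewrite dec-true (s Fin.≟ residue α) (residue-of α m (f≡low m e))
                           | dec-false (s Fin.≟ residue β) (λ s≡ → at≢at+1 {m} { - period β} (trans (sym e) (f-residue-β s≡))) =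
        trans (shape (at m) (label s)) (cong (λ u → u - label s + 1ℤ) (sym e))
        where
        shape : ∀ u v → u + 1ℤ - v ≡ u - v + 1ℤ
        shape = solve-∀
      ... | high m e rewrite dec-true (s Fin.≟ residue β) (residue-of β m (f≡high m e))
                           | dec-false (s Fin.≟ residue α) (λ s≡ → at≢at+1 { - period α} {m} (trans (sym (f-residue-α s≡)) e)) =
        trans (shape (at m) (label s)) (cong (λ u → u - label s - 1ℤ) (sym e))
        where
        shape : ∀ u v → u - v ≡ u + 1ℤ - v - 1ℤ
        shape = solve-∀
      ... | off x y  rewrite dec-false (s Fin.≟ residue α) (λ s≡ → x (- period α) (f-residue-α s≡))
                           | dec-false (s Fin.≟ residue β) (λ s≡ → y (- period β) (f-residue-β s≡)) =
        sym (ℤ.+-identityʳ _)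

    -- By `<ᵇ-partner` the only comparison that changes, up to translation, is the one between α and
    -- β, and it turns into an inversion. The bounds on swap ∘ f ensure that `affineLength` sees
    -- this inversion, in row s₀ and column j₀.
    length-swap : (∀ i → i ≤ swap (f i)) → (∀ i → swap (f i) ≤ i + + n) → α < β →
                  affineLength n (swap ∘ f) ≡ suc (affineLength n f)
    length-swap lo hi α<β = trans (affineLength-∑ n (swap ∘ f)) (trans (∑ℕ-increase s₀ {λ s → ∑ℕ.sum (inversions (swap ∘ f) s)} {λ s → ∑ℕ.sum (inversions f s)} rows) (cong suc (sym (affineLength-∑ n f))))
      where
      inversions : (ℤ → ℤ) → Fin n → Fin n → ℕ
      inversions f s j = val (f (label s + label j) <ᵇ f (label s))

      s₀ : Fin n
      s₀ = residue α

      α+1≤β : α + 1ℤ ≤ β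
      α+1≤β = subst (_≤ β) (ℤ.+-comm 1ℤ α) (ℤ.i<j⇒suc[i]≤j α<β)

      swapP : swap P ≡ P + 1ℤ
      swapP = trans (cong swap (sym (ℤ.+-identityʳ P))) (trans (swap-at 0ℤ) (cong (_+ 1ℤ) (ℤ.+-identityʳ P)))

      swapP+1 : swap (P + 1ℤ) ≡ P
      swapP+1 = trans (cong swap (sym swapP)) (swap-involutive P)

      β≤P : β ≤ P
      β≤P = ℤ.≤-trans (lo β) (≡⇒≤ (trans (cong swap (f∘b (P + 1ℤ))) swapP+1))

      P+1≤α+n : P + 1ℤ ≤ α + + n
      P+1≤α+n = ℤ.≤-trans (≡⇒≤ (sym (trans (cong swap (f∘b P)) swapP))) (hi α)

      gap : ∃ λ d → β ≡ α + 1ℤ + + d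
      gap = upTo α+1≤β

      -- From β ≤ swap (f β) = P and P + 1 = swap (f α) ≤ α + n the difference β - α is less than n,
      -- so it lies in the window [n] of `affineLength`.
      d<n : proj₁ gap ℕ.< n
      d<n = ℤ.drop‿+≤+ (≤-by (1ℤ + + proj₁ gap) (+ n) (β≤P ⊕ P+1≤α+n ⊕ ≡⇒≤ (sym (proj₂ gap)) ⊕ i≤i+1 0ℤ) (shape α β P (+ n) (+ proj₁ gap)))
        where
        shape : ∀ a b p n d → n + (b + (p + 1ℤ) + (a + 1ℤ + d) + 0ℤ) ≡ 1ℤ + d + (p + (a + n) + b + (0ℤ + 1ℤ))
        shape = solve-∀

      j₀ : Fin n
      j₀ = fromℕ< d<n

      label-j₀ : β ≡ α + label j₀
      label-j₀ = trans (proj₂ gap) (trans (ℤ.+-assoc α 1ℤ _) (cong (λ t → α + + suc t) (sym (Fin.toℕ-fromℕ< d<n))))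

      label-injective : ∀ {s s′ : Fin n} → label s ≡ label s′ → s ≡ s′
      label-injective eq = Fin.toℕ-injective (ℕ.suc-injective (ℤ.+-injective eq))

      swap-+ : ∀ u v w → u + v + w ≡ u + w + v
      swap-+ = solve-∀

      b₀ : f (label s₀ + label j₀) ≡ at (- period α) + 1ℤ
      b₀ = trans (cong f (trans (cong (_+ label j₀) (label-of α)) (trans (swap-+ α (- period α * + n) (label j₀)) (cong (_+ - period α * + n) (sym label-j₀))))) (f-high (- period α))

      ahead : ∀ (s j : Fin n) → label s ≢ label s + label j
      ahead s j eq = nonzero (trans (isolate (label s) (label j)) (trans (cong (_- label s) (sym eq)) (ℤ.+-inverseʳ (label s))))
        where
        nonzero : label j ≢ 0ℤ
        nonzero ()
        isolate : ∀ u v → v ≡ u + v - u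
        isolate = solve-∀

      pair : Fin n → Fin n → Bool
      pair s j = does (s Fin.≟ s₀) ∧ does (j Fin.≟ j₀)

      Entry : Fin n → Fin n → ℤ → ℤ → Set
      Entry s j u v = val (u <ᵇ v) ≡ val (f (label s + label j) <ᵇ f (label s)) ℕ.+ val (pair s j)

      elsewhere : ∀ s j (v : View (f (label s + label j))) (w : View (f (label s))) → meet v w ≡ false → pair s j ≡ false
      elsewhere s j v w apart = go (s Fin.≟ s₀) (j Fin.≟ j₀)
        where
        meets : ∀ {y x} (v : View y) (w : View x) → y ≡ at (- period {n} α) + 1ℤ → x ≡ at (- period {n} α) → meet v w ≡ true
        meets (high m e) (low m′ e′)  y≡ x≡ = dec-true (m ℤ.≟ m′) (trans (at-injective {m} { - period {n} α} (+1-cancel (trans (sym e) y≡))) (at-injective { - period {n} α} {m′} (trans (sym x≡) e′)))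
        meets (low m e)  _            y≡ x≡ = contradiction (trans (sym e) y≡) (at≢at+1 {m} { - period {n} α})
        meets (off x y)  _            y≡ x≡ = contradiction y≡ (y (- period {n} α))
        meets (high m e) (high m′ e′) y≡ x≡ = contradiction (trans (sym x≡) e′) (at≢at+1 { - period {n} α} {m′})
        meets (high m e) (off x y)    y≡ x≡ = contradiction x≡ (x (- period {n} α))
        go : (d : Dec (s ≡ s₀)) (d′ : Dec (j ≡ j₀)) → does d ∧ does d′ ≡ false
        go (no _)   _        = refl
        go (yes _)  (no _)   = refl
        go (yes s≡) (yes j≡) = contradiction (trans (sym apart) (meets v w (trans (cong₂ (λ s j → f (label s + label j)) s≡ j≡) b₀) (f-residue-α s≡))) λ ()

      s≡s₀ : ∀ {s m} → f (label s) ≡ at m → s ≡ s₀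
      s≡s₀ {s} {m} e = residue-of α m (f≡low m e)

      j≡j₀ : ∀ {s j m} → f (label s + label j) ≡ at m + 1ℤ → f (label s) ≡ at m → j ≡ j₀
      j≡j₀ {s} {j} {m} e e′ = label-injective (begin
        label j                                       ≡⟨ isolate (label s) (label j) ⟩
        label s + label j - label s                   ≡⟨ cong₂ _-_ (f≡high m e) (f≡low m e′) ⟩
        β + m * + n - (α + m * + n)                   ≡⟨ cong (λ u → u + m * + n - (α + m * + n)) label-j₀ ⟩
        α + label j₀ + m * + n - (α + m * + n)        ≡⟨ shape α (label j₀) (m * + n) ⟩
        label j₀                                      ∎)
        where
        open ≡-Reasoning
        isolate : ∀ u v → v ≡ u + v - u
        isolate = solve-∀
        shape : ∀ u v w → u + v + w - (u + w) ≡ v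
        shape = solve-∀

      pair-true : ∀ {s j} → s ≡ s₀ → j ≡ j₀ → pair s j ≡ true
      pair-true {s} {j} s≡ j≡ = cong₂ _∧_ (dec-true (s Fin.≟ s₀) s≡) (dec-true (j Fin.≟ j₀) j≡)

      ascent : ∀ s j m → f (label s + label j) ≡ at m + 1ℤ → f (label s) ≡ at m → Entry s j (at m) (at m + 1ℤ)
      ascent s j m e e′ = begin
        val (at m <ᵇ at m + 1ℤ)                                           ≡⟨ cong val (<ᵇ-true {at m} {at m + 1ℤ} ℤ.≤-refl) ⟩
        val false ℕ.+ val true                                            ≡⟨ cong₂ (λ x y → val x ℕ.+ val y) (<ᵇ-false {at m + 1ℤ} {at m} (i≤i+1 (at m))) (pair-true (s≡s₀ {m = m} e′) (j≡j₀ {s} {j} {m} e e′)) ⟨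
        val (at m + 1ℤ <ᵇ at m) ℕ.+ val (pair s j)                        ≡⟨ cong₂ (λ x y → val (x <ᵇ y) ℕ.+ val (pair s j)) e e′ ⟨
        val (f (label s + label j) <ᵇ f (label s)) ℕ.+ val (pair s j)     ∎
        where open ≡-Reasoning

      no-descent : ∀ s j m → f (label s + label j) ≡ at m → f (label s) ≢ at m + 1ℤ
      no-descent s j m e e′ = ℤ.<⇒≱ α<β (≤-by β α (≡⇒≤ (f≡low {label s + label j} m e) ⊕ ≡⇒≤ (sym (f≡high {label s} m e′)) ⊕ ℤ.i≤i+j (0ℤ) (label j)) (shape (label s) (label j) α β (m * + n)))
        where
        shape : ∀ s j a b u → a + (s + j + (b + u) + 0ℤ) ≡ b + (a + u + s + (0ℤ + j))
        shape = solve-∀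

      does-true : ∀ {m m′ : ℤ} → does (m ℤ.≟ m′) ≡ true → m ≡ m′
      does-true {m} {m′} eq with yes m≡m′ ← m ℤ.≟ m′ = m≡m′

      -- Two values in one pair must be its two different members, since f is injective; the larger
      -- one cannot come earlier, since α < β. What is left is an ascent that the swap turns into a
      -- descent.
      meeting : ∀ s j {y x} (v : View y) (w : View x) → y ≡ f (label s + label j) → x ≡ f (label s) → meet v w ≡ true → Entry s j (partner v) (partner w)
      meeting s j (high m e) (low m′ e′)  y≡ x≡ met =
        subst (λ u → Entry s j (at m) (at u + 1ℤ)) m≡ (ascent s j m (trans (sym y≡) e) (trans (sym x≡) (trans e′ (cong at (sym m≡)))))
        where
        m≡ : m ≡ m′
        m≡ = does-true met
      meeting s j (low m e)  (high m′ e′) y≡ x≡ met =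
        contradiction (trans (sym x≡) (trans e′ (cong (λ u → at u + 1ℤ) (sym (does-true {m} {m′} met))))) (no-descent s j m (trans (sym y≡) e))
      meeting s j (low m e)  (low m′ e′)  y≡ x≡ met =
        contradiction (f-injective (trans (sym x≡) (trans e′ (trans (cong at (sym (does-true {m} {m′} met))) (trans (sym e) y≡))))) (ahead s j)
      meeting s j (high m e) (high m′ e′) y≡ x≡ met =
        contradiction (f-injective (trans (sym x≡) (trans e′ (trans (cong (λ u → at u + 1ℤ) (sym (does-true {m} {m′} met))) (trans (sym e) y≡))))) (ahead s j)

      entry : ∀ s j → Entry s j (swap (f (label s + label j))) (swap (f (label s)))
      entry s j = go (meet v w) refl
        where
        v = view (f (label s + label j))
        w = view (f (label s))
        go : ∀ t → meet v w ≡ t → Entry s j (partner v) (partner w)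
        go true  met   = meeting s j v w refl refl met
        go false apart = trans (cong val same) (trans (sym (ℕ.+-identityʳ _)) (cong (λ t → val (f (label s + label j) <ᵇ f (label s)) ℕ.+ val t) (sym (elsewhere s j v w apart))))
          where
          same : (partner v <ᵇ partner w) ≡ (f (label s + label j) <ᵇ f (label s))
          same = sym (trans (<ᵇ-partner (λ eq → ahead s j (sym (f-injective eq))) v w) (cong (_xor (partner v <ᵇ partner w)) apart))

      rows : ∀ s → ∑ℕ.sum (inversions (swap ∘ f) s) ≡ ∑ℕ.sum (inversions f s) ℕ.+ val (does (s Fin.≟ s₀))
      rows s = go (s Fin.≟ s₀) (entry s)
        where
        go : ∀ (d : Dec (s ≡ s₀)) → (∀ j → inversions (swap ∘ f) s j ≡ inversions f s j ℕ.+ val (does d ∧ does (j Fin.≟ j₀))) →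
             ∑ℕ.sum (inversions (swap ∘ f) s) ≡ ∑ℕ.sum (inversions f s) ℕ.+ val (does d)
        go (yes _) es = trans (∑ℕ-increase j₀ {inversions (swap ∘ f) s} {inversions f s} es) (ℕ.+-comm 1 _)
        go (no  _) es = trans (∑ℕ.sum-cong-≗ {n} {inversions (swap ∘ f) s} {inversions f s} λ j → trans (es j) (ℕ.+-identityʳ _)) (sym (ℕ.+-identityʳ _))

-- Strands

-1+1 : ∀ i → i - 1ℤ + 1ℤ ≡ i
-1+1 = solve-∀

+1-1 : ∀ i → i + 1ℤ - 1ℤ ≡ i
+1-1 = solve-∀

boxAfter-entryEdge : ∀ t d c → boxAfter (entryEdge t d c) ≡ c
boxAfter-entryEdge crossing U (x , y) = refl
boxAfter-entryEdge crossing R (x , y) = cong (x ,_) (+1-1 y)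
boxAfter-entryEdge elbow    U (x , y) = cong (x ,_) (+1-1 y)
boxAfter-entryEdge elbow    R (x , y) = refl

boxBefore-exitEdge : ∀ t d c → boxBefore (exitEdge t d c) ≡ c
boxBefore-exitEdge crossing U (x , y) = cong (_, y) (+1-1 x)
boxBefore-exitEdge crossing R (x , y) = refl
boxBefore-exitEdge elbow    U (x , y) = refl
boxBefore-exitEdge elbow    R (x , y) = cong (_, y) (+1-1 x)

exitEdge-entryEdge : ∀ t e → exitEdge t (proj₁ (entryEdge t (proj₁ e) (boxBefore e))) (boxBefore e) ≡ e
exitEdge-entryEdge crossing (U , (x , y)) = cong (λ u → U , (u , y)) (-1+1 x)
exitEdge-entryEdge crossing (R , (x , y)) = refl
exitEdge-entryEdge elbow    (U , (x , y)) = cong (λ u → U , (u , y)) (-1+1 x)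
exitEdge-entryEdge elbow    (R , (x , y)) = refl

entryEdge-exitEdge : ∀ t e → entryEdge t (proj₁ (exitEdge t (proj₁ e) (boxAfter e))) (boxAfter e) ≡ e
entryEdge-exitEdge crossing (U , (x , y)) = refl
entryEdge-exitEdge crossing (R , (x , y)) = cong (λ u → R , (x , u)) (-1+1 y)
entryEdge-exitEdge elbow    (U , (x , y)) = refl
entryEdge-exitEdge elbow    (R , (x , y)) = cong (λ u → R , (x , u)) (-1+1 y)

-- Tracing strands back from the southern boundary

module Backtracking {n k : ℕ} .{{_ : NonZero n}} (P : LatticePath n k) where

  open Strip P
  open PathGeometry P
  open StripGeometry P
  open BoxGeometry P

  entry-inside : ∀ {c} → StripBox c → ∀ t d → Northern (entryEdge t d c) ⊎ StripBox (boxBefore (entryEdge t d c))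
  entry-inside sb crossing U = left-inside sb
  entry-inside sb crossing R = top-inside sb
  entry-inside sb elbow    U = top-inside sb
  entry-inside sb elbow    R = left-inside sb

  exit-inside : ∀ {c} → StripBox c → ∀ t d → Southern (exitEdge t d c) ⊎ StripBox (boxAfter (exitEdge t d c))
  exit-inside sb crossing U = right-inside sb
  exit-inside sb crossing R = bottom-inside sb
  exit-inside sb elbow    U = bottom-inside sb
  exit-inside sb elbow    R = right-inside sb

  southLabel-south : ∀ i → southLabel (south i) ≡ i
  southLabel-south i = trans (cong southLabel (south-XY i)) (X+Y i)

  Southern-south : ∀ i → Southern (south i)
  Southern-south i = cong south (sym (southLabel-south i))

  -- An elbow turns the strand without leaving the antidiagonal. A strand that meets only elbows
  -- therefore ends at the label that it already has.
  southLabel-elbow : ∀ d c → southLabel (entryEdge elbow d c) ≡ southLabel (exitEdge elbow (proj₁ (entryEdge elbow d c)) c)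
  southLabel-elbow U (x , y) = shape x y
    where
    shape : ∀ x y → x + (y + 1ℤ) + 1ℤ ≡ x + 1ℤ + y + 1ℤ
    shape = solve-∀
  southLabel-elbow R (x , y) = refl

  rank-entry : ∀ {c} → StripBox c → ∀ t d → rank c < rank (boxBefore (entryEdge t d c))
  rank-entry {x , y} sb = λ where
      crossing U → from-left
      crossing R → from-top
      elbow    U → from-top
      elbow    R → from-left
    where
    from-left : rank (x , y) < rank (x - 1ℤ , y)
    from-left = subst (λ u → rank (u , y) < rank (x - 1ℤ , y)) (-1+1 x) (rank-right {x = x - 1ℤ} {y} sb)
    from-top : rank (x , y) < rank (x , y + 1ℤ)
    from-top = rank-down {x = x} {y} sb

  rank-exit : ∀ {c} → StripBox c → ∀ t d → rank (boxAfter (exitEdge t d c)) < rank c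
  rank-exit {x , y} sb = λ where
      crossing U → to-right
      crossing R → to-bottom
      elbow    U → to-bottom
      elbow    R → to-right
    where
    to-right : rank (x + 1ℤ , y) < rank (x , y)
    to-right = rank-right {x = x} {y} sb
    to-bottom : rank (x , y - 1ℤ) < rank (x , y)
    to-bottom = subst (λ u → rank (x , y - 1ℤ) < rank (x , u)) (-1+1 y) (rank-down {x = x} {y - 1ℤ} sb)

  reach-entry : ∀ {c c′ m} t d → Reach c c′ m → Reach (boxBefore (entryEdge t d c)) c′ (suc m)
  reach-entry {x , y} {x′ , y′} = λ where
      crossing U → from-left
      crossing R → from-top
      elbow    U → from-top
      elbow    R → from-left
    where
    shape : ∀ x a → x + a ≡ x - 1ℤ + (1ℤ + a)
    shape = solve-∀
    shape₂ : ∀ y b → y + b + 1ℤ ≡ y + (1ℤ + b)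
    shape₂ = solve-∀
    from-left : ∀ {m} → Reach (x , y) (x′ , y′) m → Reach (x - 1ℤ , y) (x′ , y′) (suc m)
    from-left (reach {a} {b} x≡ y≡ m≡) = reach {a = suc a} (trans x≡ (shape x (+ a))) y≡ (cong suc m≡)
    from-top : ∀ {m} → Reach (x , y) (x′ , y′) m → Reach (x , y + 1ℤ) (x′ , y′) (suc m)
    from-top (reach {a} {b} x≡ y≡ m≡) = reach {b = suc b} x≡ (trans (cong (_+ 1ℤ) y≡) (shape₂ y′ (+ b))) (trans (ℕ.+-suc a b) (cong suc m≡))

  reach-exit : ∀ {c c′ m} t d → Reach c c′ m → Reach c (boxAfter (exitEdge t d c′)) (suc m)
  reach-exit {x , y} {x′ , y′} = λ where
      crossing U → to-right
      crossing R → to-bottom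
      elbow    U → to-bottom
      elbow    R → to-right
    where
    shape : ∀ x a → x + a + 1ℤ ≡ x + (1ℤ + a)
    shape = solve-∀
    shape₂ : ∀ y b → y + b ≡ y - 1ℤ + (1ℤ + b)
    shape₂ = solve-∀
    to-right : ∀ {m} → Reach (x , y) (x′ , y′) m → Reach (x , y) (x′ + 1ℤ , y′) (suc m)
    to-right (reach {a} {b} x≡ y≡ m≡) = reach {a = suc a} (trans (cong (_+ 1ℤ) x≡) (shape x (+ a))) y≡ (cong suc m≡)
    to-bottom : ∀ {m} → Reach (x , y) (x′ , y′) m → Reach (x , y) (x′ , y′ - 1ℤ) (suc m)
    to-bottom (reach {a} {b} x≡ y≡ m≡) = reach {b = suc b} x≡ (trans y≡ (shape₂ y′ (+ b))) (trans (ℕ.+-suc a b) (cong suc m≡))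

  reach-refl : ∀ c → Reach c c 0
  reach-refl (x , y) = reach {a = 0} {0} (sym (ℤ.+-identityʳ x)) (sym (ℤ.+-identityʳ y)) refl

  -- Closes the recursions on fuel f, whose invariant is m + f ≡ n for the number m of moves made:
  -- fuel 0 would mean n moves inside the strip.
  too-far : ∀ {a} {A : Set a} {c c′ m} → StripBox c → StripBox c′ → Reach c c′ m → m ℕ.+ 0 ≡ n → A
  too-far {m = m} sb sb′ r eq = contradiction (reach-bound sb sb′ r)
    (ℕ.<⇒≱ (subst (ℕ._< suc (suc m)) (trans (sym (ℕ.+-identityʳ m)) eq) (ℕ.m≤n+m (suc m) 1)))

  -- Back t e bs i: followed backwards in the filling t, the strand through e
  -- traverses the boxes bs and starts at north i.
  data Back (t : Box → Tile) : Edge → List Box → ℤ → Set where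
    done : ∀ {e} → Northern e → Back t e [] (northLabel e)
    via  : ∀ {e bs i} → ¬ Northern e → StripBox (boxBefore e) →
           Back t (entryEdge (t (boxBefore e)) (proj₁ e) (boxBefore e)) bs i → Back t e (boxBefore e ∷ bs) i

  back-det : ∀ {t e bs i bs′ i′} → Back t e bs i → Back t e bs′ i′ → bs ≡ bs′ × i ≡ i′
  back-det (done _)       (done _)        = refl , refl
  back-det (done nth)      (via ¬nth _ _)  = contradiction nth ¬nth
  back-det (via ¬nth _ _) (done nth)       = contradiction nth ¬nth
  back-det (via _ _ b)   (via _ _ b′) with back-det b b′
  ... | refl , refl = refl , refl

  back-step : ∀ {t e c bs i} → boxBefore e ≡ c → StripBox c → Back t (entryEdge (t c) (proj₁ e) c) bs i → Back t e (c ∷ bs) i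
  back-step {e = e} refl sb = via (λ nth → Northern⇒¬StripBox e nth sb) sb

  -- The first box traversed, c₀, bounds the starting label: north i enters it.
  record Origin (t : Box → Tile) (e : Edge) (c′ : Box) (m : ℕ) : Set where
    field
      {boxes′} : List Box
      {i}      : ℤ
      back     : Back t e boxes′ i
      short    : length boxes′ ℕ.≤ m
      {c₀}     : Box
      {m₀}     : ℕ
      strip₀   : StripBox c₀
      reach₀   : Reach c₀ c′ m₀
      above    : proj₁ c₀ + proj₂ c₀ + 1ℤ ≤ i + + k
      below    : i + + k ≤ proj₁ c₀ + proj₂ c₀ + + 2

  origin : ∀ t {c′} → StripBox c′ → ∀ f {m e} → StripBox (boxBefore e) → Reach (boxBefore e) c′ m → m ℕ.+ f ≡ n → Origin t e c′ f
  origin t sb′ zero    sb r eq = too-far sb sb′ r eq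
  origin t {c′} sb′ (suc f) {m} {e} sb r eq = at (entry-inside sb (t c) (proj₁ e))
    where
    c = boxBefore e
    e₁ = entryEdge (t c) (proj₁ e) c
    ¬northern : ¬ Northern e
    ¬northern nth = Northern⇒¬StripBox e nth sb
    shape : ∀ u k → u - k + k ≡ u
    shape = solve-∀
    entry-above : ∀ τ d (c : Box) → proj₁ c + proj₂ c + 1ℤ ≤ southLabel (entryEdge τ d c)
    entry-above crossing U (x , y) = ℤ.≤-refl
    entry-above crossing R (x , y) = ≤-by _ _ (i≤i+1 0ℤ) (shape₂ x y)
      where
      shape₂ : ∀ x y → x + (y + 1ℤ) + 1ℤ + 0ℤ ≡ x + y + 1ℤ + (0ℤ + 1ℤ)
      shape₂ = solve-∀
    entry-above elbow U c = entry-above crossing R c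
    entry-above elbow R c = entry-above crossing U c
    entry-below : ∀ τ d (c : Box) → southLabel (entryEdge τ d c) ≤ proj₁ c + proj₂ c + + 2
    entry-below crossing U (x , y) = ≤-by _ _ (i≤i+1 0ℤ) (shape₂ x y)
      where
      shape₂ : ∀ x y → x + y + + 2 + 0ℤ ≡ x + y + 1ℤ + (0ℤ + 1ℤ)
      shape₂ = solve-∀
    entry-below crossing R (x , y) = ≡⇒≤ (shape₂ x y)
      where
      shape₂ : ∀ x y → x + (y + 1ℤ) + 1ℤ ≡ x + y + + 2
      shape₂ = solve-∀
    entry-below elbow U c = entry-below crossing R c
    entry-below elbow R c = entry-below crossing U c
    at : Northern e₁ ⊎ StripBox (boxBefore e₁) → Origin t e c′ (suc f)
    at (inj₁ nth) = record
      { back   = via ¬northern sb (done nth)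
      ; short  = ℕ.s≤s ℕ.z≤n
      ; strip₀ = sb
      ; reach₀ = r
      ; above  = ℤ.≤-trans (entry-above (t c) (proj₁ e) c) (≡⇒≤ (sym (shape (southLabel e₁) (+ k))))
      ; below  = ℤ.≤-trans (≡⇒≤ (shape (southLabel e₁) (+ k))) (entry-below (t c) (proj₁ e) c)
      }
    at (inj₂ sb₁) = record
      { back   = via ¬northern sb (Origin.back O)
      ; short  = ℕ.s≤s (Origin.short O)
      ; strip₀ = Origin.strip₀ O
      ; reach₀ = Origin.reach₀ O
      ; above  = Origin.above O
      ; below  = Origin.below O
      }
      where
      O : Origin t e₁ c′ f
      O = origin t sb′ f sb₁ (reach-entry (t c) (proj₁ e) r) (trans (sym (ℕ.+-suc m f)) eq)

  abstract
    back-exists : ∀ t e → Northern e ⊎ StripBox (boxBefore e) → ∃ λ bs → ∃ λ i → Back t e bs i × length bs ℕ.≤ n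
    back-exists t e (inj₁ nth) = [] , northLabel e , done nth , ℕ.z≤n
    back-exists t e (inj₂ sb) = _ , _ , Origin.back O , Origin.short O
      where
      O : Origin t e (boxBefore e) n
      O = origin t sb n sb (reach-refl (boxBefore e)) refl

  -- `above` and `below` tie i + k to the first box c₀, and j is tied to the last box c in the same
  -- way, where c₀ lies weakly above and to the left of c. The lower bound is then due to
  -- `drop-bound`, the upper one to `advance-bound`.
  back-bounds : ∀ {t j bs i} → Back t (south j) bs i → i ≤ j × j ≤ i + + n
  back-bounds {t} {j} b = at (south-inside j) b
    where
    at : ∀ {bs i} → Northern (south j) ⊎ StripBox (boxBefore (south j)) → Back t (south j) bs i → i ≤ j × j ≤ i + + n
    at (inj₁ nth) b with back-det b (done nth)
    ... | _ , refl = ≤-by _ _ (ℤ.i≤i+j 0ℤ (+ k) ⊕ ≡⇒≤ (sym j≡)) (shape₂ j i (+ k)) , ≤-by _ _ (ℤ.i≤i+j 0ℤ (+ seen R n) ⊕ ≡⇒≤ j≡ ⊕ ≡⇒≤ (cong +_ seen-R)) (shape₃ j i (+ k) (+ seen R n) (+ n))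
      where
      i = northLabel (south j)
      shape : ∀ u k → u ≡ u - k + k
      shape = solve-∀
      j≡ : j ≡ i + + k
      j≡ = trans (sym (southLabel-south j)) (shape (southLabel (south j)) (+ k))
      shape₂ : ∀ j i k → j + (0ℤ + (i + k)) ≡ i + (0ℤ + k + j)
      shape₂ = solve-∀
      shape₃ : ∀ j i k r n → i + n + (0ℤ + j + (r + k)) ≡ j + (0ℤ + r + (i + k) + n)
      shape₃ = solve-∀
    at (inj₂ sb) b with back-det b (Origin.back O)
      where O = origin t sb n sb (reach-refl (boxBefore (south j))) refl
    ... | _ , refl = lower , upper
      where
      O = origin t sb n sb (reach-refl (boxBefore (south j))) refl
      open Origin O
      c = boxBefore (south j)
      x = proj₁ c
      y = proj₂ c
      x₀ = proj₁ c₀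
      y₀ = proj₂ c₀
      exit-label : ∀ e → proj₁ (boxBefore e) + proj₂ (boxBefore e) + 1ℤ ≤ southLabel e × southLabel e ≤ proj₁ (boxBefore e) + proj₂ (boxBefore e) + + 2
      exit-label (U , (x , y)) = ≤-by _ _ (i≤i+1 0ℤ) (shape₁ x y) , ≡⇒≤ (shape₂ x y)
        where
        shape₁ : ∀ x y → x + y + 1ℤ + 0ℤ ≡ x - 1ℤ + y + 1ℤ + (0ℤ + 1ℤ)
        shape₁ = solve-∀
        shape₂ : ∀ x y → x + y + 1ℤ ≡ x - 1ℤ + y + + 2
        shape₂ = solve-∀
      exit-label (R , (x , y)) = ℤ.≤-refl , ≤-by _ _ (i≤i+1 0ℤ) (shape₁ x y)
        where
        shape₁ : ∀ x y → x + y + + 2 + 0ℤ ≡ x + y + 1ℤ + (0ℤ + 1ℤ)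
        shape₁ = solve-∀
      j-lo : x + y + 1ℤ ≤ j
      j-lo = ℤ.≤-trans (proj₁ (exit-label (south j))) (≡⇒≤ (southLabel-south j))
      j-hi : j ≤ x + y + + 2
      j-hi = ℤ.≤-trans (≡⇒≤ (sym (southLabel-south j))) (proj₂ (exit-label (south j)))
      x₀≤x : x₀ ≤ x
      x₀≤x = ℤ.≤-trans (ℤ.i≤i+j x₀ (+ Reach.a reach₀)) (≡⇒≤ (sym (Reach.x≡ reach₀)))
      y≤y₀ : y ≤ y₀
      y≤y₀ = ℤ.≤-trans (ℤ.i≤i+j y (+ Reach.b reach₀)) (≡⇒≤ (sym (Reach.y≡ reach₀)))
      lower : i ≤ j
      lower = ≤-by _ _ (below ⊕ j-lo ⊕ x₀≤x ⊕ drop-bound strip₀ sb x₀≤x) (shape i j x y x₀ y₀ (+ k))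
        where
        shape : ∀ i j x y x₀ y₀ k → j + (i + k + (x + y + 1ℤ) + x₀ + (y₀ + 1ℤ)) ≡ i + (x₀ + y₀ + + 2 + j + x + (y + k))
        shape = solve-∀
      upper : j ≤ i + + n
      upper = ≤-by _ _ (above ⊕ j-hi ⊕ y≤y₀ ⊕ advance-bound strip₀ sb y≤y₀) (shape i j x y x₀ y₀ (+ n) (+ k))
        where
        shape : ∀ i j x y x₀ y₀ n k → i + n + (x₀ + y₀ + 1ℤ + j + y + (x + 1ℤ)) ≡ j + (i + k + (x + y + + 2) + y₀ + (x₀ + (n - k)))
        shape = solve-∀

  trace-back : ∀ A m {e bs i} → Back (tile A) e bs i → length bs ℕ.≤ m → trace A m e ≡ bs
  trace-back A zero    (done _) _ = refl
  trace-back A (suc m) (done {e} nth) _ with northern? e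
  ... | yes _  = refl
  ... | no ¬nth = contradiction nth ¬nth
  trace-back A (suc m) (via {e} ¬nth _ b) (ℕ.s≤s le) with northern? e
  ... | yes nth = contradiction nth ¬nth
  ... | no  _  = cong (boxBefore e ∷_) (trace-back A m b le)

  next-entry : ∀ A {e} → StripBox (boxBefore e) → next A (entryEdge (tile A (boxBefore e)) (proj₁ e) (boxBefore e)) ≡ e
  next-entry A {e} sb = at (entryEdge t (proj₁ e) c) (boxAfter-entryEdge t (proj₁ e) c) (exitEdge-entryEdge t e)
    where
    c = boxBefore e
    t = tile A c
    at : ∀ e₁ → boxAfter e₁ ≡ c → exitEdge t (proj₁ e₁) c ≡ e → next A e₁ ≡ e
    at e₁ after exit with southern? e₁
    ... | yes so = contradiction (subst StripBox (sym after) sb) (Southern⇒¬StripBox e₁ so)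
    ... | no  _  = trans (cong (λ b → exitEdge (tile A b) (proj₁ e₁) b) after) exit

  advance-back : ∀ A {e bs i} m → Back (tile A) e bs i → advance A (length bs ℕ.+ m) (north i) ≡ advance A m e
  advance-back A m (done nth)       = cong (advance A m) (sym nth)
  advance-back A m (via {e} {bs} {i} _ sb b) = trans (cong (λ l → advance A l (north i)) (sym (ℕ.+-suc (length bs) m)))
    (trans (advance-back A (suc m) b) (cong (advance A m) (next-entry A sb)))

  advance-south : ∀ A m j → advance A m (south j) ≡ south j
  advance-south A zero    j = refl
  advance-south A (suc m) j = trans (cong (advance A m) (stays (south j) (Southern-south j))) (advance-south A m j)
    where
    stays : ∀ e → Southern e → next A e ≡ e
    stays e so with southern? e
    ... | yes _  = refl
    ... | no ¬so = contradiction so ¬so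

  -- Replayed forwards, the traced strand reaches south j after length bs moves; the rest of the n
  -- moves in `strand` are spent standing still there.
  strand-back : ∀ A {j bs i} → Back (tile A) (south j) bs i → length bs ℕ.≤ n → strand A i ≡ j
  strand-back A {j} {bs} {i} b le = begin
    southLabel (advance A n (north i))                              ≡⟨ cong (λ m → southLabel (advance A m (north i))) (ℕ.m+[n∸m]≡n le) ⟨
    southLabel (advance A (length bs ℕ.+ (n ℕ.∸ length bs)) (north i)) ≡⟨ cong southLabel (advance-back A (n ℕ.∸ length bs) b) ⟩
    southLabel (advance A (n ℕ.∸ length bs) (south j))              ≡⟨ cong southLabel (advance-south A (n ℕ.∸ length bs) j) ⟩
    southLabel (south j)                                            ≡⟨ southLabel-south j ⟩
    j                                                               ∎
    where open ≡-Reasoning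

  back-rank : ∀ {t e bs i r} → (StripBox (boxBefore e) → r < rank (boxBefore e)) → Back t e bs i → All (λ b → r < rank b) bs
  back-rank lt (done _) = []
  back-rank {t} {e} lt (via _ sb b) = lt sb ∷ back-rank (λ _ → ℤ.<-trans (lt sb) (rank-entry sb (t (boxBefore e)) (proj₁ e))) b

  back-cong : ∀ {t t′ e bs i} → All (λ b → t b ≡ t′ b) bs → Back t e bs i → Back t′ e bs i
  back-cong []        (done nth)        = done nth
  back-cong {t} {t′} {e} {i = i} (eq ∷ eqs) (via {bs = bs} ¬nth sb b) = via ¬nth sb (subst (λ τ → Back t′ (entryEdge τ (proj₁ e) (boxBefore e)) bs i) eq (back-cong eqs b))

  back-strips : ∀ {t e bs i} → Back t e bs i → All StripBox bs
  back-strips (done _)      = []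
  back-strips (via _ sb b) = sb ∷ back-strips b

  record Descent (t : Box → Tile) (e : Edge) (bs : List Box) (i r : ℤ) : Set where
    field
      {elbows} : List Box
      back     : Back t (south (southLabel e)) (elbows ++ bs) i
      strips   : All StripBox elbows
      ranks    : All (λ b → rank b < r) elbows

  -- Since all boxes of lower rank are elbows, the strand runs down its antidiagonal to the southern
  -- edge with its own label. The boxes passed are put in front of the known past.
  descent : ∀ t r → (∀ {c} → StripBox c → rank c < r → t c ≡ elbow) →
            ∀ {e bs i} → Southern e ⊎ StripBox (boxAfter e) → rank (boxAfter e) < r → Back t e bs i → Descent t e bs i r
  descent t r flat {e} {bs} {i} inside lt b = start-from e inside lt b
    where
    fall : ∀ {c′} → StripBox c′ → ∀ f {m e bs} → StripBox (boxAfter e) → rank (boxAfter e) < r → Reach c′ (boxAfter e) m → m ℕ.+ f ≡ n →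
           Back t e bs i → Descent t e bs i r
    fall sb′ zero    sb lt rc eq b = too-far sb′ sb rc eq
    fall sb′ (suc f) {m} {e} {bs} sb lt rc eq b = at (exit-inside sb elbow (proj₁ e))
      where
      c = boxAfter e
      e₁ = exitEdge elbow (proj₁ e) c
      label≡ : southLabel e₁ ≡ southLabel e
      label≡ = same e
        where
        shape : ∀ x y → x + 1ℤ + (y - 1ℤ) + 1ℤ ≡ x + y + 1ℤ
        shape = solve-∀
        same : ∀ e → southLabel (exitEdge elbow (proj₁ e) (boxAfter e)) ≡ southLabel e
        same (U , p)       = refl
        same (R , (x , y)) = shape x y
      b₁ : Back t e₁ (c ∷ bs) i
      b₁ = back-step (boxBefore-exitEdge elbow (proj₁ e) c) sb
        (subst (λ e₂ → Back t e₂ bs i) (sym (trans (cong (λ τ → entryEdge τ (proj₁ e₁) c) (flat sb lt)) (entryEdge-exitEdge elbow e))) b)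
      at : Southern e₁ ⊎ StripBox (boxAfter e₁) → Descent t e bs i r
      at (inj₁ so) = record
        { elbows = c ∷ []
        ; back   = subst (λ e₂ → Back t e₂ (c ∷ bs) i) (trans so (cong south label≡)) b₁
        ; strips = sb ∷ []
        ; ranks  = lt ∷ []
        }
      at (inj₂ sb₁) = record
        { elbows = Descent.elbows D ++ c ∷ []
        ; back   = subst₂ (λ j cs → Back t (south j) cs i) label≡ (sym (List.++-assoc (Descent.elbows D) (c ∷ []) bs)) (Descent.back D)
        ; strips = All.++⁺ (Descent.strips D) (sb ∷ [])
        ; ranks  = All.++⁺ (Descent.ranks D) (lt ∷ [])
        }
        where
        D : Descent t e₁ (c ∷ bs) i r
        D = fall sb′ f sb₁ (ℤ.<-trans (rank-exit sb elbow (proj₁ e)) lt) (reach-exit elbow (proj₁ e) rc) (trans (sym (ℕ.+-suc m f)) eq) b₁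
    start-from : ∀ e {bs} → Southern e ⊎ StripBox (boxAfter e) → rank (boxAfter e) < r → Back t e bs i → Descent t e bs i r
    start-from e {bs} (inj₁ so) lt b = record { elbows = [] ; back = subst (λ e₂ → Back t e₂ bs i) so b ; strips = [] ; ranks = [] }
    start-from e      (inj₂ sb) lt b = fall sb n sb lt (reach-refl (boxAfter e)) refl b

  -- A converse to `descent`: once past c, the strand keeps the label of the bottom or of the right
  -- edge of c. Hence strands that end elsewhere avoid c.
  arrival : ∀ {t r e bs i} → (∀ {c} → StripBox c → rank c < r → t c ≡ elbow) → Back t e bs i →
            ∀ {c} → c ∈ bs → rank c ≡ r → southLabel e ≡ proj₁ c + proj₂ c + 1ℤ ⊎ southLabel e ≡ proj₁ c + proj₂ c + 1ℤ + 1ℤ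
  arrival {e = e} flat (via _ _ _) (here refl) _ = exit e
    where
    shape : ∀ x y → x + y + 1ℤ ≡ x - 1ℤ + y + 1ℤ + 1ℤ
    shape = solve-∀
    exit : ∀ e → southLabel e ≡ proj₁ (boxBefore e) + proj₂ (boxBefore e) + 1ℤ ⊎ southLabel e ≡ proj₁ (boxBefore e) + proj₂ (boxBefore e) + 1ℤ + 1ℤ
    exit (U , (x , y)) = inj₂ (shape x y)
    exit (R , (x , y)) = inj₁ refl
  arrival {t} {e = e} flat (via _ sb b) {c} (there c∈) refl = subst (λ j → j ≡ _ ⊎ j ≡ _) label≡ (arrival flat b c∈ refl)
    where
    low : rank (boxBefore e) < rank c
    low = All.lookup (back-rank (λ _ → rank-entry sb (t (boxBefore e)) (proj₁ e)) b) c∈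
    label≡ : southLabel (entryEdge (t (boxBefore e)) (proj₁ e) (boxBefore e)) ≡ southLabel e
    label≡ = trans (cong (λ τ → southLabel (entryEdge τ (proj₁ e) (boxBefore e))) (flat sb low))
      (trans (southLabel-elbow (proj₁ e) (boxBefore e)) (cong southLabel (exitEdge-entryEdge elbow e)))

-- Common crossings, and the last crossing made an elbow

length-filter-cong : ∀ {a p q} {A : Set a} {Q : A → Set p} {Q′ : A → Set q} (Q? : ∀ x → Dec (Q x)) (Q′? : ∀ x → Dec (Q′ x)) {xs} →
  All (λ x → (Q x → Q′ x) × (Q′ x → Q x)) xs → length (filter Q? xs) ≡ length (filter Q′? xs)
length-filter-cong Q? Q′? []                   = refl
length-filter-cong Q? Q′? {x ∷ xs} ((to , from) ∷ eqs) with Q? x | Q′? x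
... | yes _ | yes _  = cong suc (length-filter-cong Q? Q′? eqs)
... | no _  | no _   = length-filter-cong Q? Q′? eqs
... | yes q | no ¬q′ = contradiction (to q) ¬q′
... | no ¬q | yes q′ = contradiction (from q′) ¬q

odd : ℕ → Bool
odd zero    = false
odd (suc m) = not (odd m)

odd-val-+ : ∀ t m → odd (val t ℕ.+ m) ≡ t xor odd m
odd-val-+ true  m = refl
odd-val-+ false m = refl

count-∑ : ∀ t {N} (A : Vec Tile N) → count (_≟ᵗ t) A ≡ ∑ℕ.sum (λ p → val (does (lookup A p ≟ᵗ t)))
count-∑ t []      = refl
count-∑ t (s ∷ A) with does (s ≟ᵗ t)
... | true  = cong suc (count-∑ t A)
... | false = count-∑ t A

-- Last means of least rank. Other crossings may have the same rank, since boxes of equal rank need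
-- not be translates, but none has a lower one.
lastCrossing : ∀ {N} (r : Fin N → ℤ) (A : Vec Tile N) → (∀ p → lookup A p ≡ elbow) ⊎
  ∃ λ p → lookup A p ≡ crossing × (∀ p′ → r p′ < r p → lookup A p′ ≡ elbow)
lastCrossing r [] = inj₁ λ ()
lastCrossing r (t ∷ A) with lastCrossing (r ∘ suc) A
lastCrossing r (elbow    ∷ A) | inj₁ none = inj₁ λ { zero → refl ; (suc p) → none p }
lastCrossing r (crossing ∷ A) | inj₁ none = inj₂ (zero , refl , λ { zero lt → contradiction lt (ℤ.<-irrefl refl) ; (suc p) _ → none p })
lastCrossing r (elbow    ∷ A) | inj₂ (p , cr , last) = inj₂ (suc p , cr , λ { zero _ → refl ; (suc p′) → last p′ })
lastCrossing r (crossing ∷ A) | inj₂ (p , cr , last) with r zero ℤ.<? r (suc p)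
... | yes lt = inj₂ (zero , refl , λ { zero lt′ → contradiction lt′ (ℤ.<-irrefl refl) ; (suc p′) lt′ → last p′ (ℤ.<-trans lt′ lt) })
... | no ¬lt = inj₂ (suc p , cr , λ { zero lt → contradiction lt ¬lt ; (suc p′) → last p′ })

-- Compares a past before a flip with the past of the exchanged end label after it, both listed from
-- the southern end: below the flipped box each meets only elbows, above it they coincide.
record Rerouted (Low Hit : Box → Set) (hs ts xs xs′ : List Box) (i i′ : ℤ) : Set where
  field
    {elbows elbows′} : List Box
    past≡   : xs ≡ elbows ++ hs ++ ts
    past′≡  : xs′ ≡ elbows′ ++ hs ++ ts
    source≡ : i ≡ i′
    lows    : All Low elbows
    lows′   : All Low elbows′
    missed  : All (λ b → ¬ Hit b) ts

module Strands {n k : ℕ} .{{_ : NonZero n}} (P : LatticePath n k) where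

  open Strip P
  open PathGeometry P
  open StripGeometry P
  open BoxGeometry P
  open Backtracking P

  box : Fin (length boxes) → Box
  box = List.lookup boxes

  box-strip : ∀ p → StripBox (box p)
  box-strip p = listed⇒strip {p} (0ℤ , sym (shift-0 (box p)))
    where
    shift-0 : ∀ c → shift 0ℤ c ≡ c
    shift-0 (x , y) = cong₂ _,_ (ℤ.+-identityʳ x) (ℤ.+-identityʳ y)

  module _ (A : Filling) where

    abstract
      run : ∀ j → ∃ λ bs → ∃ λ i → Back (tile A) (south j) bs i × length bs ℕ.≤ n
      run j = back-exists (tile A) (south j) (south-inside j)

    past : ℤ → List Box
    past j = proj₁ (run j)

    source : ℤ → ℤ
    source j = proj₁ (proj₂ (run j))

    past-back : ∀ j → Back (tile A) (south j) (past j) (source j)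
    past-back j = proj₁ (proj₂ (proj₂ (run j)))

    past-unique : ∀ j {bs i} → Back (tile A) (south j) bs i → past j ≡ bs × source j ≡ i
    past-unique j b = back-det (past-back j) b

    strand-source : ∀ j → strand A (source j) ≡ j
    strand-source j = strand-back A (past-back j) (proj₂ (proj₂ (proj₂ (run j))))

    shared? : ∀ ys b → Dec (tile A b ≡ crossing × b ∈ ys)
    shared? ys b = (tile A b ≟ᵗ crossing) ×-dec _∈?_ _≟ᵖ_ b ys

    -- The count in `priorCrossings`, with arbitrary lists in place of the two histories, so that it
    -- also applies to the full pasts of two strands.
    common : List Box → List Box → ℕ
    common xs ys = length (filter (shared? ys) xs)

    common-++ : ∀ xs xs′ ys → common (xs ++ xs′) ys ≡ common xs ys ℕ.+ common xs′ ys
    common-++ xs xs′ ys = trans (cong length (List.filter-++ (shared? ys) xs xs′)) (List.length-++ (filter (shared? ys) xs))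

    common-elbows : ∀ {xs} ys → All (λ b → tile A b ≡ elbow) xs → common xs ys ≡ 0
    common-elbows ys flat = cong length (List.filter-none (shared? ys) (All.map (λ { eq (cr , _) → case-tile eq cr }) flat))
      where
      case-tile : ∀ {t} → t ≡ elbow → t ≢ crossing
      case-tile refl ()

    prior : Fin (length boxes) → ℕ
    prior p = priorCrossings A (box p)

  record Above (A : Filling) (e : Edge) (r : ℤ) : Set where
    field
      {boxes′} : List Box
      {i}      : ℤ
      back     : Back (tile A) e boxes′ i
      short    : length boxes′ ℕ.≤ n
      ranks    : All (λ b → r < rank b) boxes′

  above : ∀ A {c} → StripBox c → ∀ t d → Above A (entryEdge t d c) (rank c)
  above A {c} sb t d = record
    { back  = proj₁ (proj₂ (proj₂ E))
    ; short = proj₂ (proj₂ (proj₂ E))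
    ; ranks = back-rank (λ _ → rank-entry sb t d) (proj₁ (proj₂ (proj₂ E)))
    }
    where
    E : ∃ λ bs → ∃ λ i → Back (tile A) (entryEdge t d c) bs i × length bs ℕ.≤ n
    E = back-exists (tile A) (entryEdge t d c) (entry-inside sb t d)

  -- Asking for agreement on a whole rank avoids naming the representative of c in `boxes`, which
  -- has the same rank as c.
  tile-agree : ∀ {A B c} → StripBox c → (∀ p → rank (box p) ≡ rank c → lookup A p ≡ lookup B p) → tile A c ≡ tile B c
  tile-agree {A} {B} {c} sb agree = at (strip⇒listed sb)
    where
    at : (∃ λ p → Translate (box p) c) → tile A c ≡ tile B c
    at (p , m , eq) = trans (tile-class A (m , eq)) (trans (agree p (trans (sym (rank-shift m (box p))) (cong rank (sym eq)))) (sym (tile-class B (m , eq))))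

  common-cong : ∀ A B {xs} ys → All (λ b → tile A b ≡ tile B b) xs → common A xs ys ≡ common B xs ys
  common-cong A B ys eqs = length-filter-cong (shared? A ys) (shared? B ys)
    (All.map (λ eq → (λ (cr , m) → trans (sym eq) cr , m) , (λ (cr , m) → trans eq cr , m)) eqs)

  -- Both histories of a box run through boxes of higher rank only, so agreement there gives the
  -- same lists with the same tiles on them. This is the triangularity behind the final summation.
  prior-local : ∀ A B p → (∀ p′ → rank (box p) < rank (box p′) → lookup A p′ ≡ lookup B p′) → prior A p ≡ prior B p
  prior-local A B p agree = begin
    common A (trace A n (left c)) (trace A n (top c)) ≡⟨ cong₂ (common A) (trace-back A n (back L) (short L)) (trace-back A n (back T) (short T)) ⟩
    common A (boxes′ L) (boxes′ T)                    ≡⟨ common-cong A B (boxes′ T) (same L) ⟩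
    common B (boxes′ L) (boxes′ T)                    ≡⟨ cong₂ (common B) (trace-back B n (back-cong (same L) (back L)) (short L)) (trace-back B n (back-cong (same T) (back T)) (short T)) ⟨
    common B (trace B n (left c)) (trace B n (top c)) ∎
    where
    open ≡-Reasoning
    open Above
    c = box p
    L = above A (box-strip p) crossing U
    T = above A (box-strip p) crossing R
    same : ∀ {e} (E : Above A e (rank c)) → All (λ b → tile A b ≡ tile B b) (boxes′ E)
    same E = All.map (λ (sb , lt) → tile-agree sb λ p′ eq → agree p′ (subst (rank c <_) (sym eq) lt)) (All.zip (back-strips (back E) , ranks E))

  module Flip (A : Filling) (p : Fin (length boxes)) (cr : lookup A p ≡ crossing)
              (last : ∀ p′ → rank (box p′) < rank (box p) → lookup A p′ ≡ elbow) where

    A′ : Filling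
    A′ = A [ p ]≔ elbow

    -- The label shared by the left and the bottom edge of the box; the right edge has the next one.
    -- By `descent`, the strands leaving the translates of the box end at position and position + 1
    -- modulo n.
    position : ℤ
    position = southLabel (left (box p))

    2≤n : 2 ℕ.≤ n
    2≤n = reach-bound (box-strip p) (box-strip p) (reach-refl (box p))

    open Transposition n 2≤n position public

    Hit : Box → Set
    Hit c = Translate (box p) c

    abstract

      r : ℤ
      r = rank (box p)

      r≡ : r ≡ rank (box p)
      r≡ = refl

      hit : ℤ → Box
      hit m = shift m (box p)

      hit≡ : ∀ m → hit m ≡ shift m (box p)
      hit≡ m = refl

      hit-Hit : ∀ m → Hit (hit m)
      hit-Hit m = m , refl

      hit-strip : ∀ m → StripBox (hit m)
      hit-strip m = listed⇒strip (hit-Hit m)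

      Hit-rank : ∀ {c} → Hit c → rank c ≡ r
      Hit-rank (m , refl) = rank-shift m (box p)

      hit-position : ∀ m → southLabel (bottom (hit m)) ≡ at m
      hit-position m = shape (proj₁ (box p)) (proj₂ (box p)) m (+ n) (+ k)
        where
        shape : ∀ x y m n k → x + m * (n - k) + (y + m * k) + 1ℤ ≡ x + y + 1ℤ + m * n
        shape = solve-∀

      hit-position+1 : ∀ m → southLabel (right (hit m)) ≡ at m + 1ℤ
      hit-position+1 m = shape (proj₁ (box p)) (proj₂ (box p)) m (+ n) (+ k)
        where
        shape : ∀ x y m n k → x + m * (n - k) + 1ℤ + (y + m * k) + 1ℤ ≡ x + y + 1ℤ + m * n + 1ℤ
        shape = solve-∀

    hit-rank : ∀ m → rank (hit m) ≡ r
    hit-rank m = Hit-rank (hit-Hit m)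

    Hit-crossing : ∀ {c} → Hit c → tile A c ≡ crossing
    Hit-crossing h = trans (tile-class A h) cr

    Hit-elbow : ∀ {c} → Hit c → tile A′ c ≡ elbow
    Hit-elbow h = trans (tile-class A′ h) (Vec.lookup∘update p A elbow)

    other : ∀ {p′} → p′ ≢ p → lookup A′ p′ ≡ lookup A p′
    other p′≢p = Vec.lookup∘update′ p′≢p A elbow

    miss : ∀ {c} → ¬ Hit c → tile A c ≡ tile A′ c
    miss {c} ¬h with Fin.any? (λ p → translate? (List.lookup boxes p) c)
    ... | yes (p′ , tr) = sym (other λ { refl → ¬h tr })
    ... | no  _         = refl

    flat : ∀ {c} → StripBox c → rank c < r → tile A c ≡ elbow
    flat {c} sb lt = listed (strip⇒listed sb)
      where
      listed : (∃ λ p′ → Translate (box p′) c) → tile A c ≡ elbow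
      listed (p′ , m , eq) = trans (tile-class A (m , eq)) (last p′ (subst₂ _<_ (trans (cong rank eq) (rank-shift m (box p′))) r≡ lt))

    low-miss : ∀ {c} → rank c < r → ¬ Hit c
    low-miss lt h = ℤ.<⇒≢ lt (Hit-rank h)

    high-miss : ∀ {c} → r < rank c → ¬ Hit c
    high-miss lt h = ℤ.<⇒≢ lt (sym (Hit-rank h))

    flat′ : ∀ {c} → StripBox c → rank c < r → tile A′ c ≡ elbow
    flat′ sb lt = trans (sym (miss (low-miss lt))) (flat sb lt)

    entering : ∀ m d → Above A′ (entryEdge crossing d (hit m)) (rank (hit m))
    entering m d = above A′ (hit-strip m) crossing d

    tail : ℤ → Step → List Box
    tail m d = Above.boxes′ (entering m d)

    tail-miss : ∀ m d → All (λ b → ¬ Hit b) (tail m d)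
    tail-miss m d = All.map (λ {b} lt → high-miss (subst (λ u → u < rank b) (hit-rank m) lt)) (Above.ranks (entering m d))

    enters : ∀ m d → Back (tile A) (entryEdge crossing d (hit m)) (tail m d) (Above.i (entering m d))
    enters m d = back-cong (All.map (sym ∘ miss) (tail-miss m d)) (Above.back (entering m d))

    hits : ∀ {j} → View j → List Box
    hits (low m _)  = hit m ∷ []
    hits (high m _) = hit m ∷ []
    hits (off _ _)  = []

    -- In A the strand ending at `at m` leaves `hit m` through the bottom, so it entered the
    -- crossing from the top, in direction R. After the flip the strand from the top ends at the
    -- partner `at m + 1ℤ`.
    tails : ∀ {j} → View j → List Box
    tails     (low m _)  = tail m R
    tails     (high m _) = tail m U
    tails {j} (off _ _)  = past A′ j

    Low : Box → Set
    Low b = StripBox b × rank b < r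

    -- Below the box hit m, both strands through it meet only elbows, so they end
    -- at the positions at m and at m + 1; making the crossing an elbow exchanges
    -- the two pasts.
    Flipped : ∀ {j} → View j → Set
    Flipped {j} v = Rerouted Low Hit (hits v) (tails v) (past A j) (past A′ (partner v)) (source A j) (source A′ (partner v))

    private
      down : ∀ {t d e m bs i} → (∀ {c} → StripBox c → rank c < r → t c ≡ elbow) → e ≡ exitEdge crossing d (hit m) →
             Back t e bs i → Descent t e bs i r
      down {t} {d} {e} {m} flat refl b = descent t r flat (exit-inside (hit-strip m) crossing d)
        (subst (λ u → rank (boxAfter e) < u) (hit-rank m) (rank-exit (hit-strip m) crossing d)) b

      -- Here d is the direction kept through the crossing, and d′ the one in which the same
      -- incoming strand leaves after the flip.
      assemble : ∀ {j} (v : View j) m d d′ → hits v ≡ hit m ∷ [] → tails v ≡ tail m d →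
                 entryEdge elbow d′ (hit m) ≡ entryEdge crossing d (hit m) →
                 southLabel (exitEdge crossing d (hit m)) ≡ j →
                 southLabel (exitEdge crossing d′ (hit m)) ≡ partner v → proj₁ (exitEdge crossing d (hit m)) ≡ d → proj₁ (exitEdge crossing d′ (hit m)) ≡ d′ → Flipped v
      assemble {j} v m d d′ hits≡ tails≡ entry≡ j≡ j′≡ dir dir′ = record
        { past≡   = trans (proj₁ u) (cong₂ (λ hs ts → Descent.elbows D ++ hs ++ ts) (sym hits≡) (sym tails≡))
        ; past′≡  = trans (proj₁ u′) (cong₂ (λ hs ts → Descent.elbows D′ ++ hs ++ ts) (sym hits≡) (sym tails≡))
        ; source≡ = trans (proj₂ u) (sym (proj₂ u′))
        ; lows    = All.zip (Descent.strips D , Descent.ranks D)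
        ; lows′   = All.zip (Descent.strips D′ , Descent.ranks D′)
        ; missed  = subst (All (λ b → ¬ Hit b)) (sym tails≡) (tail-miss m d)
        }
        where
        c = hit m
        i = Above.i (entering m d)
        e = exitEdge crossing d c
        e′ = exitEdge crossing d′ c
        b : Back (tile A) e (c ∷ tail m d) i
        b = back-step (boxBefore-exitEdge crossing d c) (hit-strip m)
          (subst₂ (λ τ δ → Back (tile A) (entryEdge τ δ c) (tail m d) i) (sym (Hit-crossing (hit-Hit m))) (sym dir) (enters m d))
        b′ : Back (tile A′) e′ (c ∷ tail m d) i
        b′ = back-step (boxBefore-exitEdge crossing d′ c) (hit-strip m)
          (subst₂ (λ τ δ → Back (tile A′) (entryEdge τ δ c) (tail m d) i) (sym (Hit-elbow (hit-Hit m))) (sym dir′)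
            (subst (λ e₁ → Back (tile A′) e₁ (tail m d) i) (sym entry≡) (Above.back (entering m d))))
        D : Descent (tile A) e (c ∷ tail m d) i r
        D = down flat refl b
        D′ : Descent (tile A′) e′ (c ∷ tail m d) i r
        D′ = down flat′ refl b′
        u : past A j ≡ Descent.elbows D ++ c ∷ tail m d × source A j ≡ i
        u = past-unique A j (subst (λ j → Back (tile A) (south j) (Descent.elbows D ++ c ∷ tail m d) i) j≡ (Descent.back D))
        u′ : past A′ (partner v) ≡ Descent.elbows D′ ++ c ∷ tail m d × source A′ (partner v) ≡ i
        u′ = past-unique A′ (partner v) (subst (λ j → Back (tile A′) (south j) (Descent.elbows D′ ++ c ∷ tail m d) i) j′≡ (Descent.back D′))

    flipped : ∀ {j} (v : View j) → Flipped v
    flipped v@(low m refl)  = assemble v m R U refl refl refl (hit-position m) (hit-position+1 m) refl refl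
    flipped v@(high m refl) = assemble v m U R refl refl refl (hit-position+1 m) (hit-position m) refl refl
    flipped {j} v@(off ≢at ≢at+1) = record
      { elbows  = []
      ; elbows′ = []
      ; past≡   = proj₁ u
      ; past′≡  = refl
      ; source≡ = proj₂ u
      ; lows    = []
      ; lows′   = []
      ; missed  = missed
      }
      where
      -- By `arrival`, a past through a translate of the box would end at some `at m` or
      -- `at m + 1ℤ`, against the view `off`.
      no-hit : ∀ {c} → c ∈ past A′ j → ¬ Hit c
      no-hit {c} c∈ (m , c≡) = exclude (arrival {e = south j} flat′ (past-back A′ j) c∈ (Hit-rank (m , c≡)))
        where
        place≡ : proj₁ c + proj₂ c + 1ℤ ≡ at m
        place≡ = trans (cong (λ b → proj₁ b + proj₂ b + 1ℤ) (trans c≡ (sym (hit≡ m)))) (hit-position m)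
        exclude : southLabel (south j) ≡ proj₁ c + proj₂ c + 1ℤ ⊎ southLabel (south j) ≡ proj₁ c + proj₂ c + 1ℤ + 1ℤ → ⊥
        exclude (inj₁ eq) = ≢at m (trans (sym (southLabel-south j)) (trans eq place≡))
        exclude (inj₂ eq) = ≢at+1 m (trans (sym (southLabel-south j)) (trans eq (cong (_+ 1ℤ) place≡)))
      missed : All (λ b → ¬ Hit b) (past A′ j)
      missed = All.tabulate no-hit
      u : past A j ≡ past A′ j × source A j ≡ source A′ j
      u = past-unique A j (back-cong (All.map (sym ∘ miss) missed) (past-back A′ j))

    source-swap : ∀ j → source A j ≡ source A′ (swap j)
    source-swap j = Rerouted.source≡ (flipped (view j))

    -- Elbows are never counted, and a crossing in ts can recur only in ts′, since ys consists of
    -- elbows and hs′ of translates of the flipped box, which ts avoids.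
    common-split : ∀ B → (∀ {b} → Low b → tile B b ≡ elbow) → ∀ {xs ys hs hs′ ts ts′} → All Low xs → All Low ys →
                   All Hit hs′ → All (λ b → ¬ Hit b) ts →
                   common B (xs ++ hs ++ ts) (ys ++ hs′ ++ ts′) ≡ common B hs (ys ++ hs′ ++ ts′) ℕ.+ common B ts ts′
    common-split B flatB {xs} {ys} {hs} {hs′} {ts} {ts′} xs-low ys-low hits missed = begin
      common B (xs ++ hs ++ ts) zs                        ≡⟨ common-++ B xs (hs ++ ts) zs ⟩
      common B xs zs ℕ.+ common B (hs ++ ts) zs           ≡⟨ cong (ℕ._+ common B (hs ++ ts) zs) (common-elbows B zs (All.map flatB xs-low)) ⟩
      common B (hs ++ ts) zs                              ≡⟨ common-++ B hs ts zs ⟩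
      common B hs zs ℕ.+ common B ts zs                   ≡⟨ cong (common B hs zs ℕ.+_) (length-filter-cong (shared? B zs) (shared? B ts′) (All.map restrict missed)) ⟩
      common B hs zs ℕ.+ common B ts ts′                  ∎
      where
      open ≡-Reasoning
      zs = ys ++ hs′ ++ ts′
      restrict : ∀ {b} → ¬ Hit b → (tile B b ≡ crossing × b ∈ zs → tile B b ≡ crossing × b ∈ ts′) × (tile B b ≡ crossing × b ∈ ts′ → tile B b ≡ crossing × b ∈ zs)
      restrict {b} ¬h = (λ (crB , b∈) → crB , part crB b∈) , (λ (crB , b∈) → crB , ∈.∈-++⁺ʳ ys (∈.∈-++⁺ʳ hs′ b∈))
        where
        part : tile B b ≡ crossing → b ∈ zs → b ∈ ts′
        part crB b∈ with ∈.∈-++⁻ ys b∈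
        ... | inj₁ b∈ys = contradiction (trans (sym crB) (flatB (All.lookup ys-low b∈ys))) λ ()
        ... | inj₂ b∈′ with ∈.∈-++⁻ hs′ b∈′
        ...   | inj₁ b∈hs = contradiction (All.lookup hits b∈hs) ¬h
        ...   | inj₂ b∈ts = b∈ts

    hits-Hit : ∀ {j} (v : View j) → All Hit (hits v)
    hits-Hit (low m _)  = hit-Hit m ∷ []
    hits-Hit (high m _) = hit-Hit m ∷ []
    hits-Hit (off _ _)  = []

    hit-injective : ∀ {m m′} → hit m ≡ hit m′ → m ≡ m′
    hit-injective {m} {m′} eq = at-injective (trans (sym (hit-position m)) (trans (cong (southLabel ∘ bottom) eq) (hit-position m′)))

    common-hits : ∀ {j j′} (v : View j) (w : View j′) {ys} → All Low ys → All (λ b → ¬ Hit b) (tails w) →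
                  common A (hits v) (ys ++ hits w ++ tails w) ≡ val (meet v w)
    common-hits (off _ _) w ys-low missed = refl
    common-hits {j} {j′} v w {ys} ys-low missed = at-hit v w refl
      where
      single : ∀ m zs {t} → (t ≡ true → hit m ∈ zs) → (t ≡ false → ¬ hit m ∈ zs) → common A (hit m ∷ []) zs ≡ val t
      single m zs {true}  yes∈ _ = cong length (List.filter-accept (shared? A zs) {hit m} {[]} (Hit-crossing (hit-Hit m) , yes∈ refl))
      single m zs {false} _ no∈  = cong length (List.filter-reject (shared? A zs) {hit m} {[]} (λ (_ , h∈) → no∈ refl h∈))
      outside : ∀ m {hs ts} → All (λ b → ¬ Hit b) ts → ¬ hit m ∈ hs → ¬ hit m ∈ (ys ++ hs ++ ts)
      outside m {hs} missed ∉hs h∈ with ∈.∈-++⁻ ys h∈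
      ... | inj₁ h∈ys = low-miss (proj₂ (All.lookup ys-low h∈ys)) (hit-Hit m)
      ... | inj₂ h∈′ with ∈.∈-++⁻ hs h∈′
      ...   | inj₁ h∈hs = ∉hs h∈hs
      ...   | inj₂ h∈ts = All.lookup missed h∈ts (hit-Hit m)
      both : ∀ m m′ {ts} → All (λ b → ¬ Hit b) ts → common A (hit m ∷ []) (ys ++ hit m′ ∷ ts) ≡ val (does (m ℤ.≟ m′))
      both m m′ {ts} missed with m ℤ.≟ m′
      ... | yes refl = single m (ys ++ hit m ∷ ts) (λ _ → ∈.∈-++⁺ʳ ys (here refl)) λ ()
      ... | no  m≢m′ = single m (ys ++ hit m′ ∷ ts) (λ ()) λ _ → outside m {hit m′ ∷ []} missed λ { (here eq) → m≢m′ (hit-injective eq) }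
      at-hit : ∀ (v′ : View j) (w′ : View j′) → w ≡ w′ → common A (hits v′) (ys ++ hits w′ ++ tails w′) ≡ val (meet v′ w′)
      at-hit (low m _)  (low m′ _)  refl = both m m′ missed
      at-hit (low m _)  (high m′ _) refl = both m m′ missed
      at-hit (high m _) (low m′ _)  refl = both m m′ missed
      at-hit (high m _) (high m′ _) refl = both m m′ missed
      at-hit (low m _)  (off _ _)   refl = single m _ (λ ()) λ _ → outside m {[]} missed λ ()
      at-hit (high m _) (off _ _)   refl = single m _ (λ ()) λ _ → outside m {[]} missed λ ()
      at-hit (off _ _)  w′          refl = refl

    common-tails : ∀ {j j′} (v : View j) (w : View j′) → common A′ (past A′ (partner v)) (past A′ (partner w)) ≡ common A′ (tails v) (tails w)
    common-tails v w = begin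
      common A′ (past A′ (partner v)) (past A′ (partner w))   ≡⟨ cong₂ (common A′) (past′≡ F) (past′≡ G) ⟩
      common A′ (elbows′ F ++ hits v ++ tails v) (elbows′ G ++ hits w ++ tails w)
        ≡⟨ common-split A′ (λ (sb , lt) → flat′ sb lt) (lows′ F) (lows′ G) (hits-Hit w) (missed F) ⟩
      common A′ (hits v) (elbows′ G ++ hits w ++ tails w) ℕ.+ common A′ (tails v) (tails w)
        ≡⟨ cong (ℕ._+ common A′ (tails v) (tails w)) (common-elbows A′ _ (All.map Hit-elbow (hits-Hit v))) ⟩
      common A′ (tails v) (tails w)                           ∎
      where
      open ≡-Reasoning
      open Rerouted
      F = flipped v
      G = flipped w

    -- The flip costs two strands one common crossing exactly if they pass through the same
    -- translate of the box; the crossings in the rest of their pasts are unchanged.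
    common-flip : ∀ {j j′} (v : View j) (w : View j′) →
                  common A (past A j) (past A j′) ≡ val (meet v w) ℕ.+ common A′ (past A′ (partner v)) (past A′ (partner w))
    common-flip {j} {j′} v w = begin
      common A (past A j) (past A j′)                         ≡⟨ cong₂ (common A) (past≡ F) (past≡ G) ⟩
      common A (elbows F ++ hits v ++ tails v) (elbows G ++ hits w ++ tails w)
        ≡⟨ common-split A (λ (sb , lt) → flat sb lt) (lows F) (lows G) (hits-Hit w) (missed F) ⟩
      common A (hits v) (elbows G ++ hits w ++ tails w) ℕ.+ common A (tails v) (tails w)
        ≡⟨ cong₂ ℕ._+_ (common-hits v w (lows G) (missed G)) (common-cong A A′ (tails w) (All.map miss (missed F))) ⟩
      val (meet v w) ℕ.+ common A′ (tails v) (tails w)        ≡⟨ cong (val (meet v w) ℕ.+_) (common-tails v w) ⟨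
      val (meet v w) ℕ.+ common A′ (past A′ (partner v)) (past A′ (partner w)) ∎
      where
      open ≡-Reasoning
      open Rerouted
      F = flipped v
      G = flipped w

-- Length, parity and the number of crossings

module Count {n k : ℕ} .{{_ : NonZero n}} (P : LatticePath n k) where

  open Strip P
  open PathGeometry P
  open StripGeometry P
  open BoxGeometry P
  open Backtracking P
  open Strands P

  negative : (A : Filling) → Fin (length boxes) → Bool
  negative A p = does (lookup A p ≟ᵗ crossing) ∧ odd (prior A p)

  #negative : Filling → ℕ
  #negative A = ∑ℕ.sum (λ p → val (negative A p))

  -- The induction hypothesis. `parity` decides the sign of the next length change, the bounds in
  -- `bounded` keep the changed inversion in the window of `affineLength`, and `average` later
  -- places f in `𝐁`.
  record Counted (A : Filling) : Set where
    field
      f        : ℤ → ℤ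
      bounded  : Bounded n f (source A)
      parity   : ∀ j j′ → j ≢ j′ → (j <ᵇ j′) xor (source A j <ᵇ source A j′) ≡ odd (common A (past A j) (past A j′))
      average  : sumℤ (map (λ i → f i - i) [1⋯ n ]) ≡ + n * + k
      length≡  : #crossings A ≡ affineLength n f ℕ.+ 2 ℕ.* #negative A

  source-lower : ∀ A {j i} → source A j ≡ i → i ≤ j
  source-lower A {j} refl = proj₁ (back-bounds (past-back A j))

  source-upper : ∀ A {j i} → source A j ≡ i → j ≤ i + + n
  source-upper A {j} refl = proj₂ (back-bounds (past-back A j))

  module AllElbows (A : Filling) (none : ∀ p → lookup A p ≡ elbow) where

    flat : ∀ {c} → StripBox c → tile A c ≡ elbow
    flat {c} sb = listed (strip⇒listed sb)
      where
      listed : (∃ λ p → Translate (box p) c) → tile A c ≡ elbow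
      listed (p , tr) = trans (tile-class A tr) (none p)

    -- Without crossings the antidiagonal never changes, and on it the northern label is smaller
    -- than the southern one by k. So f can only be i ↦ i + k.
    back-label : ∀ {e bs i} → Back (tile A) e bs i → southLabel e ≡ i + + k
    back-label {e} (done nth) = shape (southLabel e) (+ k)
      where
      shape : ∀ u k → u ≡ u - k + k
      shape = solve-∀
    back-label (via {e} nth sb b) = begin
      southLabel e                                           ≡⟨ cong southLabel (exitEdge-entryEdge elbow e) ⟨
      southLabel (exitEdge elbow (proj₁ (entryEdge elbow (proj₁ e) c)) c) ≡⟨ southLabel-elbow (proj₁ e) c ⟨
      southLabel (entryEdge elbow (proj₁ e) c)               ≡⟨ cong (λ τ → southLabel (entryEdge τ (proj₁ e) c)) (flat sb) ⟨
      southLabel (entryEdge (tile A c) (proj₁ e) c)          ≡⟨ back-label b ⟩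
      _                                                      ∎
      where
      open ≡-Reasoning
      c = boxBefore e

    source+k : ∀ j → j ≡ source A j + + k
    source+k j = trans (sym (southLabel-south j)) (back-label (past-back A j))

    +k-cancel : ∀ {u v} → u + + k ≡ v + + k → u ≡ v
    +k-cancel {u} {v} eq = trans (isolate u (+ k)) (trans (cong (_- + k) eq) (sym (isolate v (+ k))))
      where
      isolate : ∀ u k → u ≡ u + k - k
      isolate = solve-∀

    source-inverse : ∀ i → source A (i + + k) ≡ i
    source-inverse i = +k-cancel (sym (source+k (i + + k)))

    <ᵇ-source : ∀ j j′ → j <ᵇ j′ ≡ source A j <ᵇ source A j′
    <ᵇ-source j j′ with +1≤-or-≤ (source A j) (source A j′)
    ... | inj₁ lt = trans (<ᵇ-true {j} {j′} (≤-by _ _ (lt ⊕ ≡⇒≤ (source+k j) ⊕ ≡⇒≤ (sym (source+k j′))) (shape j j′ (source A j) (source A j′) (+ k)))) (sym (<ᵇ-true {source A j} {source A j′} lt))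
      where
      shape : ∀ j j′ s s′ k → j′ + (s + 1ℤ + j + (s′ + k)) ≡ j + 1ℤ + (s′ + (s + k) + j′)
      shape = solve-∀
    ... | inj₂ ge = trans (<ᵇ-false {j} {j′} (≤-by _ _ (ge ⊕ ≡⇒≤ (source+k j′) ⊕ ≡⇒≤ (sym (source+k j))) (shape j j′ (source A j) (source A j′) (+ k)))) (sym (<ᵇ-false {source A j} {source A j′} ge))
      where
      shape : ∀ j j′ s s′ k → j + (s′ + j′ + (s + k)) ≡ j′ + (s + (s′ + k) + j)
      shape = solve-∀

    no-crossings : ∀ p → val (does (lookup A p ≟ᵗ crossing)) ≡ 0
    no-crossings p = cong (λ t → val (does (t ≟ᵗ crossing))) (none p)

    no-negatives : ∀ p → val (negative A p) ≡ 0
    no-negatives p = cong (λ t → val (does (t ≟ᵗ crossing) ∧ odd (prior A p))) (none p)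

    ∑-zero : ∀ {N} {u : Fin N → ℕ} → (∀ i → u i ≡ 0) → ∑ℕ.sum u ≡ 0
    ∑-zero {zero}  eq = refl
    ∑-zero {suc N} eq = cong₂ ℕ._+_ (eq zero) (∑-zero (eq ∘ suc))

    length-zero : affineLength n (_+ + k) ≡ 0
    length-zero = trans (affineLength-∑ n (_+ + k)) (∑-zero {n} λ s → ∑-zero {n} λ j →
      cong val (<ᵇ-false {label s + label j + + k} {label s + + k} (ℤ.+-monoˡ-≤ (+ k) (ℤ.i≤i+j (label s) (label j)))))

    average-k : sumℤ (map (λ i → i + + k - i) [1⋯ n ]) ≡ + n * + k
    average-k = trans (∑-map-allFin {n} (λ i → i + + k - i) label) (trans (constant {n} (λ s → shape (label s) (+ k))) (ℤ.pos-* n k))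
      where
      shape : ∀ u k → u + k - u ≡ k
      shape = solve-∀
      constant : ∀ {N} {u : Fin N → ℤ} → (∀ i → u i ≡ + k) → ∑ℤ.sum u ≡ + (N ℕ.* k)
      constant {zero}  eq = refl
      constant {suc N} eq = cong₂ _+_ (eq zero) (constant (eq ∘ suc))

    counted : Counted A
    counted = record
      { f       = _+ + k
      ; bounded = record
        { f∘b      = λ j → sym (source+k j)
        ; b∘f      = source-inverse
        ; periodic = λ i m → shape i (m * + n) (+ k)
        ; lower    = λ i → source-lower A (source-inverse i)
        ; upper    = λ i → source-upper A (source-inverse i)
        }
      ; parity  = λ j j′ _ → trans (cong (_xor (source A j <ᵇ source A j′)) (<ᵇ-source j j′))
                    (trans (xor-same (source A j <ᵇ source A j′)) (cong odd (sym (common-elbows A (past A j′) (All.map flat (back-strips (past-back A j)))))))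
      ; average = average-k
      ; length≡ = trans (trans (count-∑ crossing A) (∑-zero no-crossings)) (sym (cong₂ (λ u v → u ℕ.+ 2 ℕ.* v) length-zero (∑-zero no-negatives)))
      }
      where
      shape : ∀ i u k → i + u + k ≡ i + k + u
      shape = solve-∀

  #crossings-suc : ∀ A p → lookup A p ≡ crossing → #crossings A ≡ suc (#crossings (A [ p ]≔ elbow))
  #crossings-suc A p cr = begin
    #crossings A                                          ≡⟨ count-∑ crossing A ⟩
    ∑ℕ.sum (λ p′ → val (does (lookup A p′ ≟ᵗ crossing)))  ≡⟨ ∑ℕ-increase p at-p′ ⟩
    suc (∑ℕ.sum (λ p′ → val (does (lookup A′ p′ ≟ᵗ crossing)))) ≡⟨ cong suc (count-∑ crossing A′) ⟨
    suc (#crossings A′)                                   ∎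
    where
    open ≡-Reasoning
    A′ = A [ p ]≔ elbow
    at-p′ : ∀ p′ → val (does (lookup A p′ ≟ᵗ crossing)) ≡ val (does (lookup A′ p′ ≟ᵗ crossing)) ℕ.+ val (does (p′ Fin.≟ p))
    at-p′ p′ = compare (p′ Fin.≟ p)
      where
      compare : (d : Dec (p′ ≡ p)) → val (does (lookup A p′ ≟ᵗ crossing)) ≡ val (does (lookup A′ p′ ≟ᵗ crossing)) ℕ.+ val (does d)
      compare (yes refl) = trans (cong (λ t → val (does (t ≟ᵗ crossing))) cr)
        (cong (λ t → val (does (t ≟ᵗ crossing)) ℕ.+ 1) (sym (Vec.lookup∘update p A elbow)))
      compare (no p′≢p)  = trans (cong (λ t → val (does (t ≟ᵗ crossing))) (sym (Vec.lookup∘update′ p′≢p A elbow))) (sym (ℕ.+-identityʳ _))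

  module AddCrossing (A : Filling) (p : Fin (length boxes)) (cr : lookup A p ≡ crossing)
                     (last : ∀ p′ → rank (box p′) < rank (box p) → lookup A p′ ≡ elbow)
                     (C′ : Counted (A [ p ]≔ elbow)) where

    open Flip A p cr last
    open Counted C′ renaming (f to f′; bounded to bounded′; parity to parity′; average to average′; length≡ to length≡′)
    open Bounded bounded′ using () renaming (f∘b to f∘b′; b∘f to b∘f′)

    f : ℤ → ℤ
    f = swap ∘ f′

    f∘source : ∀ j → f (source A j) ≡ j
    f∘source j = trans (cong f (source-swap j)) (trans (cong swap (f∘b′ (swap j))) (swap-involutive j))

    source∘f : ∀ i → source A (f i) ≡ i
    source∘f i = trans (source-swap (f i)) (trans (cong (source A′) (swap-involutive (f′ i))) (b∘f′ i))

    bounded : Bounded n f (source A)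
    bounded = record
      { f∘b      = f∘source
      ; b∘f      = source∘f
      ; periodic = λ i m → trans (cong swap (Bounded.periodic bounded′ i m)) (swap-periodic (f′ i) m)
      -- The bounds come from the geometry of the filling A; those of f′ alone need not survive a
      -- transposition.
      ; lower    = λ i → source-lower A (source∘f i)
      ; upper    = λ i → source-upper A (source∘f i)
      }

    parity : ∀ j j′ → j ≢ j′ → (j <ᵇ j′) xor (source A j <ᵇ source A j′) ≡ odd (common A (past A j) (past A j′))
    parity j j′ j≢j′ = begin
      (j <ᵇ j′) xor (source A j <ᵇ source A j′)
        ≡⟨ cong₂ _xor_ (<ᵇ-partner j≢j′ v w) (cong₂ _<ᵇ_ (source-swap j) (source-swap j′)) ⟩
      (meet v w xor (partner v <ᵇ partner w)) xor (source A′ (partner v) <ᵇ source A′ (partner w))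
        ≡⟨ xor-assoc (meet v w) _ _ ⟩
      meet v w xor ((partner v <ᵇ partner w) xor (source A′ (partner v) <ᵇ source A′ (partner w)))
        ≡⟨ cong (meet v w xor_) (parity′ (partner v) (partner w) λ eq → j≢j′ (trans (sym (swap-involutive j)) (trans (cong swap eq) (swap-involutive j′)))) ⟩
      meet v w xor odd (common A′ (past A′ (partner v)) (past A′ (partner w)))
        ≡⟨ odd-val-+ (meet v w) (common A′ (past A′ (partner v)) (past A′ (partner w))) ⟨
      odd (val (meet v w) ℕ.+ common A′ (past A′ (partner v)) (past A′ (partner w)))
        ≡⟨ cong odd (common-flip v w) ⟨
      odd (common A (past A j) (past A j′)) ∎
      where
      open ≡-Reasoning
      v = view j
      w = view j′

    α β : ℤ
    α = source A′ position
    β = source A′ (position + 1ℤ)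

    at0 : at 0ℤ ≡ position
    at0 = ℤ.+-identityʳ position

    -- In A′ the two strands entering the box turn at its elbow and meet no crossing afterwards.
    -- What they shared before the box is therefore all that they share.
    prior-common : prior A p ≡ common A′ (past A′ (at 0ℤ)) (past A′ (at 0ℤ + 1ℤ))
    prior-common = begin
      common A (trace A n (left (box p))) (trace A n (top (box p)))
        ≡⟨ cong (λ c → common A (trace A n (left c)) (trace A n (top c))) hit0 ⟨
      common A (trace A n (left (hit 0ℤ))) (trace A n (top (hit 0ℤ)))
        ≡⟨ cong₂ (common A) (trace-back A n (enters 0ℤ U) (Above.short (entering 0ℤ U))) (trace-back A n (enters 0ℤ R) (Above.short (entering 0ℤ R))) ⟩
      common A (tail 0ℤ U) (tail 0ℤ R)
        ≡⟨ common-cong A A′ (tail 0ℤ R) (All.map miss (tail-miss 0ℤ U)) ⟩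
      common A′ (tail 0ℤ U) (tail 0ℤ R)
        ≡⟨ common-tails (high 0ℤ refl) (low 0ℤ refl) ⟨
      common A′ (past A′ (at 0ℤ)) (past A′ (at 0ℤ + 1ℤ)) ∎
      where
      open ≡-Reasoning
      hit0 : hit 0ℤ ≡ box p
      hit0 = trans (hit≡ 0ℤ) (cong₂ _,_ (ℤ.+-identityʳ (proj₁ (box p))) (ℤ.+-identityʳ (proj₂ (box p))))

    -- Since no crossing follows p, the strands through p have crossed an even
    -- number of times before iff A′ keeps them in order.
    prior-parity : odd (prior A p) ≡ not (α <ᵇ β)
    prior-parity = begin
      odd (prior A p)                                                            ≡⟨ cong odd prior-common ⟩
      odd (common A′ (past A′ (at 0ℤ)) (past A′ (at 0ℤ + 1ℤ)))                   ≡⟨ parity′ (at 0ℤ) (at 0ℤ + 1ℤ) (at≢at+1 {0ℤ} {0ℤ}) ⟨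
      (at 0ℤ <ᵇ at 0ℤ + 1ℤ) xor (source A′ (at 0ℤ) <ᵇ source A′ (at 0ℤ + 1ℤ))    ≡⟨ cong₂ _xor_ (<ᵇ-true {at 0ℤ} {at 0ℤ + 1ℤ} ℤ.≤-refl) (cong (λ u → source A′ u <ᵇ source A′ (u + 1ℤ)) at0) ⟩
      not (α <ᵇ β)                                                               ∎
      where open ≡-Reasoning

    swap-position : swap position ≡ position + 1ℤ
    swap-position = trans (cong swap (sym at0)) (trans (swap-at 0ℤ) (cong (_+ 1ℤ) at0))

    swap-position+1 : swap (position + 1ℤ) ≡ position
    swap-position+1 = trans (cong swap (sym swap-position)) (swap-involutive position)

    negative-step : ∀ p′ → val (negative A p′) ≡ val (negative A′ p′) ℕ.+ val (does (p′ Fin.≟ p) ∧ odd (prior A p))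
    negative-step p′ = compare (p′ Fin.≟ p)
      where
      compare : (d : Dec (p′ ≡ p)) → val (negative A p′) ≡ val (negative A′ p′) ℕ.+ val (does d ∧ odd (prior A p))
      compare (yes refl) = trans (cong (λ t → val (does (t ≟ᵗ crossing) ∧ odd (prior A p))) cr)
        (cong (λ t → val (does (t ≟ᵗ crossing) ∧ odd (prior A′ p)) ℕ.+ val (odd (prior A p))) (sym (Vec.lookup∘update p A elbow)))
      compare (no p′≢p)  = trans (same (lookup A p′) refl) (sym (ℕ.+-identityʳ _))
        where
        same : ∀ t → lookup A p′ ≡ t → val (negative A p′) ≡ val (negative A′ p′)
        same elbow    eq = trans (cong (λ t → val (does (t ≟ᵗ crossing) ∧ odd (prior A p′))) eq)
          (cong (λ t → val (does (t ≟ᵗ crossing) ∧ odd (prior A′ p′))) (sym (trans (other p′≢p) eq)))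
        same crossing eq = cong₂ (λ t m → val (does (t ≟ᵗ crossing) ∧ odd m)) (sym (other p′≢p)) (prior-local A A′ p′ agree)
          where
          -- The only difference is at p, and p″ = p would give p′ a lower rank than p, which makes
          -- p′ an elbow.
          agree : ∀ p″ → rank (box p′) < rank (box p″) → lookup A p″ ≡ lookup A′ p″
          agree p″ lt = sym (other λ p″≡p → contradiction (trans (sym eq) (last p′ (subst (λ u → rank (box p′) < rank (box u)) p″≡p lt))) λ ())

    length≡ : #crossings A ≡ affineLength n f ℕ.+ 2 ℕ.* #negative A
    length≡ = by (α ℤ.<? β) prior-parity
      where
      open ≡-Reasoning
      shape : ∀ l m → suc (suc l ℕ.+ 2 ℕ.* m) ≡ l ℕ.+ 2 ℕ.* suc m
      shape = ℕ-Solver.solve-∀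
      by : (d : Dec (α < β)) → odd (prior A p) ≡ not (does d) → #crossings A ≡ affineLength n f ℕ.+ 2 ℕ.* #negative A
      by (yes α<β) even = begin
        #crossings A                                           ≡⟨ #crossings-suc A p cr ⟩
        suc (#crossings A′)                                    ≡⟨ cong suc length≡′ ⟩
        suc (affineLength n f′) ℕ.+ 2 ℕ.* #negative A′         ≡⟨ cong₂ (λ l m → l ℕ.+ 2 ℕ.* m) (sym longer) (sym same) ⟩
        affineLength n f ℕ.+ 2 ℕ.* #negative A                 ∎
        where
        longer : affineLength n f ≡ suc (affineLength n f′)
        longer = length-swap bounded′ (Bounded.lower bounded) (Bounded.upper bounded) α<β
        same : #negative A ≡ #negative A′
        same = ∑ℕ.sum-cong-≗ {_} {λ p′ → val (negative A p′)} {λ p′ → val (negative A′ p′)} λ p′ → trans (negative-step p′)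
          (trans (cong (λ t → val (negative A′ p′) ℕ.+ val t) (trans (cong (does (p′ Fin.≟ p) ∧_) even) (∧-zeroʳ _))) (ℕ.+-identityʳ _))
      by (no α≮β) isOdd = begin
        #crossings A                                           ≡⟨ #crossings-suc A p cr ⟩
        suc (#crossings A′)                                    ≡⟨ cong suc length≡′ ⟩
        suc (affineLength n f′ ℕ.+ 2 ℕ.* #negative A′)         ≡⟨ cong (λ l → suc (l ℕ.+ 2 ℕ.* #negative A′)) shorter ⟩
        suc (suc (affineLength n f) ℕ.+ 2 ℕ.* #negative A′)    ≡⟨ shape (affineLength n f) (#negative A′) ⟩
        affineLength n f ℕ.+ 2 ℕ.* suc (#negative A′)          ≡⟨ cong (λ m → affineLength n f ℕ.+ 2 ℕ.* m) more ⟨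
        affineLength n f ℕ.+ 2 ℕ.* #negative A                 ∎
        where
        α≢β : α ≢ β
        α≢β eq = position≢ (trans (sym (b-inj position)) (trans (cong f′ eq) (b-inj (position + 1ℤ))))
          where
          b-inj = f∘b′
          position≢ : position ≢ position + 1ℤ
          position≢ e = at≢at+1 {0ℤ} {0ℤ} (trans at0 (trans e (cong (_+ 1ℤ) (sym at0))))
        β<α : source A position < source A (position + 1ℤ)
        β<α = subst₂ _<_ (sym (trans (source-swap position) (cong (source A′) swap-position)))
                         (sym (trans (source-swap (position + 1ℤ)) (cong (source A′) swap-position+1)))
                (ℤ.≤∧≢⇒< (ℤ.≮⇒≥ α≮β) (α≢β ∘ sym))
        -- The roles are exchanged: swap ∘ f equals f′, and seen from f the two sources are in the
        -- order that `length-swap` asks for.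
        shorter : affineLength n f′ ≡ suc (affineLength n f)
        shorter = trans (affineLength-cong n λ i → sym (swap-involutive (f′ i)))
          (length-swap bounded (λ i → ℤ.≤-trans (Bounded.lower bounded′ i) (ℤ.≤-reflexive (sym (swap-involutive (f′ i)))))
                               (λ i → ℤ.≤-trans (ℤ.≤-reflexive (swap-involutive (f′ i))) (Bounded.upper bounded′ i)) β<α)
        more : #negative A ≡ suc (#negative A′)
        more = ∑ℕ-increase p {λ p′ → val (negative A p′)} {λ p′ → val (negative A′ p′)} λ p′ → trans (negative-step p′)
          (cong (λ t → val (negative A′ p′) ℕ.+ val t) (trans (cong (does (p′ Fin.≟ p) ∧_) isOdd) (∧-identityʳ _)))

    counted : Counted A
    counted = record
      { f       = f
      ; bounded = bounded
      ; parity  = parity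
      ; average = trans (average-swap bounded′) average′
      ; length≡ = length≡
      }

  counted : ∀ A → Counted A
  counted A = by-crossings (#crossings A) A refl
    where
    Last : Filling → Set
    Last A = (∀ p → lookup A p ≡ elbow) ⊎ ∃ λ p → lookup A p ≡ crossing × (∀ p′ → rank (box p′) < rank (box p) → lookup A p′ ≡ elbow)

    mutual
      by-crossings : ∀ m A → #crossings A ≡ m → Counted A
      by-crossings m A eq = removing m A eq (lastCrossing (rank ∘ box) A)

      removing : ∀ m A → #crossings A ≡ m → Last A → Counted A
      removing m       A eq (inj₁ none)            = AllElbows.counted A none
      removing zero    A eq (inj₂ (p , cr , last)) = contradiction (trans (sym (#crossings-suc A p cr)) eq) λ ()
      removing (suc m) A eq (inj₂ (p , cr , last)) = AddCrossing.counted A p cr last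
        (by-crossings m (A [ p ]≔ elbow) (ℕ.suc-injective (trans (sym (#crossings-suc A p cr)) eq)))

-- The sum over all fillings

even⇒¬odd : ∀ {m} → 2 ∣ m → odd m ≡ false
even⇒¬odd (divides q refl) = double q
  where
  double : ∀ q → odd (q ℕ.* 2) ≡ false
  double zero    = refl
  double (suc q) = trans (not-involutive (odd (q ℕ.* 2))) (double q)

¬odd⇒even : ∀ m → odd m ≡ false → 2 ∣ m
¬odd⇒even zero          _  = divides 0 refl
¬odd⇒even (suc (suc m)) eq with divides q refl ← ¬odd⇒even m (trans (sym (not-involutive (odd m))) eq) = divides (suc q) refl

module Words {n k : ℕ} .{{_ : NonZero n}} (P : LatticePath n k) where

  open Strip P
  open Strands P
  open Count P

  module _ (A : Filling) where

    open Counted (counted A)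
    open Bounded bounded

    offset : ∀ i → ∃ λ m → f i ≡ i + + m
    offset i = upTo (lower i)

    offset< : ∀ i → proj₁ (offset i) ℕ.< suc n
    offset< i = ℕ.s≤s (ℤ.drop‿+≤+ (≤-by (+ proj₁ (offset i)) (+ n) (upper i ⊕ ≡⇒≤ (sym (proj₂ (offset i)))) (shape i (f i) (+ proj₁ (offset i)) (+ n))))
      where
      shape : ∀ i f m n → n + (f + (i + m)) ≡ m + (i + n + f)
      shape = solve-∀

    offsets : Vec (Fin (suc n)) n
    offsets = Vec.tabulate (λ s → fromℕ< (offset< (label s)))

    toℕ-offsets : ∀ s → toℕ (lookup offsets s) ≡ proj₁ (offset (label s))
    toℕ-offsets s = trans (cong toℕ (Vec.lookup∘tabulate (λ s → fromℕ< (offset< (label s))) s)) (Fin.toℕ-fromℕ< (offset< (label s)))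

    extend-offsets : ∀ i → extend offsets i ≡ f i
    extend-offsets i = begin
      i + + toℕ (lookup offsets s)                      ≡⟨ cong₂ (λ u v → u + + v) (label-split {n} i) (toℕ-offsets s) ⟩
      label s + m * + n + + proj₁ (offset (label s))    ≡⟨ shape (label s) (m * + n) (+ proj₁ (offset (label s))) ⟩
      label s + + proj₁ (offset (label s)) + m * + n    ≡⟨ cong (_+ m * + n) (proj₂ (offset (label s))) ⟨
      f (label s) + m * + n                             ≡⟨ periodic (label s) m ⟨
      f (label s + m * + n)                             ≡⟨ cong f (label-split {n} i) ⟨
      f i                                               ∎
      where
      open ≡-Reasoning
      s : Fin n
      s = residue i
      m : ℤ
      m = period {n} i
      shape : ∀ u v w → u + v + w ≡ u + w + v
      shape = solve-∀

    strand-f : ∀ i → strand A i ≡ f i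
    strand-f i = trans (cong (strand A) (sym (b∘f i))) (strand-source A (f i))

    strand-offsets : ∀ (s : Fin n) → strand A (label s) ≡ extend offsets (label s)
    strand-offsets s = trans (strand-f (label s)) (sym (extend-offsets (label s)))

    -- The values on [n] determine the offsets, so the strand condition in `IsDeogram` singles out
    -- one word for each filling.
    offsets-unique : ∀ d → (∀ (s : Fin n) → strand A (label s) ≡ extend d (label s)) → d ≡ offsets
    offsets-unique d strands = begin
      d                              ≡⟨ Vec.tabulate∘lookup d ⟨
      Vec.tabulate (lookup d)        ≡⟨ Vec.tabulate-cong same ⟩
      Vec.tabulate (lookup offsets)  ≡⟨ Vec.tabulate∘lookup offsets ⟩
      offsets                        ∎
      where
      open ≡-Reasoning
      isolate : ∀ u v → v ≡ u + v - u
      isolate = solve-∀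
      at-residue : ∀ e (s : Fin n) → extend e (label s) ≡ label s + + toℕ (lookup e s)
      at-residue e s = cong (λ r → label s + + toℕ (lookup e r)) (label-residue e s)
      same : ∀ s → lookup d s ≡ lookup offsets s
      same s = Fin.toℕ-injective (ℤ.+-injective (trans (isolate (label s) (+ toℕ (lookup d s)))
        (trans (cong (_- label s) (trans (sym (at-residue d s)) (trans (sym (strands s)) (trans (strand-offsets s) (at-residue offsets s)))))
          (sym (isolate (label s) (+ toℕ (lookup offsets s)))))))

    offsets-bounded : IsBounded n k (extend offsets)
    offsets-bounded = record
      { periodic  = λ i → subst (λ u → extend offsets (i + u) ≡ extend offsets i + u) (ℤ.*-identityˡ (+ n)) (extend-+ offsets i 1ℤ)
      ; bijective = (λ {i} {j} eq → f-injective (trans (sym (extend-offsets i)) (trans eq (extend-offsets j)))) ,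
                    λ j → source A j , λ { refl → trans (extend-offsets (source A j)) (f∘b j) }
      ; average   = trans (cong sumℤ (List.map-cong (λ i → cong (_- i) (extend-offsets i)) [1⋯ n ])) average
      ; lower     = λ i → ℤ.≤-trans (lower i) (≡⇒≤ (sym (extend-offsets i)))
      ; upper     = λ i → ℤ.≤-trans (≡⇒≤ (extend-offsets i)) (upper i)
      }

    -- By `length≡` the difference is twice `#negative A`, so truncated subtraction and integer
    -- halving lose nothing.
    exponent : (#crossings A ℕ.∸ affineLength n (extend offsets)) ℕ./ 2 ≡ #negative A
    exponent = begin
      (#crossings A ℕ.∸ affineLength n (extend offsets)) ℕ./ 2                 ≡⟨ cong₂ (λ c l → (c ℕ.∸ l) ℕ./ 2) length≡ (affineLength-cong n extend-offsets) ⟩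
      (affineLength n f ℕ.+ 2 ℕ.* #negative A ℕ.∸ affineLength n f) ℕ./ 2      ≡⟨ cong (ℕ._/ 2) (ℕ.m+n∸m≡n (affineLength n f) (2 ℕ.* #negative A)) ⟩
      2 ℕ.* #negative A ℕ./ 2                                                  ≡⟨ cong (ℕ._/ 2) (ℕ.*-comm 2 (#negative A)) ⟩
      #negative A ℕ.* 2 ℕ./ 2                                                  ≡⟨ ℕ.m*n/n≡m (#negative A) 2 ⟩
      #negative A                                                              ∎
      where open ≡-Reasoning

module Total {c ℓ} (𝓡 : CommutativeRing c ℓ) (q : CommutativeRing.Carrier 𝓡) where

  open CommutativeRing 𝓡 hiding (zero)
    renaming (_+_ to _+ʳ_; _*_ to _*ʳ_; _-_ to _-ʳ_; -_ to -ʳ_; refl to ≈-refl; sym to ≈-sym; trans to ≈-trans)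
  open Evaluation 𝓡
  open Sums 𝓡
  open import Relation.Binary.Reasoning.Setoid setoid
  import Algebra.Properties.CommutativeSemigroup *-commutativeSemigroup as *-Properties

  weight : Tile → Bool → Carrier
  weight crossing false = 1#
  weight crossing true  = q
  weight elbow    false = q -ʳ 1#
  weight elbow    true  = 0#

  weight-total : ∀ b → weight crossing b +ʳ weight elbow b ≈ q
  weight-total true  = +-identityʳ q
  weight-total false = begin
    1# +ʳ (q -ʳ 1#)         ≈⟨ +-congˡ (+-comm q (-ʳ 1#)) ⟩
    1# +ʳ (-ʳ 1# +ʳ q)      ≈⟨ +-assoc 1# (-ʳ 1#) q ⟨
    1# -ʳ 1# +ʳ q           ≈⟨ +-congʳ (-‿inverseʳ 1#) ⟩
    0# +ʳ q                 ≈⟨ +-identityˡ q ⟩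
    q                       ∎

  prod-weight : ∀ {N} (A : Vec Tile N) (o : Fin N → Bool) → (∀ p → lookup A p ≡ elbow → o p ≡ false) →
                prod (λ p → weight (lookup A p) (o p)) ≈
                (q -ʳ 1#) ^ count (_≟ᵗ elbow) A *ʳ q ^ ∑ℕ.sum (λ p → val (does (lookup A p ≟ᵗ crossing) ∧ o p))
  prod-weight []      o even = ≈-sym (*-identityˡ 1#)
  prod-weight (t ∷ A) o even = head t (o zero) (even zero)
    where
    ih = prod-weight A (o ∘ suc) (even ∘ suc)
    negatives = ∑ℕ.sum (λ p → val (does (lookup A p ≟ᵗ crossing) ∧ o (suc p)))
    head : ∀ t b → (t ≡ elbow → b ≡ false) → weight t b *ʳ prod (λ p → weight (lookup A p) (o (suc p))) ≈
           (q -ʳ 1#) ^ count (_≟ᵗ elbow) (t ∷ A) *ʳ q ^ (val (does (t ≟ᵗ crossing) ∧ b) ℕ.+ negatives)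
    head crossing false _  = ≈-trans (*-identityˡ _) ih
    head crossing true  _  = ≈-trans (*-congˡ ih) (*-Properties.x∙yz≈y∙xz _ _ _)
    head elbow    false _  = ≈-trans (*-congˡ ih) (≈-sym (*-assoc _ _ _))
    head elbow    true  ev = contradiction (ev refl) λ ()

  prod-zero : ∀ {N} (u : Fin N → Carrier) p → u p ≈ 0# → prod u ≈ 0#
  prod-zero u zero    u≈0 = ≈-trans (*-congʳ u≈0) (zeroˡ _)
  prod-zero u (suc p) u≈0 = ≈-trans (*-congˡ (prod-zero (u ∘ suc) p u≈0)) (zeroʳ _)

  module _ {n k : ℕ} .{{_ : NonZero n}} (P : LatticePath n k) where

    open Strip P
    open BoxGeometry P using (rank; length-boxes)
    open Strands P
    open Count P
    open Words P

    w : Fin (length boxes) → Filling → Carrier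
    w p A = weight (lookup A p) (odd (prior A p))

    w-local : ∀ p A B → lookup A p ≡ lookup B p → (∀ p′ → rank (box p) < rank (box p′) → lookup A p′ ≡ lookup B p′) → w p A ≈ w p B
    w-local p A B eq agree = reflexive (cong₂ (λ t m → weight t (odd m)) eq (prior-local A B p agree))

    -- Changing the tile at p does not affect the history of its own box, so both choices are
    -- weighted with the same parity.
    w-total : ∀ p A → w p (A [ p ]≔ crossing) +ʳ w p (A [ p ]≔ elbow) ≈ q
    w-total p A = begin
      w p (A [ p ]≔ crossing) +ʳ w p (A [ p ]≔ elbow)
        ≡⟨ cong₂ _+ʳ_ (cong (λ t → weight t b) (Vec.lookup∘update p A crossing))
                        (cong₂ (λ t m → weight t (odd m)) (Vec.lookup∘update p A elbow) (prior-local (A [ p ]≔ elbow) (A [ p ]≔ crossing) p agree)) ⟩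
      weight crossing b +ʳ weight elbow b ≈⟨ weight-total b ⟩
      q ∎
      where
      b : Bool
      b = odd (prior (A [ p ]≔ crossing) p)
      agree : ∀ p′ → rank (box p) < rank (box p′) → lookup (A [ p ]≔ elbow) p′ ≡ lookup (A [ p ]≔ crossing) p′
      agree p′ lt = trans (Vec.lookup∘update′ p′≢p A elbow) (sym (Vec.lookup∘update′ p′≢p A crossing))
        where
        p′≢p : p′ ≢ p
        p′≢p eq = ℤ.<-irrefl (cong (rank ∘ box) (sym eq)) lt

    term : Filling → (ℤ → ℤ) → Carrier
    term A f = (q -ʳ 1#) ^ #elbows A *ʳ q ^ ((#crossings A ℕ.∸ affineLength n f) ℕ./ 2)

    -- The two filters in the definition of g become conditionals with default 0, so that both sums
    -- run over fixed lists and can be exchanged.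
    summand : Filling → Vec (Fin (suc n)) n → Carrier
    summand A d = if does (isBounded? d k) then (if does (isDeogram? A (extend d)) then term A (extend d) else 0#) else 0#

    private
      if-zero : ∀ b {u} → u ≈ 0# → (if b then u else 0#) ≈ 0#
      if-zero true  u≈0 = u≈0
      if-zero false _   = ≈-refl

      if-∑ : ∀ {a} {S : Set a} b (xs : List S) {u} → (if b then ∑ xs u else 0#) ≈ (∑[ x ∈ xs ] (if b then u x else 0#))
      if-∑ true  xs = ≈-refl
      if-∑ false xs = ≈-sym (∑-zero xs λ _ → ≈-refl)

      if-true : ∀ {b} {u : Carrier} → b ≡ true → (if b then u else 0#) ≈ u
      if-true refl = ≈-refl

    g-∑ : g P q ≈ (∑[ A ∈ fillings ] ∑[ d ∈ words (allFin (suc n)) n ] summand A d)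
    g-∑ = begin
      g P q
        ≈⟨ ∑-map extend (filter (λ d → isBounded? d k) ws) ⟩
      ∑[ d ∈ filter (λ d → isBounded? d k) ws ] Rpoly P q (extend d)
        ≈⟨ ∑-filter (λ d → isBounded? d k) ws ⟩
      ∑[ d ∈ ws ] (if does (isBounded? d k) then Rpoly P q (extend d) else 0#)
        ≈⟨ ∑-cong ws expand ⟩
      ∑[ d ∈ ws ] ∑[ A ∈ fillings ] summand A d
        ≈⟨ ∑-swap ws fillings (λ d A → summand A d) ⟩
      ∑[ A ∈ fillings ] ∑[ d ∈ ws ] summand A d ∎
      where
      ws = words (allFin (suc n)) n
      expand : ∀ d → (if does (isBounded? d k) then Rpoly P q (extend d) else 0#) ≈ (∑[ A ∈ fillings ] summand A d)
      expand d = ≈-trans (if-cong (does (isBounded? d k)) (∑-filter (λ A → isDeogram? A (extend d)) fillings))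
                       (if-∑ (does (isBounded? d k)) fillings)
        where
        if-cong : ∀ b {u v} → u ≈ v → (if b then u else 0#) ≈ (if b then v else 0#)
        if-cong true  u≈v = u≈v
        if-cong false _   = ≈-refl

    deogram-weight : ∀ A (D? : Dec (IsDeogram A (extend (offsets A)))) →
                     (if does D? then term A (extend (offsets A)) else 0#) ≈ prod (λ p → w p A)
    deogram-weight A (yes D) = begin
      (q -ʳ 1#) ^ #elbows A *ʳ q ^ ((#crossings A ℕ.∸ affineLength n (extend (offsets A))) ℕ./ 2)
        ≡⟨ cong (λ e → (q -ʳ 1#) ^ #elbows A *ʳ q ^ e) (exponent A) ⟩
      (q -ʳ 1#) ^ #elbows A *ʳ q ^ #negative A
        ≈⟨ prod-weight A (λ p → odd (prior A p)) (λ p el → even⇒¬odd (IsDeogram.elbows D p el)) ⟨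
      prod (λ p → w p A) ∎
    -- The strand condition holds for `offsets A`, so what fails is the condition at some elbow,
    -- which then follows an odd number of crossings and has weight 0.
    deogram-weight A (no ¬D) = ≈-sym (violated (Fin.¬∀⟶∃¬ (length boxes) _ (λ p → (lookup A p ≟ᵗ elbow) →-dec (2 ∣? prior A p))
                                   λ evens → ¬D (record { strands = strand-offsets A ; elbows = evens })))
      where
      violated : (∃ λ p → ¬ (lookup A p ≡ elbow → 2 ∣ prior A p)) → prod (λ p → w p A) ≈ 0#
      violated (p , ¬even) = prod-zero (λ p → w p A) p (reflexive (vanish (lookup A p) (odd (prior A p)) refl refl))
        where
        vanish : ∀ t b → lookup A p ≡ t → odd (prior A p) ≡ b → weight t b ≡ 0#
        vanish elbow    true  _  _ = refl
        vanish elbow    false _  o = contradiction (λ _ → ¬odd⇒even (prior A p) o) ¬even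
        vanish crossing _     cr _ = contradiction (λ el → contradiction (trans (sym cr) el) λ ()) ¬even

    ∑-summand : ∀ A → (∑[ d ∈ words (allFin (suc n)) n ] summand A d) ≈ prod (λ p → w p A)
    ∑-summand A = begin
      ∑[ d ∈ words (allFin (suc n)) n ] summand A d
        ≈⟨ ∑-words (offsets A) elsewhere ⟩
      summand A (offsets A)
        ≈⟨ if-true (dec-true (isBounded? (offsets A) k) (offsets-bounded A)) ⟩
      (if does (isDeogram? A (extend (offsets A))) then term A (extend (offsets A)) else 0#)
        ≈⟨ deogram-weight A (isDeogram? A (extend (offsets A))) ⟩
      prod (λ p → w p A) ∎
      where
      elsewhere : ∀ d → d ≢ offsets A → summand A d ≈ 0#
      elsewhere d d≢ = if-zero (does (isBounded? d k)) (reflexive (cong (λ b → if b then term A (extend d) else 0#)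
        (dec-false (isDeogram? A (extend d)) λ D → d≢ (offsets-unique A d (IsDeogram.strands D)))))

    g-value : g P q ≈ q ^ (k ℕ.* (n ℕ.∸ k))
    g-value = begin
      g P q                                     ≈⟨ g-∑ ⟩
      ∑[ A ∈ fillings ] ∑[ d ∈ words (allFin (suc n)) n ] summand A d ≈⟨ ∑-cong fillings ∑-summand ⟩
      ∑[ A ∈ fillings ] prod (λ p → w p A)      ≈⟨ triangular (length boxes) (rank ∘ box) w q w-local w-total ⟩
      q ^ length boxes                          ≡⟨ cong (q ^_) (trans length-boxes (ℕ.*-comm (n ℕ.∸ k) k)) ⟩
      q ^ (k ℕ.* (n ℕ.∸ k))                     ∎

proposition5p2 : ∀ {c ℓ} (𝓡 : CommutativeRing c ℓ) (q : CommutativeRing.Carrier 𝓡) (n k : ℕ) .{{_ : NonZero n}} → k ℕ.≤ n → (P : LatticePath n k) →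
    let open CommutativeRing 𝓡 using (_≈_)
        open Evaluation 𝓡
    in g P q ≈ q ^ (k ℕ.* (n ℕ.∸ k))
proposition5p2 𝓡 q n k _ P = Total.g-value 𝓡 q P
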